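{- Let $\Pi$ be a line-parallelism of $\Sigma_\eta$ comprising the Desarguesian spread $\mathcal{D}_\eta$ and $q^2+q$ Hall spreads, which are obtained by switching the $q^2+q$ reguli of $\mathcal{D}_\eta$ through the line $r_{U_1}\cap\Sigma_\eta$; that is, for each regulus $\mathcal{R}\subset\mathcal{D}_\eta$ containing $r_{U_1}\cap\Sigma_\eta$, $\Pi$ contains exactly one Hall spread of the form $(\mathcal{S}\setminus\mathcal{R})\cup\mathcal{R}^{o}$, where $\mathcal{S}$ is a Desarguesian line-spread of $\Sigma_\eta$ containing $\mathcal{R}$ and $\mathcal{R}^{o}$ is the regulus opposite to $\mathcal{R}$. If $\Pi$ is left invariant by $E$, then there exists a good set $\mathcal{P}$ such that $\Pi=\Pi_{\mathcal{P}}$.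
   Context: Throughout, $q\ge 3$ is a prime power. Points of $\mathrm{PG}(3,q^2)$ have homogeneous coordinates $(x_1,x_2,x_3,x_4)$; $U_i$ is the point with $1$ in position $i$ and $0$ elsewhere; $t_1=\langle U_1,U_2\rangle$, $t_2=\langle U_3,U_4\rangle$, $r_{U_1}=\langle U_1,U_3\rangle$. Let $\Lambda\subset\mathbb{F}_{q^2}\setminus\{0\}$ be a fixed set of $q-1$ elements with pairwise distinct norms $\alpha^{q+1}$. For $\alpha\in\Lambda$, $\tau_\alpha:(x_1,x_2,x_3,x_4)\mapsto(x_3^q,x_4^q,\alpha^{q+1}x_1^q,\alpha^{q+1}x_2^q)$ is an involution whose set of fixed points is the Baer subgeometry $\Sigma_\alpha=\{(x,y,\alpha x^q,\alpha y^q): x,y\in\mathbb{F}_{q^2},(x,y)\neq(0,0)\}\simeq\mathrm{PG}(3,q)$. Let $\mathcal{U}=\{u\in\mathbb{F}_{q^2}:u^{q+1}=1\}$ and let $\eta$ be the unique element of $\mathcal{U}\cap\Lambda$. $E$ is the group of projectivities given (acting on column vectors on the left) by the matrices $\begin{pmatrix}1&b&0&0\\0&1&0&0\\0&0&1&b^q\\0&0&0&1\end{pmatrix}$, $b\in\mathbb{F}_{q^2}$. A set $A=\{a_1,\dots,a_t\}\subset\mathbb{F}_q\setminus\{0\}$ is fixed as follows. If $q$ is even, $t=(q-2)/2$ and $\{1\}\cup A\cup A^{ -1}=\mathbb{F}_q\setminus\{0\}$ is a partition. If $q$ is odd, $t=(q-3)/2$, $\{\pm1\}\cup A\cup A^{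 -1}=\mathbb{F}_q\setminus\{0\}$ is a partition, and $-a\notin A$ for every $a\in A$. Put $\mathcal{I}=\{\alpha\in\Lambda:\alpha^{q+1}\in A\}$ if $q$ is even and $\mathcal{I}=\{\alpha\in\Lambda:\alpha^{q+1}\in A\cup\{ -1\}\}$ if $q$ is odd. For $P\in t_1$ let $r_P=\langle P,P^{\tau_\eta}\rangle$. $\mathcal{D}_\eta=\{r_P\cap\Sigma_\eta:P\in t_1\}$ is a Desarguesian line-spread of $\Sigma_\eta$. If $\ell$ is a line of $\mathrm{PG}(3,q^2)$ with $\ell,\ell^{\tau_\eta}$ skew, $\mathcal{S}_\ell=\{\langle P,P^{\tau_\eta}\rangle\cap\Sigma_\eta:P\in\ell\}$. For $\alpha\in\mathcal{I}$, $u,v\in\mathcal{U}$: $P_{\alpha u}=(1,0,\alpha u,0)$; $\pi_{\alpha v}$ is the plane $X_4=\alpha vX_2$ (it contains $r_{U_1}$ and meets $\Sigma_\alpha$ in a Baer subplane); $p(P_{\alpha u},\pi_{\alpha v})$ is the set of the $q+1$ lines of $\pi_{\alpha v}$ through $P_{\alpha u}$ meeting $\pi_{\alpha v}\cap\Sigma_\alpha$ in a Baer subline (one is $r_{U_1}$). For each $\ell\ne r_{U_1}$ in such a set, $\mathcal{R}_\ell:=\mathcal{D}_\eta\cap\mathcal{S}_\ell$ is a regulus through $r_{U_1}\cap\Sigma_\eta$ and $\mathcal{R}_\ell^{o}$ is its opposite. A good set is a set $\mathcal{P}$ of $q+1$ pairs $(P_{\alpha_iu_i},\pi_{\alpha_iv_i})$,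 $\alpha_i\in\mathcal{I}$, $u_i,v_i\in\mathcal{U}$, such that any two members with $(\alpha_i,u_i,v_i)\ne(\alpha_j,u_j,v_j)$ satisfy $u_iv_j-v_iu_j\neq0$ and $\alpha_iu_i(\alpha_jv_j)^q-(\alpha_iv_i)^q\alpha_ju_j\neq0$. Then $\mathcal{L}_{\mathcal{P}}$ is the set of lines $\ne r_{U_1}$ lying in some $p(P_{\alpha_iu_i},\pi_{\alpha_iv_i})$ with $(P_{\alpha_iu_i},\pi_{\alpha_iv_i})\in\mathcal{P}$, and $\Pi_{\mathcal{P}}=\{(\mathcal{S}_\ell\setminus\mathcal{R}_\ell)\cup\mathcal{R}_\ell^{o}:\ell\in\mathcal{L}_{\mathcal{P}}\}\cup\{\mathcal{D}_\eta\}$. -}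

module Defs where

open import Level using (0ℓ)
open import Algebra.Bundles using (CommutativeRing)
open import Algebra.Structures using (IsCommutativeRing)
import Algebra.Properties.Semiring.Exp as SemiringExp
open import Data.Fin using (Fin; #_)
open import Data.Nat as ℕ using (ℕ; suc; _∸_)
open import Data.Nat.Divisibility using (_∣_)
open import Data.Nat.DivMod using (_/_)
open import Data.Nat.Primality using (Prime)
open import Data.Product using (∃; ∃₂; _×_; _,_)
open import Data.Sum using (_⊎_)
open import Data.Vec as Vec using (Vec; []; _∷_; zipWith; replicate; lookup)
open import Function using (_∘_)
open import Function.Bundles using (_↔_)
open import Function.Definitions using (Injective; Bijective)
open import Relation.Binary.Core using (Rel)
open import Relation.Binary.Definitions using (_Respects_)
open import Relation.Binary.PropositionalEquality using (_≡_; _≢_; cong)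
open import Relation.Nullary using (¬_)
open import Relation.Unary using (Pred; _∈_; _∉_; _⊆_; _≐_; _∩_; _∪_; _∖_; _≬_; _⊥_; ｛_｝)

IsPrimePower : ℕ → Set
IsPrimePower q = ∃₂ λ p k → Prime p × q ≡ p ℕ.^ suc k

record FiniteField (n : ℕ) : Set₁ where
  field
    Carrier           : Set
    _+_ _*_           : Carrier → Carrier → Carrier
    -_                : Carrier → Carrier
    0# 1#             : Carrier
    isCommutativeRing : IsCommutativeRing _≡_ _+_ _*_ -_ 0# 1#
    1≢0               : 1# ≢ 0#
    inverse           : ∀ x → x ≢ 0# → ∃ λ y → x * y ≡ 1#
    enumeration       : Carrier ↔ Fin n

  commutativeRing : CommutativeRing 0ℓ 0ℓ
  commutativeRing = record { isCommutativeRing = isCommutativeRing }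

-- F plays the role of the field with q² elements; its subfield with q elements
-- is {x | x^q = x}.
module Geometry (q : ℕ) (F : FiniteField (q ℕ.^ 2)) where

  open FiniteField F using (1≢0) renaming (Carrier to 𝔽)
  open CommutativeRing (FiniteField.commutativeRing F) public
    using (_+_; _*_; -_; _-_; 0#; 1#; semiring)
  open SemiringExp semiring public using (_^_)

  𝔽q 𝔽q* 𝒰 : Pred 𝔽 0ℓ
  𝔽q  x = x ^ q ≡ x
  𝔽q* x = x ∈ 𝔽q × x ≢ 0#
  𝒰   u = u ^ suc q ≡ 1#

  norm : 𝔽 → 𝔽
  norm x = x ^ suc q

  infixl 6 _⊕_
  infixr 7 _·_

  _⊕_ : ∀ {n} → Vec 𝔽 n → Vec 𝔽 n → Vec 𝔽 n
  _⊕_ = zipWith _+_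

  _·_ : ∀ {n} → 𝔽 → Vec 𝔽 n → Vec 𝔽 n
  c · v = Vec.map (c *_) v

  𝟎 : ∀ {n} → Vec 𝔽 n
  𝟎 {n} = replicate n 0#

  -- PG(3,q²).  A point is given by any of its homogeneous coordinate vectors,
  -- and X ∼ v says that v represents the point X.  All sets of points below are
  -- closed under change of representative.

  record Point : Set where
    constructor point
    field
      vec     : Vec 𝔽 4
      nonzero : vec ≢ 𝟎
  open Point public

  PointSet : Set₁
  PointSet = Pred Point 0ℓ

  infix 4 _∼_

  _∼_ : Point → Vec 𝔽 4 → Set
  X ∼ v = ∃ λ k → vec X ≡ k · v

  ⟨_,_⟩ : Vec 𝔽 4 → Vec 𝔽 4 → PointSet
  ⟨ a , b ⟩ X = ∃₂ λ s t → vec X ≡ s · a ⊕ t · b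

  Independent : Vec 𝔽 4 → Vec 𝔽 4 → Set
  Independent a b = ∀ s t → s · a ⊕ t · b ≡ 𝟎 → s ≡ 0# × t ≡ 0#

  record Line : Set where
    field
      a b         : Vec 𝔽 4
      independent : Independent a b

    on : PointSet
    on = ⟨ a , b ⟩
  open Line public using (on)

  IsBaerSubline : PointSet → Set
  IsBaerSubline B = ∃₂ λ a b → Independent a b ×
    B ≐ (λ X → ∃₂ λ s t → s ∈ 𝔽q × t ∈ 𝔽q × X ∼ s · a ⊕ t · b)

  U₁ U₂ U₃ U₄ : Vec 𝔽 4
  U₁ = 1# ∷ 0# ∷ 0# ∷ 0# ∷ []
  U₂ = 0# ∷ 1# ∷ 0# ∷ 0# ∷ []
  U₃ = 0# ∷ 0# ∷ 1# ∷ 0# ∷ []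
  U₄ = 0# ∷ 0# ∷ 0# ∷ 1# ∷ []

  t₁ r-U₁ : PointSet
  t₁   = ⟨ U₁ , U₂ ⟩
  r-U₁ = ⟨ U₁ , U₃ ⟩

  τ : 𝔽 → Vec 𝔽 4 → Vec 𝔽 4
  τ α (x₁ ∷ x₂ ∷ x₃ ∷ x₄ ∷ []) =
    x₃ ^ q ∷ x₄ ^ q ∷ norm α * x₁ ^ q ∷ norm α * x₂ ^ q ∷ []

  ι : 𝔽 → Vec 𝔽 2 → Vec 𝔽 4
  ι α (x ∷ y ∷ []) = x ∷ y ∷ α * x ^ q ∷ α * y ^ q ∷ []

  -- Σ_α; points are nonzero, which forces w ≠ 0 here.
  Baer : 𝔽 → PointSet
  Baer α X = ∃ λ w → X ∼ ι α w

  -- The group E acting on column vectors: elation b is left multiplication by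
  --   ( 1  b  0  0   )
  --   ( 0  1  0  0   )
  --   ( 0  0  1  b^q )
  --   ( 0  0  0  1   )
  elation : 𝔽 → Vec 𝔽 4 → Vec 𝔽 4
  elation b (x₁ ∷ x₂ ∷ x₃ ∷ x₄ ∷ []) =
    x₁ + b * x₂ ∷ x₂ ∷ x₃ + b ^ q * x₄ ∷ x₄ ∷ []

  P⟨_⟩ : 𝔽 → Point
  P⟨ c ⟩ = point (1# ∷ 0# ∷ c ∷ 0# ∷ []) (1≢0 ∘ cong Vec.head)

  π⟨_⟩ : 𝔽 → PointSet
  π⟨ c ⟩ X = lookup (vec X) (# 3) ≡ c * lookup (vec X) (# 1)

  -- p(P_{αu}, π_{αv}); α is determined by αu, because 𝒰 consists of elements of
  -- norm 1 and the elements of Λ have distinct norms.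
  pencil : (α u v : 𝔽) → Pred Line 0ℓ
  pencil α u v ℓ =
      on ℓ ⊆ π⟨ α * v ⟩
    × P⟨ α * u ⟩ ∈ on ℓ
    × IsBaerSubline (on ℓ ∩ (π⟨ α * v ⟩ ∩ Baer α))

  IsPartition₃ : Pred 𝔽 0ℓ → (B C D : Pred 𝔽 0ℓ) → Set
  IsPartition₃ X B C D = ((B ∪ (C ∪ D)) ≐ X) × B ⊥ C × B ⊥ D × C ⊥ D

  inverses : Pred 𝔽 0ℓ → Pred 𝔽 0ℓ
  inverses A x = ∃ λ y → y ∈ A × x * y ≡ 1#

  record Setting : Set where
    field
      Λ         : Fin (q ∸ 1) → 𝔽
      Λ-nonzero : ∀ i → Λ i ≢ 0#
      Λ-norms   : Injective _≡_ _≡_ (norm ∘ Λ)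

      η         : 𝔽
      η∈Λ       : ∃ λ i → Λ i ≡ η
      η∈𝒰       : η ∈ 𝒰

      t         : ℕ
      a         : Fin t → 𝔽
      a-distinct : Injective _≡_ _≡_ a

    A : Pred 𝔽 0ℓ
    A x = ∃ λ i → a i ≡ x

    field
      q-even : 2 ∣ q →
          t ≡ (q ∸ 2) / 2
        × IsPartition₃ 𝔽q* ｛ 1# ｝ A (inverses A)
      q-odd : ¬ (2 ∣ q) →
          t ≡ (q ∸ 3) / 2
        × IsPartition₃ 𝔽q* (｛ 1# ｝ ∪ ｛ - 1# ｝) A (inverses A)
        × (∀ x → x ∈ A → - x ∉ A)

    ℐ : Pred 𝔽 0ℓ
    ℐ α = (∃ λ i → Λ i ≡ α) × (norm α ∈ A ⊎ (¬ (2 ∣ q) × norm α ≡ - 1#))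

  module Construction (setting : Setting) where

    open Setting setting

    Ση : PointSet
    Ση = Baer η

    -- A line of Ση ≃ PG(3,q) is the set of points of Ση on the line of PG(3,q²)
    -- joining two distinct points of Ση.
    record Lineη : Set where
      field
        X Y      : Point
        X∈Ση     : X ∈ Ση
        Y∈Ση     : Y ∈ Ση
        distinct : ¬ (X ∼ vec Y)

      pts : PointSet
      pts = ⟨ vec X , vec Y ⟩ ∩ Ση
    open Lineη public using (pts)

    infix 4 _≈_

    _≈_ : Rel Lineη 0ℓ
    m ≈ n = pts m ≐ pts n

    LineSet : Set₁
    LineSet = Pred Lineη 0ℓ

    Skew : Rel Lineη 0ℓ
    Skew m n = ¬ (pts m ≬ pts n)

    record IsSpread (S : LineSet) : Set where
      field
        respects : S Respects _≈_
        covers   : ∀ X → X ∈ Ση → ∃ λ m → m ∈ S × X ∈ pts m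
        unique   : ∀ X m n → m ∈ S → n ∈ S → X ∈ pts m → X ∈ pts n → m ≈ n

    record IsParallelism (Π : Pred LineSet 0ℓ) : Set₁ where
      field
        respects : Π Respects _≐_
        spread   : ∀ S → S ∈ Π → IsSpread S
        covers   : ∀ m → ∃ λ S → S ∈ Π × m ∈ S
        unique   : ∀ m S T → S ∈ Π → T ∈ Π → m ∈ S → m ∈ T → S ≐ T

    -- Field reduction: identify the 4-dimensional 𝔽q-space
    -- {(x,y,ηx^q,ηy^q)} underlying Ση with 𝔽² through some 𝔽q-linear
    -- isomorphism (ι η after φ); the lines of the spread are then the
    -- one-dimensional 𝔽-subspaces of 𝔽².
    record IsDesarguesian (S : LineSet) : Set where
      field
        isSpread    : IsSpread S
        φ           : Vec 𝔽 2 → Vec 𝔽 2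
        additive    : ∀ v w → φ (v ⊕ w) ≡ φ v ⊕ φ w
        homogeneous : ∀ c v → c ∈ 𝔽q → φ (c · v) ≡ c · φ v
        bijective   : Bijective _≡_ _≡_ φ
        reduction   : S ≐ λ m → ∃ λ w → w ≢ 𝟎 ×
                        pts m ≐ (λ X → ∃ λ c → X ∼ ι η (φ (c · w)))

    IsRegulus : LineSet → Set
    IsRegulus R = ∃ λ l₁ → ∃ λ l₂ → ∃ λ l₃ →
        Skew l₁ l₂ × Skew l₁ l₃ × Skew l₂ l₃
      × R ≐ λ m → pts m ≬ pts l₁ × pts m ≬ pts l₂ × pts m ≬ pts l₃

    opposite : LineSet → LineSet
    opposite R m = ∀ l → l ∈ R → pts m ≬ pts l

    switch : LineSet → LineSet → LineSet
    switch S R = (S ∖ R) ∪ opposite R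

    -- {⟨P,P^τ⟩ ∩ Ση : P ∈ ℓ}, for a set of points ℓ; used for t₁ and for lines
    -- that are skew to their image under τ η.
    joins : PointSet → LineSet
    joins ℓ m = ∃ λ P → P ∈ ℓ × pts m ≐ (⟨ vec P , τ η (vec P) ⟩ ∩ Ση)

    𝒟η : LineSet
    𝒟η = joins t₁

    𝒮 ℛ : Line → LineSet
    𝒮 ℓ = joins (on ℓ)
    ℛ ℓ = 𝒟η ∩ 𝒮 ℓ

    record IsRegulusThroughR (R : LineSet) : Set where
      field
        regulus : IsRegulus R
        inside  : R ⊆ 𝒟η
        through : ∃ λ m → m ∈ R × pts m ≐ (r-U₁ ∩ Ση)

    IsHallSpreadOver : LineSet → LineSet → Set₁
    IsHallSpreadOver R T = ∃ λ S → IsDesarguesian S × R ⊆ S × T ≐ switch S R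

    record IsHallParallelism (Π : Pred LineSet 0ℓ) : Set₁ where
      field
        isParallelism : IsParallelism Π
        hall          : Fin (q ℕ.^ 2 ℕ.+ q) → LineSet
        hall-distinct : Injective _≡_ _≐_ hall
        hall-spread   : ∀ i → ∃ λ R → IsRegulusThroughR R × IsHallSpreadOver R (hall i)
        members       : Π ≐ λ T → T ≐ 𝒟η ⊎ ∃ λ i → T ≐ hall i
        exactly-one   : ∀ R → IsRegulusThroughR R →
                          ∃ λ T → T ∈ Π × IsHallSpreadOver R T
                            × (∀ T′ → T′ ∈ Π → IsHallSpreadOver R T′ → T′ ≐ T)

    image : 𝔽 → LineSet → LineSet
    image b T m = ∃ λ n → n ∈ T ×
      pts m ≐ (λ X → ∃ λ Y → Y ∈ pts n × X ∼ elation b (vec Y))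

    -- Closure under every element of a group gives equality of Π and its images.
    E-invariant : Pred LineSet 0ℓ → Set₁
    E-invariant Π = ∀ b T → T ∈ Π → image b T ∈ Π

    -- A set of q+1 pairs (P_{αu}, π_{αv}), listed without repetition.
    record GoodSet : Set where
      field
        α u v : Fin (suc q) → 𝔽
        α∈ℐ   : ∀ i → α i ∈ ℐ
        u∈𝒰   : ∀ i → u i ∈ 𝒰
        v∈𝒰   : ∀ i → v i ∈ 𝒰
        distinct-pairs : ∀ i j → i ≢ j →
          ¬ (P⟨ α i * u i ⟩ ∼ vec P⟨ α j * u j ⟩ × π⟨ α i * v i ⟩ ≐ π⟨ α j * v j ⟩)
        good : ∀ i j → (α i , u i , v i) ≢ (α j , u j , v j) →
            u i * v j - v i * u j ≢ 0#
          × (α i * u i) * (α j * v j) ^ q - (α i * v i) ^ q * (α j * u j) ≢ 0#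

    ℒ⟨_⟩ : GoodSet → Pred Line 0ℓ
    ℒ⟨ 𝒫 ⟩ ℓ = ¬ (on ℓ ≐ r-U₁) × ∃ λ i → ℓ ∈ pencil (α i) (u i) (v i)
      where open GoodSet 𝒫

    Π⟨_⟩ : GoodSet → Pred LineSet 0ℓ
    Π⟨ 𝒫 ⟩ T = (∃ λ ℓ → ℓ ∈ ℒ⟨ 𝒫 ⟩ × T ≐ switch (𝒮 ℓ) (ℛ ℓ)) ⊎ T ≐ 𝒟η

{-# OPTIONS --safe #-}

-- Write x̄ = x^q and identify Ση with 𝔽² through ι η.  The lines of Ση disjoint
-- from r_{U₁}, which becomes y = 0, are the graphs x = M y + N ȳ; those with N = 0
-- form the rest of 𝒟η, and the elation b adds b to M.  A regulus of 𝒟η through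
-- r_{U₁} consists of y = 0 and the graphs with N = 0 and M ∈ c + d 𝔽q; d is its
-- direction, and E permutes the q reguli of each of the q + 1 directions.
--
-- A Desarguesian spread containing the regulus with c = 0 is the image of 𝒟η under
-- an 𝔽q-linear map: its components are {(d f(sa), f(a))}, where f(a) = a + g ā after
-- rescaling.  Replacing f by its composition with conjugation inverts the norm of g,
-- which may therefore be taken in A ∪ {-1}.  With h d̄ = d g this spread is 𝒮 ℓ for a
-- line ℓ of the pencil of (P_{αu}, π_{αv}), where αu = η h̄ and αv = η ḡ.
--
-- The member of Π over a regulus contains the opposite regulus, hence chords meeting
-- y = 0 in one point, and it is determined by any of them.  So the members over the
-- reguli of one direction form an E-orbit, given by one pair (P_{αu}, π_{αv}).  The
-- first condition on a good set says that the directions differ.  If the second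
-- failed for two pairs, the nonzero coefficients N occurring in the two spreads would
-- span the same 𝔽q-line; a translate of one member would share a graph with the other
-- and so be equal to it, although their directions differ.

module Submission where

-- Three components of a Desarguesian spread, `y = 0`, `x = 0` and `x = d y`, already bring it to
-- the form `(d f(sa), f(a))`: the first two split the linear map into its coordinates, and the
-- third expresses one coordinate through the other. What remains is `f(a) = i a + j ā`. If `i` or
-- `j` vanishes, the spread contains every graph with `N = 0`, and switching it leaves a line of
-- `𝒟η`, which a parallelism forbids.
--
-- The element `h` is forced by `h d̄ = d g`. Taking norms gives `N h = N g`, so a single `α` of
-- that norm serves both the point and the plane, and dividing `η h̄` and `η ḡ` by `α` leaves
-- elements of norm 1. Since `h / g = d / d̄` depends only on the direction of `d`, the first
-- condition on a good set separates directions.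
--
-- A line of the pencil through `(c, 1, αv c̄, αv)` is the image under the elation `c` of the one
-- with `c = 0`. Parameters `c` and `c + s` give the same line exactly when `v s̄ = u s`, that is,
-- when `s` lies in `d 𝔽q`; this matches the q reguli of one direction.
--
-- Counting enters through the bound of q roots for `x^q - x`: it provides `ω` outside the fixed
-- field and makes the norms of `Λ` exhaust its nonzero elements.

open import Algebra.Bundles using (CommutativeRing; RawRing)
import Algebra.Properties.CommutativeMonoid.Sum as Sum
import Algebra.Properties.CommutativeSemiring.Binomial as Binomial
import Algebra.Properties.CommutativeSemiring.Exp as Exp
import Algebra.Properties.Semiring.Exp as SemiringExp
import Algebra.Properties.Semiring.Mult as SemiringMult
import Algebra.Solver.Ring as RingSolver
import Algebra.Solver.Ring.AlmostCommutativeRing as ACR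
open import Data.Bool using (Bool; true; false; not; if_then_else_)
open import Data.Empty using (⊥)
open import Data.Fin as Fin using (Fin; zero; suc; _↑ˡ_; _↑ʳ_)
import Data.Fin.Properties as Fin
open import Data.List as List using (List)
open import Data.Maybe using (Maybe; just; nothing)
open import Data.Nat as ℕ using (ℕ; zero; suc; _≤_; _<_; z≤n; s≤s; _∸_)
open import Data.Nat.Combinatorics using (_C_; nCk≡n!/k![n-k]!; k![n∸k]!∣n!; nCn≡1)
open import Data.Nat.Divisibility using (_∣_; _∣?_; divides; ∣⇒≤; m∣m*n)
open import Data.Nat.DivMod using (m/n*n≡m)
open import Data.Nat.Primality using (Prime; euclidsLemma; prime⇒nonTrivial)
import Data.Nat.Properties as ℕ
open import Data.Product using (Σ; ∃; ∃₂; _×_; _,_; proj₁; proj₂)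
open import Data.Sum using (_⊎_; inj₁; inj₂; [_,_]′)
open import Data.Vec as Vec using (Vec; []; _∷_; lookup; _++_)
import Data.Vec.Functional as Vector
open import Data.Vec.N-ary using (N-ary; Eq; _$ⁿ_; curryⁿ; curryⁿ-cong)
import Data.Vec.Properties as Vec
open import Function using (id; _∘_)
open import Function.Bundles using (_↔_; Inverse; mk↔ₛ′)
open import Function.Construct.Composition using (_↔-∘_)
open import Function.Construct.Symmetry using (↔-sym)
open import Function.Definitions using (Injective)
open import Function.Properties.Inverse using (Inverse⇒Injection)
open import Level using (0ℓ)
open import Relation.Binary.Definitions using (DecidableEquality)
open import Relation.Binary.PropositionalEquality using
  (_≡_; _≢_; refl; sym; trans; cong; cong₂; subst; subst₂; ≢-sym; module ≡-Reasoning)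
open import Relation.Nullary using (¬_; Dec; yes; no; contradiction)
open import Relation.Nullary.Decidable using (via-injection; _×-dec_)
open import Relation.Unary using (Pred; _∈_; _∉_; _⊆_; _≐_; _∩_; _≬_)
open import Defs

-- A solver for commutative rings with an involution

-- Integer coefficients are represented as formal differences of naturals.
module IntegerCoefficients (F : CommutativeRing 0ℓ 0ℓ) where
  private
    R = ACR.fromCommutativeRing F
  open CommutativeRing F renaming (refl to ≈-refl; sym to ≈-sym; trans to ≈-trans)
  open SemiringMult semiring using (×-homo-+; ×1-homo-*; ×-homo-1) renaming (_×_ to _·_)
  open import Relation.Binary.Reasoning.Setoid setoid
  private
    -- A preliminary solver without a test for equal coefficients. It proves the identities from
    -- which the solver with integer coefficients is built.
    open module Weak = RingSolver rawRing R (ACR.-raw-almostCommutative⟶ R) (λ _ _ → nothing)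
      using (solve; _:=_; _:+_; _:*_; :-_; _:-_)

    Difference : Set
    Difference = ℕ × ℕ

    differences : RawRing 0ℓ 0ℓ
    differences = record
      { Carrier = Difference
      ; _≈_     = _≡_
      ; _+_     = λ (a , b) (c , d) → a ℕ.+ c , b ℕ.+ d
      ; _*_     = λ (a , b) (c , d) → a ℕ.* c ℕ.+ b ℕ.* d , a ℕ.* d ℕ.+ b ℕ.* c
      ; -_      = λ (a , b) → b , a
      ; 0#      = 0 , 0
      ; 1#      = 1 , 0
      }

    eval : Difference → Carrier
    eval (a , b) = a · 1# - b · 1#

    ×1-homo-+* : ∀ a b c d → (a ℕ.* c ℕ.+ b ℕ.* d) · 1# ≈ (a · 1#) * (c · 1#) + (b · 1#) * (d · 1#)
    ×1-homo-+* a b c d = ≈-trans (×-homo-+ 1# (a ℕ.* c) (b ℕ.* d)) (+-cong (×1-homo-* a c) (×1-homo-* b d))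

    x-0≈x : ∀ x → x - 0# ≈ x
    x-0≈x x = begin
      x - 0#        ≈⟨ +-identityʳ _ ⟨
      x - 0# + 0#   ≈⟨ +-assoc x (- 0#) 0# ⟩
      x + (- 0# + 0#) ≈⟨ +-congˡ (-‿inverseˡ 0#) ⟩
      x + 0#        ≈⟨ +-identityʳ x ⟩
      x ∎

  homomorphism : differences ACR.-Raw-AlmostCommutative⟶ R
  homomorphism = record
    { ⟦_⟧    = eval
    ; +-homo = λ (a , b) (c , d) → begin
        eval (a ℕ.+ c , b ℕ.+ d)
          ≈⟨ +-cong (×-homo-+ 1# a c) (-‿cong (×-homo-+ 1# b d)) ⟩
        (a · 1# + c · 1#) - (b · 1# + d · 1#)
          ≈⟨ solve 4 (λ x y z w → (x :+ z) :- (y :+ w) := (x :- y) :+ (z :- w)) ≈-refl (a · 1#) (b · 1#) (c · 1#) (d · 1#) ⟩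
        eval (a , b) + eval (c , d) ∎
    ; *-homo = λ (a , b) (c , d) → begin
        eval (a ℕ.* c ℕ.+ b ℕ.* d , a ℕ.* d ℕ.+ b ℕ.* c)
          ≈⟨ +-cong (×1-homo-+* a b c d) (-‿cong (×1-homo-+* a b d c)) ⟩
        ((a · 1#) * (c · 1#) + (b · 1#) * (d · 1#)) - ((a · 1#) * (d · 1#) + (b · 1#) * (c · 1#))
          ≈⟨ mul (a · 1#) (b · 1#) (c · 1#) (d · 1#) ⟩
        eval (a , b) * eval (c , d) ∎
    ; -‿homo = λ (a , b) → begin
        b · 1# - a · 1#
          ≈⟨ neg (a · 1#) (b · 1#) ⟩
        - (a · 1# - b · 1#) ∎
    ; 0-homo = -‿inverseʳ 0#
    ; 1-homo = ≈-trans (x-0≈x _) (×-homo-1 1#)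
    }
    where
    open import Algebra.Properties.Ring ring using (-‿distribʳ-*; -‿distribˡ-*; -‿involutive; -‿+-comm)
    neg : ∀ x y → y - x ≈ - (x - y)
    neg x y = begin
      y - x         ≈⟨ +-comm y (- x) ⟩
      - x + y       ≈⟨ +-congˡ (-‿involutive y) ⟨
      - x + - (- y) ≈⟨ -‿+-comm x (- y) ⟩
      - (x - y) ∎
    mul : ∀ x y z w → (x * z + y * w) - (x * w + y * z) ≈ (x - y) * (z - w)
    mul x y z w = ≈-sym (begin
      (x - y) * (z - w)                                   ≈⟨ distribʳ _ _ _ ⟩
      x * (z - w) + - y * (z - w)                         ≈⟨ +-cong (distribˡ x z (- w)) (distribˡ (- y) z (- w)) ⟩
      (x * z + x * - w) + (- y * z + - y * - w)           ≈⟨ +-cong (+-congˡ (-‿distribʳ-* x w)) (+-cong (-‿distribˡ-* y z) (≈-trans (-‿cong (-‿distribˡ-* y w)) (-‿distribʳ-* (- y) w))) ⟨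
      (x * z - x * w) + (- (y * z) + - - (y * w))           ≈⟨ +-congˡ (+-congˡ (-‿involutive (y * w))) ⟩
      (x * z - x * w) + (- (y * z) + y * w)               ≈⟨ solve 4 (λ p q r s → (p :- q) :+ (:- r :+ s) := (p :+ s) :- (q :+ r)) ≈-refl (x * z) (x * w) (y * z) (y * w) ⟩
      (x * z + y * w) - (x * w + y * z) ∎)

  private
    -- The differences a - b and c - d have equal values as soon as a + d = c + b in ℕ. In positive
    -- characteristic the converse fails, and then `nothing` is returned.
    weak≟ : ∀ p r → Maybe (eval p ≈ eval r)
    weak≟ (a , b) (c , d) with a ℕ.+ d ℕ.≟ c ℕ.+ b
    ... | yes eq = just (begin
            a · 1# - b · 1#                        ≈⟨ +-identityʳ _ ⟨
            (a · 1# - b · 1#) + 0#                 ≈⟨ +-congˡ (-‿inverseʳ (d · 1#)) ⟨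
            (a · 1# - b · 1#) + (d · 1# - d · 1#)
              ≈⟨ solve 3 (λ x y z → (x :- y) :+ (z :- z) := (x :+ z) :+ (:- y :- z)) ≈-refl (a · 1#) (b · 1#) (d · 1#) ⟩
            (a · 1# + d · 1#) + (- (b · 1#) - d · 1#) ≈⟨ +-congʳ (≈-sym (×-homo-+ 1# a d)) ⟩
            (a ℕ.+ d) · 1# + (- (b · 1#) - d · 1#) ≈⟨ +-congʳ (reflexive (cong (_· 1#) eq)) ⟩
            (c ℕ.+ b) · 1# + (- (b · 1#) - d · 1#) ≈⟨ +-congʳ (×-homo-+ 1# c b) ⟩
            (c · 1# + b · 1#) + (- (b · 1#) - d · 1#)
              ≈⟨ solve 3 (λ x y z → (z :+ y) :+ (:- y :- x) := (z :- x) :+ (y :- y)) ≈-refl (d · 1#) (b · 1#) (c · 1#) ⟩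
            (c · 1# - d · 1#) + (b · 1# - b · 1#)  ≈⟨ +-congˡ (-‿inverseʳ (b · 1#)) ⟩
            (c · 1# - d · 1#) + 0#                 ≈⟨ +-identityʳ _ ⟩
            c · 1# - d · 1# ∎)
    ... | _ = nothing

  open RingSolver differences R homomorphism weak≟ public

-- Finite fields

module FiniteFieldProperties {n : ℕ} (F : FiniteField n) where
  open FiniteField F using (1≢0; inverse; enumeration)
  open CommutativeRing (FiniteField.commutativeRing F) hiding (refl; sym; trans; zero)
  open SemiringExp semiring using (_^_)
  open SemiringMult semiring using (×1-homo-*) renaming (_×_ to _·_)
  open ≡-Reasoning
  private
    module P = IntegerCoefficients (FiniteField.commutativeRing F)
    open Inverse enumeration using (to; from; strictlyInverseˡ; strictlyInverseʳ)

  _≟_ : DecidableEquality Carrier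
  _≟_ = via-injection (Inverse⇒Injection enumeration) Fin._≟_

  opaque
    *-cancel-0 : ∀ {x y} → x ≢ 0# → x * y ≡ 0# → y ≡ 0#
    *-cancel-0 {x} {y} x≢0 xy≡0 = let x⁻¹ , e = inverse x x≢0 in begin
      y              ≡⟨ *-identityˡ y ⟨
      1# * y         ≡⟨ cong (_* y) e ⟨
      x * x⁻¹ * y    ≡⟨ P.solve 3 (λ x i y → x P.:* i P.:* y P.:= i P.:* (x P.:* y)) refl x x⁻¹ y ⟩
      x⁻¹ * (x * y)  ≡⟨ cong (x⁻¹ *_) xy≡0 ⟩
      x⁻¹ * 0#       ≡⟨ zeroʳ x⁻¹ ⟩
      0# ∎

    *-nonzero : ∀ {x y} → x ≢ 0# → y ≢ 0# → x * y ≢ 0#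
    *-nonzero x≢0 y≢0 = y≢0 ∘ *-cancel-0 x≢0

    ^-nonzero : ∀ {x} k → x ≢ 0# → x ^ k ≢ 0#
    ^-nonzero zero    x≢0 = 1≢0
    ^-nonzero (suc k) x≢0 = *-nonzero x≢0 (^-nonzero k x≢0)

    x-y≡0⇒x≡y : ∀ {x y} → x - y ≡ 0# → x ≡ y
    x-y≡0⇒x≡y {x} {y} e = begin
      x           ≡⟨ P.solve 2 (λ x y → x P.:= x P.:- y P.:+ y) refl x y ⟩
      x - y + y   ≡⟨ cong (_+ y) e ⟩
      0# + y      ≡⟨ +-identityˡ y ⟩
      y ∎

    *-cancelˡ : ∀ {x y z} → x ≢ 0# → x * y ≡ x * z → y ≡ z
    *-cancelˡ {x} {y} {z} x≢0 e = x-y≡0⇒x≡y (*-cancel-0 x≢0 (begin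
      x * (y - z)   ≡⟨ P.solve 3 (λ x y z → x P.:* (y P.:- z) P.:= x P.:* y P.:- x P.:* z) refl x y z ⟩
      x * y - x * z ≡⟨ cong (_- x * z) e ⟩
      x * z - x * z ≡⟨ -‿inverseʳ (x * z) ⟩
      0# ∎))

  module Σ⁺ = Sum +-commutativeMonoid
  module Π = Sum *-commutativeMonoid

  permutation : Carrier ↔ Carrier → Fin n ↔ Fin n
  permutation f = enumeration ↔-∘ (f ↔-∘ ↔-sym enumeration)

  opaque
    -- Translation by 1 permutes the field, so the sum `s` of all elements equals `s + n · 1`.
    n·1≡0 : n · 1# ≡ 0#
    n·1≡0 = begin
      n · 1#                          ≡⟨ P.solve 2 (λ s m → m P.:= (s P.:+ m) P.:- s) refl s (n · 1#) ⟩
      (s + n · 1#) - s                ≡⟨ cong (λ z → (s + z) - s) (Σ⁺.sum-replicate n) ⟨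
      (s + Σ⁺.sum {n} (λ _ → 1#)) - s ≡⟨ cong (_- s) (Σ⁺.∑-distrib-+ from (λ _ → 1#)) ⟨
      Σ⁺.sum (λ i → from i + 1#) - s  ≡⟨ cong (_- s) (Σ⁺.sum-cong-≗ (λ i → strictlyInverseʳ (from i + 1#))) ⟨
      Σ⁺.sum (λ i → from (to (from i + 1#))) - s ≡⟨ cong (_- s) (Σ⁺.sum-permute from (permutation shift)) ⟨
      s - s                           ≡⟨ -‿inverseʳ s ⟩
      0# ∎
      where
      s : Carrier
      s = Σ⁺.sum from
      shift : Carrier ↔ Carrier
      shift = mk↔ₛ′ (_+ 1#) (_- 1#)
        (λ x → P.solve 2 (λ x o → x P.:- o P.:+ o P.:= x) refl x 1#)
        (λ x → P.solve 2 (λ x o → x P.:+ o P.:- o P.:= x) refl x 1#)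

  private
    product-units : ∀ {m} (f : Fin m → Carrier) → (∀ i → f i ≡ 1#) → Π.sum f ≡ 1#
    product-units {zero}  f h = refl
    product-units {suc m} f h = trans (cong₂ _*_ (h zero) (product-units (f ∘ suc) (h ∘ suc))) (*-identityˡ 1#)

    product-single : ∀ {m} (f : Fin m → Carrier) i → (∀ j → j ≢ i → f j ≡ 1#) → Π.sum f ≡ f i
    product-single f zero h =
      trans (cong (f zero *_) (product-units (f ∘ suc) (λ j → h (suc j) λ ()))) (*-identityʳ _)
    product-single f (suc i) h =
      trans (cong₂ _*_ (h zero λ ()) (product-single (f ∘ suc) i (λ j j≢i → h (suc j) (j≢i ∘ Fin.suc-injective))))
            (*-identityˡ _)

    product-nonzero : ∀ {m} (f : Fin m → Carrier) → (∀ i → f i ≢ 0#) → Π.sum f ≢ 0#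
    product-nonzero {zero}  f h = 1≢0
    product-nonzero {suc m} f h = *-nonzero (h zero) (product-nonzero (f ∘ suc) (h ∘ suc))

    choose : Carrier → Carrier → Carrier → Carrier
    choose x y z with z ≟ 0#
    ... | yes _ = x
    ... | no _  = y

    choose-0 : ∀ x y z → z ≡ 0# → choose x y z ≡ x
    choose-0 x y z z≡0 with z ≟ 0#
    ... | yes _ = refl
    ... | no z≢0 = contradiction z≡0 z≢0

    choose-≢0 : ∀ x y z → z ≢ 0# → choose x y z ≡ y
    choose-≢0 x y z z≢0 with z ≟ 0#
    ... | yes z≡0 = contradiction z≡0 z≢0
    ... | no _ = refl

  -- Multiplication by a ≢ 0 permutes the field, so it preserves the product of
  -- all nonzero elements; the zero element is replaced by 1 in that product.
  x^n≡x : ∀ x → x ^ n ≡ x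
  x^n≡x a with a ≟ 0#
  ... | yes refl = 0^n n (to 0#)
    where
    0^n : ∀ m → Fin m → 0# ^ m ≡ 0#
    0^n (suc m) _ = zeroˡ _
  ... | no a≢0 = begin
    a ^ n                                ≡⟨ Π.sum-replicate n ⟨
    Π.sum {n} (λ _ → a)                  ≡⟨ Π.sum-cong-≗ (λ i → split (from i)) ⟩
    Π.sum (λ i → c (from i) * δ (from i)) ≡⟨ Π.∑-distrib-+ (c ∘ from) (δ ∘ from) ⟩
    Π.sum (c ∘ from) * Π.sum (δ ∘ from)  ≡⟨ cong₂ _*_ Πc≡1 (trans (product-single (δ ∘ from) (to 0#) off) (choose-0 a 1# _ (strictlyInverseʳ 0#))) ⟩
    1# * a                               ≡⟨ *-identityˡ a ⟩
    a ∎
    where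
    -- The constant `a` factors as `c z * δ z`: `c` carries it at nonzero `z` and `δ` at zero. The
    -- product of all `δ z` is then `a`, and comparing the products of `f z` and `f (a * z)` shows
    -- that the product of all `c z` is 1.
    c δ f : Carrier → Carrier
    c = choose 1# a
    δ = choose a 1#
    f z = choose 1# z z
    split : ∀ z → a ≡ c z * δ z
    split z with z ≟ 0#
    ... | yes _ = sym (*-identityˡ a)
    ... | no _  = sym (*-identityʳ a)
    off : ∀ j → j ≢ to 0# → δ (from j) ≡ 1#
    off j j≢ = choose-≢0 a 1# _ λ e → j≢ (trans (sym (strictlyInverseˡ j)) (cong to e))
    f-* : ∀ z → f (a * z) ≡ c z * f z
    f-* z with z ≟ 0#
    ... | yes refl = trans (choose-0 1# _ _ (zeroʳ a)) (sym (*-identityˡ 1#))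
    ... | no z≢0 = choose-≢0 1# _ _ (*-nonzero a≢0 z≢0)
    f≢0 : ∀ z → f z ≢ 0#
    f≢0 z with z ≟ 0#
    ... | yes _ = 1≢0
    ... | no z≢0 = z≢0
    scale : Carrier ↔ Carrier
    scale = let a⁻¹ , e = inverse a a≢0 in mk↔ₛ′ (a *_) (a⁻¹ *_)
      (λ x → trans (sym (*-assoc a a⁻¹ x)) (trans (cong (_* x) e) (*-identityˡ x)))
      (λ x → trans (sym (*-assoc a⁻¹ a x)) (trans (cong (_* x) (trans (*-comm a⁻¹ a) e)) (*-identityˡ x)))
    G = Π.sum (f ∘ from)
    Πc≡1 : Π.sum (c ∘ from) ≡ 1#
    Πc≡1 = *-cancelˡ (product-nonzero (f ∘ from) (f≢0 ∘ from)) (begin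
      G * Π.sum (c ∘ from)                  ≡⟨ *-comm G _ ⟩
      Π.sum (c ∘ from) * G                  ≡⟨ Π.∑-distrib-+ (c ∘ from) (f ∘ from) ⟨
      Π.sum (λ i → c (from i) * f (from i)) ≡⟨ Π.sum-cong-≗ (λ i → f-* (from i)) ⟨
      Π.sum (λ i → f (a * from i))          ≡⟨ Π.sum-cong-≗ (λ i → cong f (strictlyInverseʳ (a * from i))) ⟨
      Π.sum (λ i → f (from (to (a * from i)))) ≡⟨ Π.sum-permute (f ∘ from) (permutation scale) ⟨
      G                                     ≡⟨ *-identityʳ G ⟨
      G * 1# ∎)

  -- The coefficient 1 of x^m is not listed.
  monic : ∀ {m} → Vec Carrier m → Carrier → Carrier
  monic []       x = 1#
  monic (c ∷ cs) x = c + x * monic cs x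

  private
    -- Horner's scheme for (p(x) - p(r)) / (x - r), which is again monic, of degree one less.
    quotient : ∀ {m} → Vec Carrier (suc m) → Carrier → Vec Carrier m
    quotient (c ∷ [])      r = []
    quotient (c ∷ cs@(_ ∷ _)) r = monic cs r ∷ quotient cs r

    quotient-correct : ∀ {m} (cs : Vec Carrier (suc m)) r x →
      monic cs x - monic cs r ≡ (x - r) * monic (quotient cs r) x
    quotient-correct (c ∷ []) r x =
      P.solve 4 (λ c r x o → (c P.:+ x P.:* o) P.:- (c P.:+ r P.:* o) P.:= (x P.:- r) P.:* o) refl c r x 1#
    quotient-correct (c ∷ cs@(_ ∷ _)) r x = begin
      (c + x * p x) - (c + r * p r)        ≡⟨ P.solve 5 (λ c x r px pr → (c P.:+ x P.:* px) P.:- (c P.:+ r P.:* pr)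
                                                P.:= x P.:* (px P.:- pr) P.:+ (x P.:- r) P.:* pr) refl c x r (p x) (p r) ⟩
      x * (p x - p r) + (x - r) * p r      ≡⟨ cong (λ z → x * z + (x - r) * p r) (quotient-correct cs r x) ⟩
      x * ((x - r) * qx) + (x - r) * p r   ≡⟨ P.solve 4 (λ x r q pr → x P.:* ((x P.:- r) P.:* q) P.:+ (x P.:- r) P.:* pr
                                                P.:= (x P.:- r) P.:* (pr P.:+ x P.:* q)) refl x r qx (p r) ⟩
      (x - r) * (p r + x * qx) ∎
      where
      p = monic cs
      qx = monic (quotient cs r) x

  monic-roots : ∀ {m} (cs : Vec Carrier m) (f : Fin (suc m) → Carrier) →
    Injective _≡_ _≡_ f → ¬ (∀ i → monic cs (f i) ≡ 0#)
  monic-roots []       f inj roots = 1≢0 (roots zero)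
  monic-roots (c ∷ cs) f inj roots =
    monic-roots (quotient (c ∷ cs) r) (f ∘ suc) (Fin.suc-injective ∘ inj) λ i →
      *-cancel-0 (λ e → Fin.0≢1+n (inj (sym (x-y≡0⇒x≡y e)))) (begin
        (f (suc i) - r) * monic (quotient (c ∷ cs) r) (f (suc i)) ≡⟨ quotient-correct (c ∷ cs) r (f (suc i)) ⟨
        monic (c ∷ cs) (f (suc i)) - monic (c ∷ cs) r             ≡⟨ cong₂ _-_ (roots (suc i)) (roots zero) ⟩
        0# - 0#                                                   ≡⟨ -‿inverseʳ 0# ⟩
        0# ∎)
    where r = f zero

-- Polynomials in m atoms as sorted lists of terms with nonzero coefficients.
module SparsePolynomials {n : ℕ} (F : FiniteField n) where
  open CommutativeRing (FiniteField.commutativeRing F) hiding (refl; sym; trans; zero)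
  open import Data.List using ([]; _∷_)
  open ≡-Reasoning
  private
    module P = IntegerCoefficients (FiniteField.commutativeRing F)
    module H = ACR._-Raw-AlmostCommutative⟶_ P.homomorphism
    Coefficient = ℕ × ℕ

  Monomial : ℕ → Set
  Monomial m = List (Fin m)

  Polynomial : ℕ → Set
  Polynomial m = List (Coefficient × Monomial m)

  module _ {m : ℕ} where
    private
      -- Only `equal` carries a proof. The order decides where a term is stored and so whether like
      -- terms find each other; the correctness of addition does not depend on it.
      data Order (x y : Monomial m) : Set where
        less greater : Order x y
        equal        : x ≡ y → Order x y

      order : ∀ x y → Order x y
      order []      []      = equal refl
      order []      (_ ∷ _) = less
      order (_ ∷ _) []      = greater
      order (i ∷ x) (j ∷ y) with i Fin.≟ j
      ... | no _ = if Fin.toℕ i ℕ.<ᵇ Fin.toℕ j then less else greater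
      ... | yes refl with order x y
      ...   | less    = less
      ...   | greater = greater
      ...   | equal e = equal (cong (i ∷_) e)

      insert : Fin m → Monomial m → Monomial m
      insert i [] = i ∷ []
      insert i (j ∷ x) = if Fin.toℕ i ℕ.<ᵇ Fin.toℕ j then i ∷ j ∷ x else j ∷ insert i x

    addTerm : Coefficient → Monomial m → Polynomial m → Polynomial m
    addTerm c x [] = (c , x) ∷ []
    addTerm c@(a , b) x ((d@(a′ , b′) , y) ∷ p) with order x y
    ... | less    = (c , x) ∷ (d , y) ∷ p
    ... | greater = (d , y) ∷ addTerm c x p
    ... | equal _ with (a ℕ.+ a′) ℕ.≟ (b ℕ.+ b′)
    ...   | yes _ = p
    ...   | no _  = ((a ℕ.+ a′ , b ℕ.+ b′) , y) ∷ p

    add : Polynomial m → Polynomial m → Polynomial m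
    add []            r = r
    add ((c , x) ∷ p) r = addTerm c x (add p r)

    mulTerm : Coefficient → Monomial m → Polynomial m → Polynomial m → Polynomial m
    mulTerm (a , b) x []                    r = r
    mulTerm (a , b) x (((a′ , b′) , y) ∷ p) r =
      addTerm (a ℕ.* a′ ℕ.+ b ℕ.* b′ , a ℕ.* b′ ℕ.+ b ℕ.* a′) (List.foldr insert y x) (mulTerm (a , b) x p r)

    mul : Polynomial m → Polynomial m → Polynomial m
    mul []            r = []
    mul ((c , x) ∷ p) r = mulTerm c x r (mul p r)

    neg : Polynomial m → Polynomial m
    neg []                  = []
    neg (((a , b) , x) ∷ p) = ((b , a) , x) ∷ neg p

    module _ (ρ : Vec Carrier m) where
      ⟦_⟧ᵐ : Monomial m → Carrier
      ⟦ [] ⟧ᵐ    = 1#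
      ⟦ i ∷ x ⟧ᵐ = lookup ρ i * ⟦ x ⟧ᵐ

      ⟦_⟧ᵖ : Polynomial m → Carrier
      ⟦ [] ⟧ᵖ          = 0#
      ⟦ (c , x) ∷ p ⟧ᵖ = H.⟦ c ⟧ * ⟦ x ⟧ᵐ + ⟦ p ⟧ᵖ

      private
        insert-correct : ∀ i x → ⟦ insert i x ⟧ᵐ ≡ lookup ρ i * ⟦ x ⟧ᵐ
        insert-correct i [] = refl
        insert-correct i (j ∷ x) with Fin.toℕ i ℕ.<ᵇ Fin.toℕ j
        ... | true  = refl
        ... | false = trans (cong (lookup ρ j *_) (insert-correct i x))
          (P.solve 3 (λ a b c → a P.:* (b P.:* c) P.:= b P.:* (a P.:* c)) refl (lookup ρ j) (lookup ρ i) ⟦ x ⟧ᵐ)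

        product-correct : ∀ x y → ⟦ List.foldr insert y x ⟧ᵐ ≡ ⟦ x ⟧ᵐ * ⟦ y ⟧ᵐ
        product-correct []      y = sym (*-identityˡ _)
        product-correct (i ∷ x) y = trans (insert-correct i (List.foldr insert y x))
          (trans (cong (lookup ρ i *_) (product-correct x y)) (sym (*-assoc _ _ _)))

      addTerm-correct : ∀ c x p → ⟦ addTerm c x p ⟧ᵖ ≡ H.⟦ c ⟧ * ⟦ x ⟧ᵐ + ⟦ p ⟧ᵖ
      addTerm-correct c x [] = refl
      addTerm-correct c@(a , b) x ((d@(a′ , b′) , y) ∷ p) with order x y
      ... | less    = refl
      ... | greater = trans (cong (H.⟦ d ⟧ * ⟦ y ⟧ᵐ +_) (addTerm-correct c x p))
        (P.solve 3 (λ a b c → a P.:+ (b P.:+ c) P.:= b P.:+ (a P.:+ c)) refl (H.⟦ d ⟧ * ⟦ y ⟧ᵐ) (H.⟦ c ⟧ * ⟦ x ⟧ᵐ) ⟦ p ⟧ᵖ)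
      ... | equal refl with (a ℕ.+ a′) ℕ.≟ (b ℕ.+ b′)
      ...   | no _ = trans (cong (λ z → z * ⟦ x ⟧ᵐ + ⟦ p ⟧ᵖ) (H.+-homo c d))
        (P.solve 4 (λ c d x p → (c P.:+ d) P.:* x P.:+ p P.:= c P.:* x P.:+ (d P.:* x P.:+ p)) refl H.⟦ c ⟧ H.⟦ d ⟧ ⟦ x ⟧ᵐ ⟦ p ⟧ᵖ)
      ...   | yes e = begin
        ⟦ p ⟧ᵖ                                          ≡⟨ P.solve 2 (λ x p → p P.:= P.con (0 , 0) P.:* x P.:+ p) refl ⟦ x ⟧ᵐ ⟦ p ⟧ᵖ ⟩
        H.⟦ 0 , 0 ⟧ * ⟦ x ⟧ᵐ + ⟦ p ⟧ᵖ                   ≡⟨ cong (λ z → z * ⟦ x ⟧ᵐ + ⟦ p ⟧ᵖ) (trans H.0-homo (sym c+d≡0)) ⟩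
        (H.⟦ c ⟧ + H.⟦ d ⟧) * ⟦ x ⟧ᵐ + ⟦ p ⟧ᵖ           ≡⟨ P.solve 4 (λ c d x p → (c P.:+ d) P.:* x P.:+ p P.:= c P.:* x P.:+ (d P.:* x P.:+ p)) refl H.⟦ c ⟧ H.⟦ d ⟧ ⟦ x ⟧ᵐ ⟦ p ⟧ᵖ ⟩
        H.⟦ c ⟧ * ⟦ x ⟧ᵐ + (H.⟦ d ⟧ * ⟦ x ⟧ᵐ + ⟦ p ⟧ᵖ) ∎
        where
        c+d≡0 : H.⟦ c ⟧ + H.⟦ d ⟧ ≡ 0#
        c+d≡0 = trans (sym (H.+-homo c d)) (trans (cong (λ k → H.⟦ k , b ℕ.+ b′ ⟧) e) (-‿inverseʳ _))

      add-correct : ∀ p r → ⟦ add p r ⟧ᵖ ≡ ⟦ p ⟧ᵖ + ⟦ r ⟧ᵖ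
      add-correct []            r = sym (+-identityˡ _)
      add-correct ((c , x) ∷ p) r = trans (addTerm-correct c x (add p r))
        (trans (cong (H.⟦ c ⟧ * ⟦ x ⟧ᵐ +_) (add-correct p r)) (sym (+-assoc _ _ _)))

      mulTerm-correct : ∀ c x p r → ⟦ mulTerm c x p r ⟧ᵖ ≡ H.⟦ c ⟧ * ⟦ x ⟧ᵐ * ⟦ p ⟧ᵖ + ⟦ r ⟧ᵖ
      mulTerm-correct c x [] r = sym (trans (cong (_+ ⟦ r ⟧ᵖ) (zeroʳ _)) (+-identityˡ _))
      mulTerm-correct c x ((d , y) ∷ p) r = trans (addTerm-correct _ (List.foldr insert y x) (mulTerm c x p r))
        (trans (cong₂ _+_ (cong₂ _*_ (H.*-homo c d) (product-correct x y)) (mulTerm-correct c x p r))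
          (P.solve 6 (λ c x d y p r → c P.:* d P.:* (x P.:* y) P.:+ (c P.:* x P.:* p P.:+ r)
            P.:= c P.:* x P.:* (d P.:* y P.:+ p) P.:+ r) refl H.⟦ c ⟧ ⟦ x ⟧ᵐ H.⟦ d ⟧ ⟦ y ⟧ᵐ ⟦ p ⟧ᵖ ⟦ r ⟧ᵖ))

      mul-correct : ∀ p r → ⟦ mul p r ⟧ᵖ ≡ ⟦ p ⟧ᵖ * ⟦ r ⟧ᵖ
      mul-correct []            r = sym (zeroˡ _)
      mul-correct ((c , x) ∷ p) r = trans (mulTerm-correct c x r (mul p r))
        (trans (cong (H.⟦ c ⟧ * ⟦ x ⟧ᵐ * ⟦ r ⟧ᵖ +_) (mul-correct p r)) (sym (distribʳ _ _ _)))

      neg-correct : ∀ p → ⟦ neg p ⟧ᵖ ≡ - ⟦ p ⟧ᵖ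
      neg-correct [] = trans (sym (-‿inverseʳ 0#)) (+-identityˡ _)
      neg-correct ((c , x) ∷ p) = trans (cong₂ (λ a b → a * ⟦ x ⟧ᵐ + b) (H.-‿homo c) (neg-correct p))
        (P.solve 3 (λ c x p → P.:- c P.:* x P.:+ P.:- p P.:= P.:- (c P.:* x P.:+ p)) refl H.⟦ c ⟧ ⟦ x ⟧ᵐ ⟦ p ⟧ᵖ)

record IsInvolution {n : ℕ} (F : FiniteField n) (conj : FiniteField.Carrier F → FiniteField.Carrier F) : Set where
  open CommutativeRing (FiniteField.commutativeRing F) using (_+_; _*_; -_; 0#; 1#)
  field
    conj-+          : ∀ x y → conj (x + y) ≡ conj x + conj y
    conj-*          : ∀ x y → conj (x * y) ≡ conj x * conj y
    conj-neg        : ∀ x → conj (- x) ≡ - conj x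
    conj-0          : conj 0# ≡ 0#
    conj-1          : conj 1# ≡ 1#
    conj-involutive : ∀ x → conj (conj x) ≡ x

module ConjugationSolver {n : ℕ} (F : FiniteField n) {conj : FiniteField.Carrier F → FiniteField.Carrier F}
  (isInvolution : IsInvolution F conj) where

  open IsInvolution isInvolution
  open SparsePolynomials F
  open import Data.List using ([]; _∷_)
  open CommutativeRing (FiniteField.commutativeRing F) using
    (Carrier; _+_; _*_; -_; 0#; 1#; +-identityʳ; *-identityˡ; *-identityʳ; +-assoc; +-identityˡ; -‿inverseˡ)
  private
    module H = ACR._-Raw-AlmostCommutative⟶_ (IntegerCoefficients.homomorphism (FiniteField.commutativeRing F))

  infix  4 _:=_
  infixl 7 _:+_ _:-_
  infixl 8 _:*_
  infix  9 :-_
  infix  10 _ᶜ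

  data Expr (n : ℕ) : Set where
    var       : Fin n → Expr n
    𝟘 𝟙       : Expr n
    _:+_ _:*_ : Expr n → Expr n → Expr n
    :-_ _ᶜ    : Expr n → Expr n

  _:-_ : ∀ {n} → Expr n → Expr n → Expr n
  x :- y = x :+ (:- y)

  _:=_ : ∀ {n} → Expr n → Expr n → Expr n × Expr n
  _:=_ = _,_

  private
    ⟦_⟧ : ∀ {n} → Expr n → Vec Carrier n → Carrier
    ⟦ var i ⟧  ρ = lookup ρ i
    ⟦ 𝟘 ⟧      ρ = 0#
    ⟦ 𝟙 ⟧      ρ = 1#
    ⟦ x :+ y ⟧ ρ = ⟦ x ⟧ ρ + ⟦ y ⟧ ρ
    ⟦ x :* y ⟧ ρ = ⟦ x ⟧ ρ * ⟦ y ⟧ ρ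
    ⟦ :- x ⟧   ρ = - ⟦ x ⟧ ρ
    ⟦ x ᶜ ⟧    ρ = conj (⟦ x ⟧ ρ)

    conjIf : Bool → Carrier → Carrier
    conjIf false x = x
    conjIf true  x = conj x

    conjIf-+ : ∀ b x y → conjIf b (x + y) ≡ conjIf b x + conjIf b y
    conjIf-+ false x y = refl
    conjIf-+ true  x y = conj-+ x y

    conjIf-* : ∀ b x y → conjIf b (x * y) ≡ conjIf b x * conjIf b y
    conjIf-* false x y = refl
    conjIf-* true  x y = conj-* x y

    conjIf-neg : ∀ b x → conjIf b (- x) ≡ - conjIf b x
    conjIf-neg false x = refl
    conjIf-neg true  x = conj-neg x

    conjIf-conj : ∀ b x → conjIf (not b) x ≡ conjIf b (conj x)
    conjIf-conj false x = refl
    conjIf-conj true  x = sym (conj-involutive x)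

    conjIf-0 : ∀ b → 0# ≡ conjIf b 0#
    conjIf-0 false = refl
    conjIf-0 true  = sym conj-0

    conjIf-1 : ∀ b → 1# ≡ conjIf b 1#
    conjIf-1 false = refl
    conjIf-1 true  = sym conj-1

    atom : ∀ {n} → Bool → Fin n → Fin (n ℕ.+ n)
    atom {n} false i = i ↑ˡ n
    atom {n} true  i = n ↑ʳ i

    -- The flag tells whether the subexpression stands under an odd number of conjugations.
    -- Conjugation is thus pushed down to the variables, where `x` and `conj x` become independent
    -- atoms.
    normalise : ∀ {n} → Bool → Expr n → Polynomial (n ℕ.+ n)
    normalise b (var i)  = ((1 , 0) , atom b i ∷ []) ∷ []
    normalise b 𝟘        = []
    normalise b 𝟙        = ((1 , 0) , []) ∷ []
    normalise b (x :+ y) = add (normalise b x) (normalise b y)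
    normalise b (x :* y) = mul (normalise b x) (normalise b y)
    normalise b (:- x)   = neg (normalise b x)
    normalise b (x ᶜ)    = normalise (not b) x

    environment : ∀ {n} → Vec Carrier n → Vec Carrier (n ℕ.+ n)
    environment ρ = ρ ++ Vec.map conj ρ

    lookup-atom : ∀ {n} b i (ρ : Vec Carrier n) → lookup (environment ρ) (atom b i) ≡ conjIf b (lookup ρ i)
    lookup-atom false i ρ = Vec.lookup-++ˡ ρ (Vec.map conj ρ) i
    lookup-atom true  i ρ = trans (Vec.lookup-++ʳ ρ (Vec.map conj ρ) i) (Vec.lookup-map i conj ρ)

    unit-term : ∀ x → H.⟦ 1 , 0 ⟧ * x + 0# ≡ x
    unit-term x = trans (+-identityʳ _) (trans (cong (_* x) H.1-homo) (*-identityˡ x))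

    normalise-correct : ∀ {n} b (e : Expr n) ρ → ⟦_⟧ᵖ (environment ρ) (normalise b e) ≡ conjIf b (⟦ e ⟧ ρ)
    normalise-correct b (var i)  ρ = trans (unit-term _) (trans (*-identityʳ _) (lookup-atom b i ρ))
    normalise-correct b 𝟘        ρ = conjIf-0 b
    normalise-correct b 𝟙        ρ = trans (unit-term 1#) (conjIf-1 b)
    normalise-correct b (x :+ y) ρ = trans (add-correct (environment ρ) (normalise b x) (normalise b y))
      (trans (cong₂ _+_ (normalise-correct b x ρ) (normalise-correct b y ρ)) (sym (conjIf-+ b _ _)))
    normalise-correct b (x :* y) ρ = trans (mul-correct (environment ρ) (normalise b x) (normalise b y))
      (trans (cong₂ _*_ (normalise-correct b x ρ) (normalise-correct b y ρ)) (sym (conjIf-* b _ _)))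
    normalise-correct b (:- x)   ρ = trans (neg-correct (environment ρ) (normalise b x))
      (trans (cong -_ (normalise-correct b x ρ)) (sym (conjIf-neg b _)))
    normalise-correct b (x ᶜ)    ρ = trans (normalise-correct (not b) x ρ) (conjIf-conj b _)

    close : ∀ n → N-ary n (Expr n) (Expr n × Expr n) → Expr n × Expr n
    close n f = f $ⁿ Vec.map var (Vec.allFin n)

  opaque
    -- The premise holds by `refl` once the difference of the two sides computes to the empty list
    -- of terms. Since only a difference is tested, normal forms of the two sides are never
    -- compared.
    solve : ∀ n (f : N-ary n (Expr n) (Expr n × Expr n)) →
      normalise false (proj₁ (close n f) :- proj₂ (close n f)) ≡ [] →
      Eq n _≡_ (curryⁿ ⟦ proj₁ (close n f) ⟧) (curryⁿ ⟦ proj₂ (close n f) ⟧)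
    solve n f h = curryⁿ-cong _≡_ ⟦ l ⟧ ⟦ r ⟧ λ ρ → begin
        ⟦ l ⟧ ρ                       ≡⟨ +-identityʳ _ ⟨
        ⟦ l ⟧ ρ + 0#                  ≡⟨ cong (⟦ l ⟧ ρ +_) (-‿inverseˡ (⟦ r ⟧ ρ)) ⟨
        ⟦ l ⟧ ρ + (- ⟦ r ⟧ ρ + ⟦ r ⟧ ρ) ≡⟨ +-assoc _ _ _ ⟨
        ⟦ l :- r ⟧ ρ + ⟦ r ⟧ ρ        ≡⟨ cong (_+ ⟦ r ⟧ ρ) (normalise-correct false (l :- r) ρ) ⟨
        ⟦_⟧ᵖ (environment ρ) (normalise false (l :- r)) + ⟦ r ⟧ ρ ≡⟨ cong (λ p → ⟦_⟧ᵖ (environment ρ) p + ⟦ r ⟧ ρ) h ⟩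
        0# + ⟦ r ⟧ ρ                  ≡⟨ +-identityˡ _ ⟩
        ⟦ r ⟧ ρ ∎
      where
      open ≡-Reasoning
      l : Expr n
      l = proj₁ (close n f)
      r : Expr n
      r = proj₂ (close n f)

-- Frobenius and conjugation

p∤k! : ∀ {p} → Prime p → ∀ k → k < p → ¬ (p ∣ k ℕ.!)
p∤k! pr zero    k<p p∣1 = ℕ.<⇒≱ (ℕ.nonTrivial⇒n>1 _ {{prime⇒nonTrivial pr}}) (∣⇒≤ p∣1)
p∤k! pr (suc k) k<p p∣ with euclidsLemma (suc k) (k ℕ.!) pr p∣
... | inj₁ p∣k+1 = ℕ.<⇒≱ k<p (∣⇒≤ p∣k+1)
... | inj₂ p∣k!  = p∤k! pr k (ℕ.<⇒≤ k<p) p∣k!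

-- The prime p divides p! = C(p,k) k! (p - k)!, but neither of the two factorials on the right.
p∣pCk : ∀ {p} → Prime p → ∀ k → 0 < k → k < p → p ∣ (p C k)
p∣pCk {p@(suc p-1)} pr k 0<k k<p
  with euclidsLemma (p C k) (k ℕ.! ℕ.* (p ∸ k) ℕ.!) pr
         (subst (p ∣_) (sym pCk*≡p!) (m∣m*n (p-1 ℕ.!)))
  where
  instance _ = k ℕ.!* (p ∸ k) !≢0
  pCk*≡p! : (p C k) ℕ.* (k ℕ.! ℕ.* (p ∸ k) ℕ.!) ≡ p ℕ.!
  pCk*≡p! = trans (cong (ℕ._* (k ℕ.! ℕ.* (p ∸ k) ℕ.!)) (nCk≡n!/k![n-k]! (ℕ.<⇒≤ k<p))) (m/n*n≡m (k![n∸k]!∣n! (ℕ.<⇒≤ k<p)))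
... | inj₁ p∣C = p∣C
... | inj₂ p∣k!* with euclidsLemma (k ℕ.!) ((p ∸ k) ℕ.!) pr p∣k!*
...   | inj₁ p∣k! = contradiction p∣k! (p∤k! pr k k<p)
...   | inj₂ p∣[p-k]! = contradiction p∣[p-k]! (p∤k! pr (p ∸ k) (ℕ.∸-monoʳ-< 0<k (ℕ.<⇒≤ k<p)))

module Frobenius {n : ℕ} (F : FiniteField n) where
  open FiniteField F using (1≢0)
  open FiniteFieldProperties F
  open CommutativeRing (FiniteField.commutativeRing F) hiding (refl; sym; trans; zero)
  open Exp commutativeSemiring using (_^_; ^-assocʳ; ^-distrib-*)
  open SemiringMult semiring using (×1-homo-*; ×-assoc-*; ×-homo-1) renaming (_×_ to _·_)
  open ≡-Reasoning

  -- `n · 1 = 0` is a product of k factors `p · 1`, and a field has no zero divisors.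
  prime-characteristic : ∀ {p} k → n ≡ p ℕ.^ k → p · 1# ≡ 0#
  prime-characteristic {p} k n≡p^k = descend k (subst (λ m → m · 1# ≡ 0#) n≡p^k n·1≡0)
    where
    descend : ∀ k → (p ℕ.^ k) · 1# ≡ 0# → p · 1# ≡ 0#
    descend zero    e = contradiction (trans (sym (×-homo-1 1#)) e) 1≢0
    descend (suc k) e with (p · 1#) ≟ 0#
    ... | yes p≡0 = p≡0
    ... | no p≢0  = descend k (*-cancel-0 p≢0 (trans (sym (×1-homo-* p (p ℕ.^ k))) e))

  module _ {p} (pr : Prime p) (p·1≡0 : p · 1# ≡ 0#) where

    p∣m⇒m·x≡0 : ∀ {m} x → p ∣ m → m · x ≡ 0#
    p∣m⇒m·x≡0 {m} x (divides c refl) = begin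
      (c ℕ.* p) · x          ≡⟨ cong ((c ℕ.* p) ·_) (*-identityˡ x) ⟨
      (c ℕ.* p) · (1# * x)   ≡⟨ ×-assoc-* (c ℕ.* p) 1# x ⟨
      (c ℕ.* p) · 1# * x     ≡⟨ cong (_* x) (×1-homo-* c p) ⟩
      c · 1# * (p · 1#) * x  ≡⟨ cong (λ z → c · 1# * z * x) p·1≡0 ⟩
      c · 1# * 0# * x        ≡⟨ cong (_* x) (zeroʳ _) ⟩
      0# * x                 ≡⟨ zeroˡ x ⟩
      0# ∎

    ^p-distrib-+ : ∀ x y → (x + y) ^ p ≡ x ^ p + y ^ p
    ^p-distrib-+ x y = trans (Binomial.theorem commutativeSemiring p x y) (expand p refl)
      where
      open Binomial commutativeSemiring using (binomialTerm; binomialExpansion)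
      -- The exponent is generalised to allow a case split on it. Between the two outer terms every
      -- binomial coefficient is divisible by p, so those terms vanish.
      expand : ∀ m → p ≡ m → binomialExpansion x y m ≡ x ^ m + y ^ m
      expand zero refl = contradiction (ℕ.nonTrivial⇒n>1 0 {{prime⇒nonTrivial pr}}) λ ()
      expand m@(suc m-1) refl = begin
        t zero + Σ⁺.sum (t ∘ suc)                                      ≡⟨ cong₂ _+_ first (Σ⁺.sum-init-last (t ∘ suc)) ⟩
        y ^ m + (Σ⁺.sum (Vector.init (t ∘ suc)) + t (suc (Fin.fromℕ m-1))) ≡⟨ cong₂ (λ u v → y ^ m + (u + v)) (trans (Σ⁺.sum-cong-≗ inner) (Σ⁺.sum-replicate-zero m-1)) final ⟩
        y ^ m + (0# + x ^ m)                                           ≡⟨ cong (y ^ m +_) (+-identityˡ _) ⟩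
        y ^ m + x ^ m                                                  ≡⟨ +-comm _ _ ⟩
        x ^ m + y ^ m ∎
        where
        t = binomialTerm x y m
        first : t zero ≡ y ^ m
        first = trans (×-homo-1 _) (*-identityˡ _)
        inner : ∀ i → Vector.init (t ∘ suc) i ≡ 0#
        inner i = p∣m⇒m·x≡0 _ (p∣pCk pr (suc (Fin.toℕ (Fin.inject₁ i))) (s≤s z≤n)
          (s≤s (subst (_< m-1) (sym (Fin.toℕ-inject₁ i)) (Fin.toℕ<n i))))
        final : t (suc (Fin.fromℕ m-1)) ≡ x ^ m
        final rewrite Fin.toℕ-fromℕ m-1 | nCn≡1 m | ℕ.n∸n≡0 m-1 = trans (×-homo-1 _) (*-identityʳ _)

    ^p^k-distrib-+ : ∀ k x y → (x + y) ^ (p ℕ.^ k) ≡ x ^ (p ℕ.^ k) + y ^ (p ℕ.^ k)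
    ^p^k-distrib-+ zero    x y = trans (*-identityʳ _) (sym (cong₂ _+_ (*-identityʳ x) (*-identityʳ y)))
    ^p^k-distrib-+ (suc k) x y = begin
      (x + y) ^ (p ℕ.* p ℕ.^ k)                        ≡⟨ ^-assocʳ (x + y) p (p ℕ.^ k) ⟨
      ((x + y) ^ p) ^ (p ℕ.^ k)                        ≡⟨ cong (_^ (p ℕ.^ k)) (^p-distrib-+ x y) ⟩
      (x ^ p + y ^ p) ^ (p ℕ.^ k)                      ≡⟨ ^p^k-distrib-+ k (x ^ p) (y ^ p) ⟩
      (x ^ p) ^ (p ℕ.^ k) + (y ^ p) ^ (p ℕ.^ k)        ≡⟨ cong₂ _+_ (^-assocʳ x p (p ℕ.^ k)) (^-assocʳ y p (p ℕ.^ k)) ⟩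
      x ^ (p ℕ.* p ℕ.^ k) + y ^ (p ℕ.* p ℕ.^ k) ∎

module Conjugation (q : ℕ) (3≤q : 3 ≤ q) (pp : IsPrimePower q) (F : FiniteField (q ℕ.^ 2)) where
  open FiniteField F using (1≢0; inverse; enumeration) renaming (Carrier to 𝔽) public
  open Geometry q F public using (𝔽q; 𝔽q*; inverses; norm; _^_; _+_; _*_; -_; _-_; 0#; 1#)
  open CommutativeRing (FiniteField.commutativeRing F) public
    using (semiring; commutativeSemiring; zeroˡ; zeroʳ; +-identityˡ; +-identityʳ; *-identityˡ; *-identityʳ;
      +-comm; *-comm; *-assoc; -‿inverseʳ; -‿inverseˡ)
  open FiniteFieldProperties F public
  open Exp commutativeSemiring using (^-assocʳ; ^-distrib-*)
  open ≡-Reasoning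

  opaque
    -- Opaque, so that conjugation stays an atom and the power with exponent q is never unfolded.
    conj : 𝔽 → 𝔽
    conj x = x ^ q

    conj≡^q : ∀ x → conj x ≡ x ^ q
    conj≡^q x = refl

    conj-≢0 : ∀ {x} → x ≢ 0# → conj x ≢ 0#
    conj-≢0 = ^-nonzero q

    norm≡ : ∀ x → norm x ≡ x * conj x
    norm≡ x = refl

    conj-+ : ∀ x y → conj (x + y) ≡ conj x + conj y
    conj-+ x y = additive pp
      where
      additive : IsPrimePower q → conj (x + y) ≡ conj x + conj y
      additive (p , k , pr , q≡p^k) = begin
        (x + y) ^ q                                   ≡⟨ cong ((x + y) ^_) q≡p^k ⟩
        (x + y) ^ (p ℕ.^ suc k)                       ≡⟨ Frobenius.^p^k-distrib-+ F pr (Frobenius.prime-characteristic F {p} (suc k ℕ.* 2)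
          (trans (cong (ℕ._^ 2) q≡p^k) (ℕ.^-*-assoc p (suc k) 2))) (suc k) x y ⟩
        x ^ (p ℕ.^ suc k) + y ^ (p ℕ.^ suc k)         ≡⟨ cong (λ m → x ^ m + y ^ m) q≡p^k ⟨
        x ^ q + y ^ q ∎

    conj-* : ∀ x y → conj (x * y) ≡ conj x * conj y
    conj-* x y = ^-distrib-* x y q

    conj-1 : conj 1# ≡ 1#
    conj-1 = 1^ q
      where
      1^ : ∀ m → 1# ^ m ≡ 1#
      1^ zero    = refl
      1^ (suc m) = trans (*-identityˡ _) (1^ m)

    conj-0 : conj 0# ≡ 0#
    conj-0 = 0^ 3≤q
      where
      0^ : ∀ {k m} → suc k ≤ m → 0# ^ m ≡ 0#
      0^ (s≤s _) = zeroˡ _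

    conj-neg : ∀ x → conj (- x) ≡ - conj x
    conj-neg x = begin
      conj (- x)                       ≡⟨ P.solve 2 (λ a b → a P.:= (b P.:+ a) P.:- b) refl (conj (- x)) (conj x) ⟩
      (conj x + conj (- x)) - conj x   ≡⟨ cong (_- conj x) (conj-+ x (- x)) ⟨
      conj (x + - x) - conj x          ≡⟨ cong (λ z → conj z - conj x) (-‿inverseʳ x) ⟩
      conj 0# - conj x                 ≡⟨ cong (_- conj x) conj-0 ⟩
      0# - conj x                      ≡⟨ +-identityˡ _ ⟩
      - conj x ∎
      where module P = IntegerCoefficients (FiniteField.commutativeRing F)

    conj-involutive : ∀ x → conj (conj x) ≡ x
    conj-involutive x = begin
      (x ^ q) ^ q     ≡⟨ ^-assocʳ x q q ⟩
      x ^ (q ℕ.* q)   ≡⟨ cong (λ m → x ^ (q ℕ.* m)) (ℕ.*-identityʳ q) ⟨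
      x ^ (q ℕ.^ 2)   ≡⟨ x^n≡x x ⟩
      x ∎

  isInvolution : IsInvolution F conj
  isInvolution = record
    { conj-+ = conj-+ ; conj-* = conj-* ; conj-neg = conj-neg
    ; conj-0 = conj-0 ; conj-1 = conj-1 ; conj-involutive = conj-involutive }

  open ConjugationSolver F isInvolution public

  private
    from-0 : ∀ {l r} → l ≡ r → ∀ c → c * (l - r) ≡ 0#
    from-0 refl c = trans (cong (c *_) (-‿inverseʳ _)) (zeroʳ c)

  opaque
    -- A certificate for consequences of equations: `L - R` is displayed as a combination of the
    -- differences `l - r` of known equations, with explicit cofactors `c`. The displayed identity
    -- holds in every commutative ring with involution and is left to `solve`.
    combine₁ : ∀ {l r L R} → l ≡ r → ∀ c → L - R ≡ c * (l - r) → L ≡ R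
    combine₁ e c h = x-y≡0⇒x≡y (trans h (from-0 e c))

    combine₂ : ∀ {l r l′ r′ L R} → l ≡ r → ∀ c → l′ ≡ r′ → ∀ c′ →
      L - R ≡ c * (l - r) + c′ * (l′ - r′) → L ≡ R
    combine₂ e c e′ c′ h = x-y≡0⇒x≡y (trans h (trans (cong₂ _+_ (from-0 e c) (from-0 e′ c′)) (+-identityˡ 0#)))

    combine₃ : ∀ {l r l′ r′ l″ r″ L R} → l ≡ r → ∀ c → l′ ≡ r′ → ∀ c′ → l″ ≡ r″ → ∀ c″ →
      L - R ≡ c * (l - r) + c′ * (l′ - r′) + c″ * (l″ - r″) → L ≡ R
    combine₃ e c e′ c′ e″ c″ h = x-y≡0⇒x≡y (trans h (trans
      (cong₂ _+_ (trans (cong₂ _+_ (from-0 e c) (from-0 e′ c′)) (+-identityˡ 0#)) (from-0 e″ c″)) (+-identityˡ 0#)))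

    combine₄ : ∀ {l r l′ r′ l″ r″ l‴ r‴ L R} → l ≡ r → ∀ c → l′ ≡ r′ → ∀ c′ → l″ ≡ r″ → ∀ c″ → l‴ ≡ r‴ → ∀ c‴ →
      L - R ≡ c * (l - r) + c′ * (l′ - r′) + c″ * (l″ - r″) + c‴ * (l‴ - r‴) → L ≡ R
    combine₄ e c e′ c′ e″ c″ e‴ c‴ h = x-y≡0⇒x≡y (trans h (trans (cong₂ _+_ (trans
      (cong₂ _+_ (trans (cong₂ _+_ (from-0 e c) (from-0 e′ c′)) (+-identityˡ 0#)) (from-0 e″ c″)) (+-identityˡ 0#))
      (from-0 e‴ c‴)) (+-identityˡ 0#)))

  -- The fixed field of conjugation, norms and linear maps

  Fix : Pred 𝔽 0ℓ
  Fix x = conj x ≡ x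

  Fix⇒𝔽q : ∀ {x} → x ∈ Fix → x ∈ 𝔽q
  Fix⇒𝔽q {x} = trans (sym (conj≡^q x))

  𝔽q⇒Fix : ∀ {x} → x ∈ 𝔽q → x ∈ Fix
  𝔽q⇒Fix {x} = trans (conj≡^q x)

  Fix-0 : 0# ∈ Fix
  Fix-0 = conj-0

  Fix-1 : 1# ∈ Fix
  Fix-1 = conj-1

  Fix-+ : ∀ {x y} → x ∈ Fix → y ∈ Fix → x + y ∈ Fix
  Fix-+ hx hy = trans (conj-+ _ _) (cong₂ _+_ hx hy)

  Fix-* : ∀ {x y} → x ∈ Fix → y ∈ Fix → x * y ∈ Fix
  Fix-* hx hy = trans (conj-* _ _) (cong₂ _*_ hx hy)

  Fix-neg : ∀ {x} → x ∈ Fix → - x ∈ Fix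
  Fix-neg hx = trans (conj-neg _) (cong -_ hx)

  Fix-inverse : ∀ {x y} → x * y ≡ 1# → x ∈ Fix → y ∈ Fix
  Fix-inverse {x} {y} xy≡1 hx = combine₃
    xy≡1 (- conj y) (trans (sym (conj-* x y)) (trans (cong conj xy≡1) conj-1)) y hx (- (y * conj y))
    (solve 2 (λ x y → y ᶜ :- y := :- (y ᶜ) :* (x :* y :- 𝟙) :+ y :* (x ᶜ :* y ᶜ :- 𝟙) :+ :- (y :* y ᶜ) :* (x ᶜ :- x)) refl x y)

  N : 𝔽 → 𝔽
  N x = x * conj x

  N-∈Fix : ∀ x → N x ∈ Fix
  N-∈Fix x = solve 1 (λ x → (x :* x ᶜ) ᶜ := x :* x ᶜ) refl x

  private
    -- Fixed elements are roots of the monic polynomial `x^q - x`. Below its leading term the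
    -- coefficients are 0, -1 and then zeros, which is possible because q is at least 2.
    Fix-roots : ∀ m → q ≡ suc (suc m) → (f : Fin (suc (suc (suc m))) → 𝔽) → Injective _≡_ _≡_ f → ¬ (∀ i → f i ∈ Fix)
    Fix-roots m q≡2+m f inj fix = monic-roots (0# ∷ - 1# ∷ Vec.replicate m 0#) f inj λ i →
      trans (reduce (f i)) (trans (cong (_- f i) (trans (cong (f i ^_) (sym q≡2+m)) (Fix⇒𝔽q (fix i)))) (-‿inverseʳ (f i)))
      where
      power : ∀ m x → monic (Vec.replicate m 0#) x ≡ x ^ m
      power zero    x = refl
      power (suc m) x = trans (+-identityˡ _) (cong (x *_) (power m x))
      reduce : ∀ x → monic (0# ∷ - 1# ∷ Vec.replicate m 0#) x ≡ x ^ suc (suc m) - x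
      reduce x = trans (cong (λ z → 0# + x * (- 1# + x * z)) (power m x))
        (solve 2 (λ x z → 𝟘 :+ x :* (:- 𝟙 :+ x :* z) := x :* (x :* z) :- x) refl x (x ^ m))

  at-most-q-fixed : (f : Fin (suc q) → 𝔽) → Injective _≡_ _≡_ f → ¬ (∀ i → f i ∈ Fix)
  at-most-q-fixed = subst (λ k → (f : Fin (suc k) → 𝔽) → Injective _≡_ _≡_ f → ¬ (∀ i → f i ∈ Fix))
    (sym q≡2+m) (Fix-roots (q ∸ 2) q≡2+m)
    where
    q≡2+m : q ≡ suc (suc (q ∸ 2))
    q≡2+m = sym (ℕ.m+[n∸m]≡n (ℕ.<⇒≤ 3≤q))

  private
    e : Fin (q ℕ.^ 2) → 𝔽
    e = Inverse.from enumeration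

    e-injective : Injective _≡_ _≡_ e
    e-injective {i} {j} h = trans (sym (Inverse.strictlyInverseˡ enumeration i))
      (trans (cong (Inverse.to enumeration) h) (Inverse.strictlyInverseˡ enumeration j))

    q<q² : suc q ≤ q ℕ.^ 2
    q<q² = ℕ.≤-trans (ℕ.+-monoˡ-≤ q (ℕ.≤-trans (s≤s z≤n) 3≤q))
      (ℕ.≤-trans (ℕ.≤-reflexive (cong (q ℕ.+_) (sym (ℕ.+-identityʳ q)))) (ℕ.≤-trans (ℕ.*-monoˡ-≤ q (ℕ.<⇒≤ 3≤q))
        (ℕ.≤-reflexive (cong (q ℕ.*_) (sym (ℕ.*-identityʳ q))))))

  abstract
    -- The field has q² > q elements, too many for all of them to be roots of `x^q - x`. It is
    -- abstract so that later proofs do not unfold the search.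
    outside-Fix : ∃ (_∉ Fix)
    outside-Fix = let i , ei∉Fix = Fin.¬∀⟶∃¬ (q ℕ.^ 2) (λ i → e i ∈ Fix) (λ i → conj (e i) ≟ e i) not-all in e i , ei∉Fix
      where
      not-all : ¬ (∀ i → e i ∈ Fix)
      not-all all = at-most-q-fixed (λ i → e (Fin.inject≤ i q<q²))
        (λ {i} {j} h → Fin.inject≤-injective q<q² q<q² i j (e-injective h)) (λ i → all (Fin.inject≤ i q<q²))

  ω : 𝔽
  ω = proj₁ outside-Fix

  ω∉Fix : ω ∉ Fix
  ω∉Fix = proj₂ outside-Fix

  opaque
    neg-≢0 : ∀ {x y} → x ≢ y → x - y ≢ 0#
    neg-≢0 x≢y = x≢y ∘ x-y≡0⇒x≡y

    *-cancel-≡ : ∀ {x y z} → x ≢ 0# → x * (y - z) ≡ 0# → y ≡ z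
    *-cancel-≡ x≢0 h = x-y≡0⇒x≡y (*-cancel-0 x≢0 h)

  -- The determinant of `x` and `y` over the fixed field, up to a constant factor. Conjugation
  -- changes its sign.
  wedge : 𝔽 → 𝔽 → 𝔽
  wedge x y = x * conj y - conj x * y

  opaque
    -- Cramer's rule: the coordinates are quotients of two wedges. Conjugation negates numerator and
    -- denominator, so the quotients are fixed.
    Fix-basis : ∀ {x y} → wedge x y ≢ 0# → ∀ z → ∃₂ λ r s → r ∈ Fix × s ∈ Fix × z ≡ r * x + s * y
    Fix-basis {x} {y} w≢0 z with inverse (wedge x y) w≢0
    ... | i , wi≡1 = wedge z y * i , wedge x z * i , fixed z y , fixed x z ,
      combine₁ wi≡1 (- z) (solve 4 (λ x y z i →
        z :- ((z :* y ᶜ :- z ᶜ :* y) :* i :* x :+ (x :* z ᶜ :- x ᶜ :* z) :* i :* y)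
          := :- z :* ((x :* y ᶜ :- x ᶜ :* y) :* i :- 𝟙)) refl x y z i)
      where
      conj-wi≡1 : conj (wedge x y * i) ≡ 1#
      conj-wi≡1 = trans (cong conj wi≡1) conj-1
      ī≡-i : conj i ≡ - i
      ī≡-i = combine₂ wi≡1 (- conj i) conj-wi≡1 (- i) (solve 3 (λ x y i →
        i ᶜ :- (:- i) := :- (i ᶜ) :* ((x :* y ᶜ :- x ᶜ :* y) :* i :- 𝟙) :+ (:- i) :* (((x :* y ᶜ :- x ᶜ :* y) :* i) ᶜ :- 𝟙)) refl x y i)
      fixed : ∀ a b → wedge a b * i ∈ Fix
      fixed a b = combine₁ ī≡-i (- wedge a b) (solve 3 (λ a b i →
        ((a :* b ᶜ :- a ᶜ :* b) :* i) ᶜ :- (a :* b ᶜ :- a ᶜ :* b) :* i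
          := :- (a :* b ᶜ :- a ᶜ :* b) :* (i ᶜ :- (:- i))) refl a b i)

  opaque
    wedge-zero : ∀ {x y} → x ≢ 0# → wedge x y ≡ 0# → ∃ λ r → r ∈ Fix × y ≡ r * x
    wedge-zero {x} {y} x≢0 w≡0 with inverse x x≢0
    ... | i , xi≡1 = y * i ,
      combine₃ w≡0 (i * conj i) xi≡1 (- (conj y * conj i)) (trans (sym (conj-* x i)) (trans (cong conj xi≡1) conj-1)) (y * i)
        (solve 3 (λ x y i → (y :* i) ᶜ :- y :* i
          := i :* i ᶜ :* ((x :* y ᶜ :- x ᶜ :* y) :- 𝟘) :+ (:- (y ᶜ :* i ᶜ)) :* (x :* i :- 𝟙) :+ y :* i :* (x ᶜ :* i ᶜ :- 𝟙)) refl x y i) ,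
      combine₁ xi≡1 (- y) (solve 3 (λ x y i → y :- y :* i :* x := :- y :* (x :* i :- 𝟙)) refl x y i)

  ω̄-ω≢0 : conj ω - ω ≢ 0#
  ω̄-ω≢0 = neg-≢0 ω∉Fix

  wedge-1-ω : wedge 1# ω ≢ 0#
  wedge-1-ω e = ω̄-ω≢0 (trans (solve 1 (λ w → w ᶜ :- w := 𝟙 :* w ᶜ :- 𝟙 ᶜ :* w) refl ω) e)

  private
    ω-coordinates : ∀ a → ∃₂ λ r s → r ∈ Fix × s ∈ Fix × a ≡ r * 1# + s * ω
    ω-coordinates = Fix-basis wedge-1-ω

  opaque
    -- Evaluation at 1 and `ω` suffices: the determinant of the resulting linear system is
    -- `conj ω - ω`, which is not 0.
    coefficients : ∀ {u v u′ v′} → (∀ a → u * a + v * conj a ≡ u′ * a + v′ * conj a) → u ≡ u′ × v ≡ v′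
    coefficients {u} {v} {u′} {v′} h = u≡u′ , v≡v′
      where
      v≡v′ : v ≡ v′
      v≡v′ = *-cancel-≡ ω̄-ω≢0 (combine₂ (h ω) 1# (h 1#) (- ω)
        (solve 5 (λ u v u′ v′ w → (w ᶜ :- w) :* (v :- v′) :- 𝟘
          := 𝟙 :* ((u :* w :+ v :* w ᶜ) :- (u′ :* w :+ v′ :* w ᶜ))
            :+ (:- w) :* ((u :* 𝟙 :+ v :* 𝟙 ᶜ) :- (u′ :* 𝟙 :+ v′ :* 𝟙 ᶜ))) refl u v u′ v′ ω))
      u≡u′ : u ≡ u′
      u≡u′ = combine₂ (h 1#) 1# v≡v′ (- 1#)
        (solve 4 (λ u v u′ v′ → u :- u′ := 𝟙 :* ((u :* 𝟙 :+ v :* 𝟙 ᶜ) :- (u′ :* 𝟙 :+ v′ :* 𝟙 ᶜ)) :+ (:- 𝟙) :* (v :- v′))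
          refl u v u′ v′)

  -- A map that is linear over the fixed field is determined by its values on the basis 1, `ω`, and
  -- interpolating these two values yields `i` and `j`.
  linear-form : (A : 𝔽 → 𝔽) → (∀ x y → A (x + y) ≡ A x + A y) → (∀ r x → r ∈ Fix → A (r * x) ≡ r * A x) →
    ∃₂ λ i j → ∀ a → A a ≡ i * a + j * conj a
  linear-form A A-+ A-* = A 1# - j , j , λ a → let r , s , hr , hs , a≡ = ω-coordinates a in begin
      A a                      ≡⟨ cong A a≡ ⟩
      A (r * 1# + s * ω)       ≡⟨ trans (A-+ _ _) (cong₂ _+_ (A-* r 1# hr) (A-* s ω hs)) ⟩
      r * A 1# + s * A ω       ≡⟨ interpolate (A 1#) (A ω) ω t r s hr hs (proj₂ δ⁻¹) ⟩
      (A 1# - j) * (r * 1# + s * ω) + j * conj (r * 1# + s * ω) ≡⟨ cong (λ z → (A 1# - j) * z + j * conj z) a≡ ⟨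
      (A 1# - j) * a + j * conj a ∎
    where
    open ≡-Reasoning
    δ⁻¹ = inverse (conj ω - ω) ω̄-ω≢0
    t = proj₁ δ⁻¹
    j = (A ω - ω * A 1#) * t
    interpolate : ∀ a₁ aω w t r s → r ∈ Fix → s ∈ Fix → (conj w - w) * t ≡ 1# →
      r * a₁ + s * aω ≡ (a₁ - (aω - w * a₁) * t) * (r * 1# + s * w) + (aω - w * a₁) * t * conj (r * 1# + s * w)
    interpolate a₁ aω w t r s hr hs δt≡1 =
      combine₃ hr (- ((aω - w * a₁) * t)) hs (- ((aω - w * a₁) * t * conj w)) δt≡1 (- (s * (aω - w * a₁)))
      (solve 6 (λ a₁ aω w t r s →
        (r :* a₁ :+ s :* aω) :- ((a₁ :- (aω :- w :* a₁) :* t) :* (r :* 𝟙 :+ s :* w) :+ (aω :- w :* a₁) :* t :* (r :* 𝟙 :+ s :* w) ᶜ)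
          := (:- ((aω :- w :* a₁) :* t)) :* (r ᶜ :- r) :+ (:- ((aω :- w :* a₁) :* t :* w ᶜ)) :* (s ᶜ :- s)
            :+ (:- (s :* (aω :- w :* a₁))) :* ((w ᶜ :- w) :* t :- 𝟙)) refl a₁ aω w t r s)

  twist : 𝔽 → 𝔽 → 𝔽
  twist g a = a + g * conj a

  Fix-1-N : ∀ g → 1# - N g ∈ Fix
  Fix-1-N g = solve 1 (λ g → (𝟙 :- g :* g ᶜ) ᶜ := 𝟙 :- g :* g ᶜ) refl g

  opaque
    -- `twist (- g)` undoes `twist g` up to the factor `1 - N g`.
    twist-surjective : ∀ {g} → N g ≢ 1# → ∀ y → ∃ λ a → twist g a ≡ y
    twist-surjective {g} N≢1 y with inverse (1# - N g) (neg-≢0 (≢-sym N≢1))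
    ... | t , e = (y - g * conj y) * t ,
      combine₂ e y (Fix-inverse e (Fix-1-N g)) (g * (conj y - conj g * y))
        (solve 3 (λ g y t → ((y :- g :* y ᶜ) :* t :+ g :* ((y :- g :* y ᶜ) :* t) ᶜ) :- y
          := y :* ((𝟙 :- g :* g ᶜ) :* t :- 𝟙) :+ g :* (y ᶜ :- g ᶜ :* y) :* (t ᶜ :- t)) refl g y t)

  opaque
    -- Every `a + ū ā` solves the equation, so only a nonzero value is needed. The choices `a = 1`
    -- and `a = ω` cannot both give 0, because `ω` is not fixed.
    hilbert90 : ∀ {u} → N u ≡ 1# → ∃ λ x → x ≢ 0# × conj x ≡ u * x
    hilbert90 {u} uū≡1 with twist (conj u) 1# ≟ 0#
    ... | no ≢0 = twist (conj u) 1# , ≢0 , combine₁ uū≡1 (- 1#)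
      (solve 1 (λ u → (𝟙 :+ u ᶜ :* 𝟙 ᶜ) ᶜ :- u :* (𝟙 :+ u ᶜ :* 𝟙 ᶜ) := (:- 𝟙) :* (u :* u ᶜ :- 𝟙)) refl u)
    ... | yes ≡0 = twist (conj u) ω , (λ e → ω̄-ω≢0 (combine₂ e (- 1#) ≡0 (conj ω)
        (solve 2 (λ u w → (w ᶜ :- w) :- 𝟘 := (:- 𝟙) :* ((w :+ u ᶜ :* w ᶜ) :- 𝟘) :+ w ᶜ :* ((𝟙 :+ u ᶜ :* 𝟙 ᶜ) :- 𝟘)) refl u ω))) ,
      combine₁ uū≡1 (- conj ω)
      (solve 2 (λ u w → (w :+ u ᶜ :* w ᶜ) ᶜ :- u :* (w :+ u ᶜ :* w ᶜ) := (:- (w ᶜ)) :* (u :* u ᶜ :- 𝟙)) refl u ω)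

  private
    q≡1+q-1 : q ≡ suc (q ∸ 1)
    q≡1+q-1 = sym (ℕ.m+[n∸m]≡n (ℕ.≤-trans (s≤s z≤n) 3≤q))

  module NormTransversal (Λ : Fin (q ∸ 1) → 𝔽) (Λ≢0 : ∀ i → Λ i ≢ 0#)
    (Λ-norms : Injective _≡_ _≡_ (N ∘ Λ)) where

    private
      fq′ : Fin (suc (q ∸ 1)) → 𝔽
      fq′ zero    = 0#
      fq′ (suc i) = N (Λ i)

      norm-Λ≢0 : ∀ i → N (Λ i) ≢ 0#
      norm-Λ≢0 i = *-nonzero (Λ≢0 i) (conj-≢0 (Λ≢0 i))

      fq′-injective : Injective _≡_ _≡_ fq′
      fq′-injective {zero}  {zero}  _ = refl
      fq′-injective {zero}  {suc j} e = contradiction (sym e) (norm-Λ≢0 j)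
      fq′-injective {suc i} {zero}  e = contradiction e (norm-Λ≢0 i)
      fq′-injective {suc i} {suc j} e = cong suc (Λ-norms e)

      fq′-∈ : ∀ i → fq′ i ∈ Fix
      fq′-∈ zero    = Fix-0
      fq′-∈ (suc i) = N-∈Fix (Λ i)

      -- Zero and the norms of `Λ` are q distinct fixed elements; one more would be a root too many
      -- for `x^q - x`.
      fq′-onto : ∀ x → x ∈ Fix → ∃ λ i → fq′ i ≡ x
      fq′-onto x hx with Fin.any? (λ i → fq′ i ≟ x)
      ... | yes p = p
      ... | no ¬p = contradiction all-fixed
          (subst (λ k → (f : Fin (suc k) → 𝔽) → Injective _≡_ _≡_ f → ¬ (∀ i → f i ∈ Fix)) q≡1+q-1 at-most-q-fixed f f-injective)
        where
        f : Fin (suc (suc (q ∸ 1))) → 𝔽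
        f zero    = x
        f (suc i) = fq′ i
        f-injective : Injective _≡_ _≡_ f
        f-injective {zero}  {zero}  _ = refl
        f-injective {zero}  {suc j} e = contradiction (j , sym e) ¬p
        f-injective {suc i} {zero}  e = contradiction (i , e) ¬p
        f-injective {suc i} {suc j} e = cong suc (fq′-injective e)
        all-fixed : ∀ i → f i ∈ Fix
        all-fixed zero    = hx
        all-fixed (suc i) = fq′-∈ i

    norm-onto : ∀ {x} → x ∈ Fix → x ≢ 0# → ∃ λ i → N (Λ i) ≡ x
    norm-onto {x} hx x≢0 with fq′-onto x hx
    ... | zero  , e = contradiction (sym e) x≢0
    ... | suc i , e = i , e

    private
      fq-bundle : Σ (Fin q → 𝔽) λ f → Injective _≡_ _≡_ f × (∀ i → f i ∈ Fix) × (∀ x → x ∈ Fix → ∃ λ i → f i ≡ x)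
      fq-bundle = subst (λ k → Σ (Fin k → 𝔽) λ f → Injective _≡_ _≡_ f × (∀ i → f i ∈ Fix) × (∀ x → x ∈ Fix → ∃ λ i → f i ≡ x))
        (sym q≡1+q-1) (fq′ , fq′-injective , fq′-∈ , fq′-onto)

      f : Fin q → 𝔽
      f = proj₁ fq-bundle

      f-fixed : ∀ i → f i ∈ Fix
      f-fixed = proj₁ (proj₂ (proj₂ fq-bundle))

    -- Representatives of the q+1 classes of nonzero elements modulo nonzero elements of Fix.
    direction : Fin (suc q) → 𝔽
    direction zero    = 1#
    direction (suc i) = ω + f i

    direction-wedge : ∀ i j → i ≢ j → wedge (direction i) (direction j) ≢ 0#
    direction-wedge zero    zero    i≢j = contradiction refl i≢j
    direction-wedge zero    (suc j) _ e = wedge-1-ω (combine₂ e 1# (f-fixed j) (- 1#)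
      (solve 2 (λ w f → (𝟙 :* w ᶜ :- 𝟙 ᶜ :* w) :- 𝟘 := 𝟙 :* ((𝟙 :* (w :+ f) ᶜ :- 𝟙 ᶜ :* (w :+ f)) :- 𝟘) :+ (:- 𝟙) :* (f ᶜ :- f)) refl ω (f j)))
    direction-wedge (suc i) zero    _ e = wedge-1-ω (combine₂ e (- 1#) (f-fixed i) (- 1#)
      (solve 2 (λ w f → (𝟙 :* w ᶜ :- 𝟙 ᶜ :* w) :- 𝟘 := (:- 𝟙) :* (((w :+ f) :* 𝟙 ᶜ :- (w :+ f) ᶜ :* 𝟙) :- 𝟘) :+ (:- 𝟙) :* (f ᶜ :- f)) refl ω (f i)))
    direction-wedge (suc i) (suc j) i≢j e =
      i≢j (cong suc (proj₁ (proj₂ fq-bundle) (*-cancel-≡ ω̄-ω≢0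
        (combine₃ e 1# (f-fixed i) (ω + f j) (f-fixed j) (- (ω + f i))
        (solve 3 (λ w f g → (w ᶜ :- w) :* (f :- g) :- 𝟘
          := 𝟙 :* ((w :+ f) :* (w :+ g) ᶜ :- (w :+ f) ᶜ :* (w :+ g) :- 𝟘) :+ (w :+ g) :* (f ᶜ :- f) :+ (:- (w :+ f)) :* (g ᶜ :- g)) refl ω (f i) (f j))))))

    direction≢0 : ∀ i → direction i ≢ 0#
    direction≢0 zero    = 1≢0
    direction≢0 (suc i) e = ω∉Fix (combine₂ (trans (cong conj e) conj-0) 1# (trans (f-fixed i) (x-y≡0⇒x≡y (trans (solve 2 (λ w f → f :- (:- w) := w :+ f) refl ω (f i)) e))) (- 1#)
      (solve 2 (λ w f → w ᶜ :- w := 𝟙 :* ((w :+ f) ᶜ :- 𝟘) :+ (:- 𝟙) :* (f ᶜ :- (:- w))) refl ω (f i)))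

    direction-onto : ∀ {d} → d ≢ 0# → ∃₂ λ i r → r ∈ Fix × r ≢ 0# × d ≡ r * direction i
    direction-onto {d} d≢0 with ω-coordinates d
    ... | r , s , hr , hs , refl with s ≟ 0#
    ...   | yes refl = zero , r , hr , (λ { refl → d≢0 (solve 1 (λ w → 𝟘 :* 𝟙 :+ 𝟘 :* w := 𝟘) refl ω) }) ,
            solve 2 (λ r w → r :* 𝟙 :+ 𝟘 :* w := r :* 𝟙) refl r ω
    ...   | no s≢0 with inverse s s≢0
    ...     | t , st≡1 with proj₂ (proj₂ (proj₂ fq-bundle)) (r * t) (Fix-* hr (Fix-inverse st≡1 hs))
    ...       | i , e = suc i , s , hs , s≢0 , combine₂ st≡1 (- r) e (- s)
                (solve 5 (λ r s t w f → (r :* 𝟙 :+ s :* w) :- s :* (w :+ f) := (:- r) :* (s :* t :- 𝟙) :+ (:- s) :* (f :- r :* t)) refl r s t ω (f i))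

-- Equivalence of binary predicates

infix 4 _≃_

record _≃_ {A B : Set} (P Q : A → B → Set) : Set where
  constructor equiv
  field
    to   : ∀ {x y} → P x y → Q x y
    from : ∀ {x y} → Q x y → P x y
open _≃_

≃-sym : ∀ {A B : Set} {P Q : A → B → Set} → P ≃ Q → Q ≃ P
≃-sym h = equiv (from h) (to h)

≃-trans : ∀ {A B : Set} {P Q R : A → B → Set} → P ≃ Q → Q ≃ R → P ≃ R
≃-trans h k = equiv (λ p → to k (to h p)) (λ r → from h (from k r))

module HallParallelisms (q : ℕ) (3≤q : 3 ≤ q) (pp : IsPrimePower q) (F : FiniteField (q ℕ.^ 2))
  (setting : Geometry.Setting q F) where
  open Conjugation q 3≤q pp F
  open Geometry q F public using (_⊕_; _·_; 𝟎; Point; point; vec; nonzero; PointSet; _∼_; ⟨_,_⟩; Independent;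
    Line; on; IsBaerSubline; U₁; U₂; U₃; t₁; r-U₁; τ; ι; Baer; elation; P⟨_⟩; π⟨_⟩; pencil; module Setting; module Construction)
  open Setting setting public hiding (a; t)
  open Construction setting public
  open Lineη public using (X; Y; X∈Ση; Y∈Ση; distinct)

  N-η : N η ≡ 1#
  N-η = trans (sym (norm≡ η)) η∈𝒰

  -- Lines of Ση in coordinates

  ι′ : 𝔽 → 𝔽 → 𝔽 → Vec 𝔽 4
  ι′ α x y = x ∷ y ∷ α * conj x ∷ α * conj y ∷ []

  ι≡ι′ : ∀ α x y → ι α (x ∷ y ∷ []) ≡ ι′ α x y
  ι≡ι′ α x y = sym (cong₂ (λ x̄ ȳ → x ∷ y ∷ α * x̄ ∷ α * ȳ ∷ []) (conj≡^q x) (conj≡^q y))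

  vec4 : ∀ {a b c d a′ b′ c′ d′ : 𝔽} → a ≡ a′ → b ≡ b′ → c ≡ c′ → d ≡ d′ →
    _≡_ {A = Vec 𝔽 4} (a ∷ b ∷ c ∷ d ∷ []) (a′ ∷ b′ ∷ c′ ∷ d′ ∷ [])
  vec4 refl refl refl refl = refl

  vec4-injective : ∀ {a b c d a′ b′ c′ d′ : 𝔽} →
    _≡_ {A = Vec 𝔽 4} (a ∷ b ∷ c ∷ d ∷ []) (a′ ∷ b′ ∷ c′ ∷ d′ ∷ []) → a ≡ a′ × b ≡ b′ × c ≡ c′ × d ≡ d′
  vec4-injective refl = refl , refl , refl , refl

  ·-· : ∀ {n} k l (a : Vec 𝔽 n) → k · (l · a) ≡ (k * l) · a
  ·-· k l []      = refl
  ·-· k l (x ∷ a) = cong₂ _∷_ (sym (*-assoc k l x)) (·-· k l a)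

  1·_ : ∀ {n} (a : Vec 𝔽 n) → 1# · a ≡ a
  1· []      = refl
  1· (x ∷ a) = cong₂ _∷_ (*-identityˡ x) (1· a)

  0·_ : ∀ {n} (a : Vec 𝔽 n) → 0# · a ≡ 𝟎
  0· []      = refl
  0· (x ∷ a) = cong₂ _∷_ (zeroˡ x) (0· a)

  0·⊕0· : ∀ {n} (a b : Vec 𝔽 n) → 0# · a ⊕ 0# · b ≡ 𝟎
  0·⊕0· []      []      = refl
  0·⊕0· (x ∷ a) (y ∷ b) = cong₂ _∷_ (solve 2 (λ x y → 𝟘 :* x :+ 𝟘 :* y := 𝟘) refl x y) (0·⊕0· a b)

  ·-combination : ∀ {n} k s t (a b : Vec 𝔽 n) → k · (s · a ⊕ t · b) ≡ (k * s) · a ⊕ (k * t) · b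
  ·-combination k s t []      []      = refl
  ·-combination k s t (x ∷ a) (y ∷ b) = cong₂ _∷_
    (solve 5 (λ k s t x y → k :* (s :* x :+ t :* y) := k :* s :* x :+ k :* t :* y) refl k s t x y) (·-combination k s t a b)

  Origin : 𝔽 → 𝔽 → Set
  Origin x y = x ≡ 0# × y ≡ 0#

  origin? : ∀ x y → Dec (Origin x y)
  origin? x y = x ≟ 0# ×-dec y ≟ 0#

  pt : ∀ x y → ¬ Origin x y → Point
  pt x y ≢0 = point (ι′ η x y) λ e → ≢0 (let x≡0 , y≡0 , _ = vec4-injective e in x≡0 , y≡0)

  pt∈Ση : ∀ {x y} (≢0 : ¬ Origin x y) → pt x y ≢0 ∈ Ση
  pt∈Ση {x} {y} ≢0 = (x ∷ y ∷ []) , 1# , trans (sym (1· ι′ η x y)) (cong (1# ·_) (sym (ι≡ι′ η x y)))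

  -- The normalised vector of (x, y) lies in the span of `a` and `b`. As a predicate on (x, y) this
  -- is a subspace over the fixed field.
  Section : Vec 𝔽 4 → Vec 𝔽 4 → 𝔽 → 𝔽 → Set
  Section a b x y = ∃₂ λ s t → ι′ η x y ≡ s · a ⊕ t · b

  section : Vec 𝔽 4 → Vec 𝔽 4 → PointSet
  section a b = ⟨ a , b ⟩ ∩ Ση

  Ση-coordinates : ∀ P → P ∈ Ση → ∃₂ λ x y → ∃₂ λ k l → vec P ≡ k · ι′ η x y × l * k ≡ 1# × ¬ Origin x y
  Ση-coordinates P ((x ∷ y ∷ []) , k , e) = x , y , k , proj₁ k⁻¹ , e′ , trans (*-comm (proj₁ k⁻¹) k) (proj₂ k⁻¹) ,
    λ { (refl , refl) → nonzero P (trans e′ (vec4 (zeroʳ k) (zeroʳ k) z z)) }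
    where
    e′ : vec P ≡ k · ι′ η x y
    e′ = trans e (cong (k ·_) (ι≡ι′ η x y))
    k≢0 : k ≢ 0#
    k≢0 refl = nonzero P (trans e (0· ι η (x ∷ y ∷ [])))
    k⁻¹ = inverse k k≢0
    z : k * (η * conj 0#) ≡ 0#
    z = solve 2 (λ k h → k :* (h :* 𝟘 ᶜ) := 𝟘) refl k η

  section-at : ∀ {a b x y k l} P → P ∈ ⟨ a , b ⟩ → vec P ≡ k · ι′ η x y → l * k ≡ 1# → Section a b x y
  section-at {a} {b} {x} {y} {k} {l} P (s , t , e) e′ lk≡1 = l * s , l * t , (begin
      ι′ η x y                     ≡⟨ 1· ι′ η x y ⟨
      1# · ι′ η x y                ≡⟨ cong (_· ι′ η x y) lk≡1 ⟨
      (l * k) · ι′ η x y           ≡⟨ ·-· l k (ι′ η x y) ⟨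
      l · (k · ι′ η x y)           ≡⟨ cong (l ·_) (trans (sym e′) e) ⟩
      l · (s · a ⊕ t · b)          ≡⟨ ·-combination l s t a b ⟩
      (l * s) · a ⊕ (l * t) · b ∎)
    where open ≡-Reasoning

  opaque
    section-coordinates : ∀ {a b} P → P ∈ section a b →
      ∃₂ λ x y → ∃ λ k → vec P ≡ k · ι′ η x y × Section a b x y × ¬ Origin x y
    section-coordinates P (P∈ , P∈Ση) = let x , y , k , l , e , lk≡1 , ≢0 = Ση-coordinates P P∈Ση in
      x , y , k , e , section-at P P∈ e lk≡1 , ≢0

  section-point : ∀ {a b x y k} P → Section a b x y → vec P ≡ k · ι′ η x y → P ∈ section a b
  section-point {a} {b} {x} {y} {k} P (s , t , e) e′ =
    (k * s , k * t , trans e′ (trans (cong (k ·_) e) (·-combination k s t a b))) ,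
    (x ∷ y ∷ []) , k , trans e′ (cong (k ·_) (sym (ι≡ι′ η x y)))

  -- The origin is no point, but admitting it in every section lets lines be compared as subspaces.
  Section-origin : ∀ {a b x y} → Origin x y → Section a b x y
  Section-origin {a} {b} (refl , refl) = 0# , 0# , trans (vec4 refl refl z z) (sym (0·⊕0· a b))
    where
    z : η * conj 0# ≡ 0#
    z = solve 1 (λ h → h :* 𝟘 ᶜ := 𝟘) refl η

  section-⊆ : ∀ {a b c d} → (∀ {x y} → Section a b x y → Section c d x y) → section a b ⊆ section c d
  section-⊆ h {P} P∈ = let x , y , k , e , S , _ = section-coordinates P P∈ in section-point P (h S) e

  section-⊆⁻¹ : ∀ {a b c d} → section a b ⊆ section c d → ∀ {x y} → Section a b x y → Section c d x y
  section-⊆⁻¹ h {x} {y} S with origin? x y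
  ... | yes o = Section-origin o
  ... | no ≢0 = proj₁ (h {pt x y ≢0} (S , pt∈Ση ≢0))

  opaque
    section-≐ : ∀ {a b c d} → Section a b ≃ Section c d → section a b ≐ section c d
    section-≐ {a} {b} {c} {d} h = (λ {P} → section-⊆ {a} {b} {c} {d} (to h) {P}) , (λ {P} → section-⊆ {c} {d} {a} {b} (from h) {P})

  opaque
    section-≐⁻¹ : ∀ {a b c d} → section a b ≐ section c d → Section a b ≃ Section c d
    section-≐⁻¹ {a} {b} {c} {d} (h , k) = equiv (section-⊆⁻¹ {a} {b} {c} {d} (λ {P} → h {P})) (section-⊆⁻¹ {c} {d} {a} {b} (λ {P} → k {P}))

  -- The two-dimensional subspace of 𝔽² over the fixed field that belongs to a line of `Ση`.
  W : Lineη → 𝔽 → 𝔽 → Set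
  W m = Section (vec (X m)) (vec (Y m))

  ≈⇒≃ : ∀ {m n} → m ≈ n → W m ≃ W n
  ≈⇒≃ {m} {n} = section-≐⁻¹ {vec (X m)} {vec (Y m)} {vec (X n)} {vec (Y n)}

  ≃⇒≈ : ∀ {m n} → W m ≃ W n → m ≈ n
  ≃⇒≈ {m} {n} = section-≐ {vec (X m)} {vec (Y m)} {vec (X n)} {vec (Y n)}

  Meet : Lineη → Lineη → Set
  Meet m n = ∃₂ λ x y → ¬ Origin x y × W m x y × W n x y

  ≬⇒Meet : ∀ {m n} → pts m ≬ pts n → Meet m n
  ≬⇒Meet (P , (P∈m , P∈Ση) , (P∈n , _)) = let x , y , k , l , e , lk≡1 , ≢0 = Ση-coordinates P P∈Ση in
    x , y , ≢0 , section-at P P∈m e lk≡1 , section-at P P∈n e lk≡1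

  Meet⇒≬ : ∀ {m n} → Meet m n → pts m ≬ pts n
  Meet⇒≬ (x , y , ≢0 , Wm , Wn) = pt x y ≢0 , (Wm , pt∈Ση ≢0) , (Wn , pt∈Ση ≢0)

  Span : 𝔽 → 𝔽 → 𝔽 → 𝔽 → 𝔽 → 𝔽 → Set
  Span x₁ y₁ x₂ y₂ x y = ∃₂ λ r s → r ∈ Fix × s ∈ Fix × x ≡ r * x₁ + s * x₂ × y ≡ r * y₁ + s * y₂

  𝔽q-Independent : 𝔽 → 𝔽 → 𝔽 → 𝔽 → Set
  𝔽q-Independent x₁ y₁ x₂ y₂ = ∀ r s → r ∈ Fix → s ∈ Fix →
    r * x₁ + s * x₂ ≡ 0# → r * y₁ + s * y₂ ≡ 0# → r ≡ 0# × s ≡ 0#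

  -- Points of Ση are fixed by the semilinear map τ η, so the coordinates of a
  -- point of Ση with respect to two others are, by uniqueness, fixed by conj.
  module _ {x₁ y₁ x₂ y₂ : 𝔽} (independent : ∀ k → ι′ η x₁ y₁ ≢ k · ι′ η x₂ y₂) (≢0₂ : ¬ Origin x₂ y₂) where

    private
      fixed-part : ∀ {x z w} a b → x ≡ a * z + b * w → η * conj x ≡ a * (η * conj z) + b * (η * conj w) →
        (a - conj a) * z + (b - conj b) * w ≡ 0#
      fixed-part {x} {z} {w} a b e e′ = combine₃ e (- 1#) (cong conj e′) η N-η (- (x - conj a * z - conj b * w))
        (solve 6 (λ a b x z w h → ((a :- a ᶜ) :* z :+ (b :- b ᶜ) :* w) :- 𝟘
          := (:- 𝟙) :* (x :- (a :* z :+ b :* w)) :+ h :* ((h :* x ᶜ) ᶜ :- (a :* (h :* z ᶜ) :+ b :* (h :* w ᶜ)) ᶜ)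
            :+ (:- (x :- a ᶜ :* z :- b ᶜ :* w)) :* (h :* h ᶜ :- 𝟙)) refl a b x z w η)

      -- Conjugation negates `e` and `f`, so `e z + f w = 0` implies the same relation for `conj z`
      -- and `conj w`. A relation in the first two coordinates thus extends to all four.
      dependent : ∀ {e f i z w} → conj e ≡ - e → conj f ≡ - f → e * i ≡ 1# → e * z + f * w ≡ 0# →
        z ≡ - (f * i) * w × η * conj z ≡ - (f * i) * (η * conj w)
      dependent {e} {f} {i} {z} {w} ē f̄ ei≡1 h =
        combine₂ h i ei≡1 (- z) (solve 5 (λ e f i z w → z :- (:- (f :* i)) :* w
          := i :* ((e :* z :+ f :* w) :- 𝟘) :+ (:- z) :* (e :* i :- 𝟙)) refl e f i z w) ,
        combine₂ h̄ (η * i) ei≡1 (- (η * conj z)) (solve 6 (λ e f i z w h → h :* z ᶜ :- (:- (f :* i)) :* (h :* w ᶜ)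
          := h :* i :* ((e :* z ᶜ :+ f :* w ᶜ) :- 𝟘) :+ (:- (h :* z ᶜ)) :* (e :* i :- 𝟙)) refl e f i z w η)
        where
        h̄ : e * conj z + f * conj w ≡ 0#
        h̄ = combine₃ (trans (cong conj h) conj-0) (- 1#) ē (conj z) f̄ (conj w)
          (solve 4 (λ e f z w → (e :* z ᶜ :+ f :* w ᶜ) :- 𝟘 := (:- 𝟙) :* ((e :* z :+ f :* w) ᶜ :- 𝟘)
            :+ z ᶜ :* (e ᶜ :- (:- e)) :+ w ᶜ :* (f ᶜ :- (:- f))) refl e f z w)

      anti-fixed-zero : ∀ {e f} → conj e ≡ - e → conj f ≡ - f →
        e * x₁ + f * x₂ ≡ 0# → e * y₁ + f * y₂ ≡ 0# → e ≡ 0# × f ≡ 0#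
      anti-fixed-zero {e} {f} ē f̄ hx hy with e ≟ 0#
      ... | no e≢0 = contradiction (vec4 (proj₁ dx) (proj₁ dy) (proj₂ dx) (proj₂ dy)) (independent _)
        where
        e⁻¹ = inverse e e≢0
        dx = dependent ē f̄ (proj₂ e⁻¹) hx
        dy = dependent ē f̄ (proj₂ e⁻¹) hy
      ... | yes e≡0 with f ≟ 0#
      ...   | yes f≡0 = e≡0 , f≡0
      ...   | no f≢0 = contradiction (zero-at hx , zero-at hy) ≢0₂
        where
        zero-at : ∀ {z w} → e * z + f * w ≡ 0# → w ≡ 0#
        zero-at {z} {w} h = *-cancel-0 f≢0 (combine₂ h 1# e≡0 (- z)
          (solve 4 (λ e f z w → f :* w :- 𝟘 := 𝟙 :* ((e :* z :+ f :* w) :- 𝟘) :+ (:- z) :* (e :- 𝟘)) refl e f z w))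

    Section⇒Span : ∀ {k₁ k₂ x y} → Section (k₁ · ι′ η x₁ y₁) (k₂ · ι′ η x₂ y₂) x y → Span x₁ y₁ x₂ y₂ x y
    Section⇒Span {k₁} {k₂} {x} {y} (s , t , e) with vec4-injective e
    ... | ex , ey , ex̄ , eȳ = a , b , fixed a ea , fixed b eb ,
        trans ex (regroup s k₁ x₁ t k₂ x₂) , trans ey (regroup s k₁ y₁ t k₂ y₂)
      where
      a b : 𝔽
      a = s * k₁
      b = t * k₂
      regroup : ∀ s k z t l w → s * (k * z) + t * (l * w) ≡ s * k * z + t * l * w
      regroup = solve 6 (λ s k z t l w → s :* (k :* z) :+ t :* (l :* w) := s :* k :* z :+ t :* l :* w) refl
      anti : ∀ c → conj (c - conj c) ≡ - (c - conj c)
      anti = solve 1 (λ c → (c :- c ᶜ) ᶜ := :- (c :- c ᶜ)) refl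
      zeros = anti-fixed-zero (anti a) (anti b)
        (fixed-part a b (trans ex (regroup s k₁ x₁ t k₂ x₂)) (trans ex̄ (regroup s k₁ (η * conj x₁) t k₂ (η * conj x₂))))
        (fixed-part a b (trans ey (regroup s k₁ y₁ t k₂ y₂)) (trans eȳ (regroup s k₁ (η * conj y₁) t k₂ (η * conj y₂))))
      ea = proj₁ zeros
      eb = proj₂ zeros
      fixed : ∀ c → c - conj c ≡ 0# → conj c ≡ c
      fixed c h = sym (x-y≡0⇒x≡y h)

    independent⇒𝔽q-Independent : 𝔽q-Independent x₁ y₁ x₂ y₂
    independent⇒𝔽q-Independent r s hr hs hx hy = cancel (proj₁ zeros) , cancel (proj₂ zeros)
      where
      -- Multiplication by `δ` turns fixed coefficients into coefficients negated by conjugation, to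
      -- which `anti-fixed-zero` applies.
      δ = conj ω - ω
      anti : ∀ {c} → c ∈ Fix → conj (c * δ) ≡ - (c * δ)
      anti {c} hc = combine₁ hc (- δ) (solve 2 (λ c w → (c :* (w ᶜ :- w)) ᶜ :- (:- (c :* (w ᶜ :- w)))
        := (:- (w ᶜ :- w)) :* (c ᶜ :- c)) refl c ω)
      scale : ∀ {z w} → r * z + s * w ≡ 0# → r * δ * z + s * δ * w ≡ 0#
      scale {z} {w} h = combine₁ h δ (solve 5 (λ r s z w d → (r :* d :* z :+ s :* d :* w) :- 𝟘
        := d :* ((r :* z :+ s :* w) :- 𝟘)) refl r s z w δ)
      zeros = anti-fixed-zero (anti hr) (anti hs) (scale hx) (scale hy)
      cancel : ∀ {c} → c * δ ≡ 0# → c ≡ 0#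
      cancel {c} h = *-cancel-0 ω̄-ω≢0 (trans (*-comm δ c) h)

  Span⇒Section : ∀ {x₁ y₁ x₂ y₂ k₁ k₂ l₁ l₂ x y} → l₁ * k₁ ≡ 1# → l₂ * k₂ ≡ 1# → Span x₁ y₁ x₂ y₂ x y →
    Section (k₁ · ι′ η x₁ y₁) (k₂ · ι′ η x₂ y₂) x y
  Span⇒Section {x₁} {y₁} {x₂} {y₂} {k₁} {k₂} {l₁} {l₂} h₁ h₂ (r , s , hr , hs , refl , refl) =
    r * l₁ , s * l₂ , vec4 (plain x₁ x₂) (plain y₁ y₂) (conjugate x₁ x₂) (conjugate y₁ y₂)
    where
    plain : ∀ z w → r * z + s * w ≡ r * l₁ * (k₁ * z) + s * l₂ * (k₂ * w)
    plain z w = combine₂ h₁ (- (r * z)) h₂ (- (s * w))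
      (solve 8 (λ r s z w k₁ k₂ l₁ l₂ → (r :* z :+ s :* w) :- (r :* l₁ :* (k₁ :* z) :+ s :* l₂ :* (k₂ :* w))
        := (:- (r :* z)) :* (l₁ :* k₁ :- 𝟙) :+ (:- (s :* w)) :* (l₂ :* k₂ :- 𝟙)) refl r s z w k₁ k₂ l₁ l₂)
    conjugate : ∀ z w → η * conj (r * z + s * w) ≡ r * l₁ * (k₁ * (η * conj z)) + s * l₂ * (k₂ * (η * conj w))
    conjugate z w = trans (combine₂ hr (η * conj z) hs (η * conj w)
      (solve 5 (λ r s z w h → h :* (r :* z :+ s :* w) ᶜ :- (r :* (h :* z ᶜ) :+ s :* (h :* w ᶜ))
        := h :* z ᶜ :* (r ᶜ :- r) :+ h :* w ᶜ :* (s ᶜ :- s)) refl r s z w η))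
      (plain (η * conj z) (η * conj w))

  opaque
    -- The last two coordinates, conjugated, say that `conj k` does what `k` does to the first two.
    -- One of `x₂`, `y₂` is nonzero and can be cancelled.
    multiplier-fixed : ∀ {x₁ y₁ x₂ y₂ k} → ι′ η x₁ y₁ ≡ k · ι′ η x₂ y₂ → ¬ Origin x₂ y₂ → k ∈ Fix
    multiplier-fixed {x₁} {y₁} {x₂} {y₂} {k} e ≢0₂ = go (x₂ ≟ 0#) (y₂ ≟ 0#) (vec4-injective e)
      where
      fixed-at : ∀ {z w} → z ≡ k * w → η * conj z ≡ k * (η * conj w) → w * (conj k - k) ≡ 0#
      fixed-at {z} {w} h h̄ = combine₃ h 1# (cong conj h̄) (- η) N-η (z - conj k * w)
        (solve 4 (λ k z w h → w :* (k ᶜ :- k) :- 𝟘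
          := 𝟙 :* (z :- k :* w) :+ (:- h) :* ((h :* z ᶜ) ᶜ :- (k :* (h :* w ᶜ)) ᶜ) :+ (z :- k ᶜ :* w) :* (h :* h ᶜ :- 𝟙)) refl k z w η)
      go : Dec (x₂ ≡ 0#) → Dec (y₂ ≡ 0#) →
        x₁ ≡ k * x₂ × y₁ ≡ k * y₂ × η * conj x₁ ≡ k * (η * conj x₂) × η * conj y₁ ≡ k * (η * conj y₂) → k ∈ Fix
      go (no x₂≢0)  _          (ex , _ , ex̄ , _) = *-cancel-≡ x₂≢0 (fixed-at ex ex̄)
      go (yes _)    (no y₂≢0)  (_ , ey , _ , eȳ) = *-cancel-≡ y₂≢0 (fixed-at ey eȳ)
      go (yes x₂≡0) (yes y₂≡0) _                 = contradiction (x₂≡0 , y₂≡0) ≢0₂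

  𝔽q-Independent⇒independent : ∀ {x₁ y₁ x₂ y₂} → 𝔽q-Independent x₁ y₁ x₂ y₂ →
    (∀ k → ι′ η x₁ y₁ ≢ k · ι′ η x₂ y₂) × ¬ Origin x₁ y₁ × ¬ Origin x₂ y₂
  𝔽q-Independent⇒independent {x₁} {y₁} {x₂} {y₂} ind = not-multiple , ≢0₁ , ≢0₂
    where
    ≢0₁ : ¬ Origin x₁ y₁
    ≢0₁ (refl , refl) = 1≢0 (proj₁ (ind 1# 0# Fix-1 Fix-0 (z x₂) (z y₂)))
      where
      z : ∀ w → 1# * 0# + 0# * w ≡ 0#
      z = solve 1 (λ w → 𝟙 :* 𝟘 :+ 𝟘 :* w := 𝟘) refl
    ≢0₂ : ¬ Origin x₂ y₂
    ≢0₂ (refl , refl) = 1≢0 (proj₂ (ind 0# 1# Fix-0 Fix-1 (z x₁) (z y₁)))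
      where
      z : ∀ w → 0# * w + 1# * 0# ≡ 0#
      z = solve 1 (λ w → 𝟘 :* w :+ 𝟙 :* 𝟘 := 𝟘) refl
    not-multiple : ∀ k → ι′ η x₁ y₁ ≢ k · ι′ η x₂ y₂
    not-multiple k e = let ex , ey , _ = vec4-injective e in
      1≢0 (proj₁ (ind 1# (- k) Fix-1 (Fix-neg (multiplier-fixed e ≢0₂)) (zero-at ex) (zero-at ey)))
      where
      zero-at : ∀ {z w} → z ≡ k * w → 1# * z + - k * w ≡ 0#
      zero-at {z} {w} h = combine₁ h 1# (solve 3 (λ k z w → (𝟙 :* z :+ (:- k) :* w) :- 𝟘 := 𝟙 :* (z :- k :* w)) refl k z w)

  record Basis (m : Lineη) : Set where
    field
      x₁ y₁ x₂ y₂ : 𝔽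
      independent : 𝔽q-Independent x₁ y₁ x₂ y₂
      spans       : W m ≃ Span x₁ y₁ x₂ y₂

  opaque
    basis : ∀ m → Basis m
    basis m with Ση-coordinates (X m) (X∈Ση m) | Ση-coordinates (Y m) (Y∈Ση m)
    ... | x₁ , y₁ , k₁ , l₁ , e₁ , h₁ , ≢0₁ | x₂ , y₂ , k₂ , l₂ , e₂ , h₂ , ≢0₂ = record
      { independent = independent⇒𝔽q-Independent ind ≢0₂
      ; spans = subst₂ (λ a b → Section a b ≃ Span x₁ y₁ x₂ y₂) (sym e₁) (sym e₂)
          (equiv (Section⇒Span ind ≢0₂) (Span⇒Section h₁ h₂))
      }
      where
      open ≡-Reasoning
      ind : ∀ k → ι′ η x₁ y₁ ≢ k · ι′ η x₂ y₂
      ind k e = distinct m (k₁ * k * l₂ , (begin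
        vec (X m)                               ≡⟨ e₁ ⟩
        k₁ · ι′ η x₁ y₁                         ≡⟨ cong (k₁ ·_) e ⟩
        k₁ · (k · ι′ η x₂ y₂)                   ≡⟨ cong (λ v → k₁ · (k · v)) (1· ι′ η x₂ y₂) ⟨
        k₁ · (k · (1# · ι′ η x₂ y₂))            ≡⟨ cong (λ c → k₁ · (k · (c · ι′ η x₂ y₂))) h₂ ⟨
        k₁ · (k · ((l₂ * k₂) · ι′ η x₂ y₂))     ≡⟨ trans (·-· k₁ k _) (trans (cong ((k₁ * k) ·_) (sym (·-· l₂ k₂ _))) (·-· (k₁ * k) l₂ _)) ⟩
        (k₁ * k * l₂) · (k₂ · ι′ η x₂ y₂)       ≡⟨ cong ((k₁ * k * l₂) ·_) e₂ ⟨
        (k₁ * k * l₂) · vec (Y m) ∎))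

  opaque
    span-line : ∀ {x₁ y₁ x₂ y₂} → 𝔽q-Independent x₁ y₁ x₂ y₂ → ∃ λ m → W m ≃ Span x₁ y₁ x₂ y₂
    span-line {x₁} {y₁} {x₂} {y₂} ind with 𝔽q-Independent⇒independent ind
    ... | not-multiple , ≢0₁ , ≢0₂ =
      record { X = pt x₁ y₁ ≢0₁ ; Y = pt x₂ y₂ ≢0₂ ; X∈Ση = pt∈Ση ≢0₁ ; Y∈Ση = pt∈Ση ≢0₂ ; distinct = λ (k , e) → not-multiple k e } ,
      subst₂ (λ a b → Section a b ≃ Span x₁ y₁ x₂ y₂) (1· ι′ η x₁ y₁) (1· ι′ η x₂ y₂)
        (equiv (Section⇒Span not-multiple ≢0₂) (Span⇒Section (*-identityˡ 1#) (*-identityˡ 1#)))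

  Section-scale : ∀ {a b x y x′ y′ k} → ι′ η x y ≡ k · ι′ η x′ y′ → Section a b x′ y′ → Section a b x y
  Section-scale {a} {b} {k = k} e (s , t , e′) = k * s , k * t , trans e (trans (cong (k ·_) e′) (·-combination k s t a b))

  -- A set of points of Ση that corresponds to the set Q of coordinate pairs.
  record Coordinates (B : PointSet) (Q : 𝔽 → 𝔽 → Set) : Set where
    field
      coordinates : ∀ P → P ∈ B → ∃₂ λ x y → ∃ λ k → Q x y × vec P ≡ k · ι′ η x y
      member      : ∀ P {x y k} → Q x y → ¬ Origin x y → vec P ≡ k · ι′ η x y → P ∈ B
      at-origin   : Q 0# 0#
      scale       : ∀ {x y x′ y′ k} → Q x′ y′ → ι′ η x y ≡ k · ι′ η x′ y′ → Q x y

  module _ {B Q} (C : Coordinates B Q) where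
    open Coordinates C

    opaque
      ≐⇒≃ : ∀ {m} → pts m ≐ B → W m ≃ Q
      ≐⇒≃ {m} (h , k) = equiv forth back
        where
        forth : ∀ {x y} → W m x y → Q x y
        forth {x} {y} w with origin? x y
        ... | yes (x≡0 , y≡0) = subst₂ Q (sym x≡0) (sym y≡0) at-origin
        ... | no ≢0 = let x′ , y′ , κ , Qxy , e = coordinates (pt x y ≢0) (h {pt x y ≢0} (w , pt∈Ση ≢0)) in scale Qxy e
        back : ∀ {x y} → Q x y → W m x y
        back {x} {y} Qxy with origin? x y
        ... | yes o = Section-origin o
        ... | no ≢0 = proj₁ (k {pt x y ≢0} (member (pt x y ≢0) Qxy ≢0 (sym (1· ι′ η x y))))

    opaque
      ≃⇒≐ : ∀ {m} → W m ≃ Q → pts m ≐ B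
      ≃⇒≐ {m} h =
        (λ {P} P∈m → let x , y , k , e , w , ≢0 = section-coordinates P P∈m in member P (to h w) ≢0 e) ,
        (λ {P} P∈B → let x , y , k , Qxy , e = coordinates P P∈B in section-point P (from h Qxy) e)

  Infinity : 𝔽 → 𝔽 → Set
  Infinity x y = y ≡ 0#

  -- For nonzero `k` and `y₀`, the line that meets `y = 0` only in the point (k, 0) and passes
  -- through (x₀, y₀).
  Chord : 𝔽 → 𝔽 → 𝔽 → 𝔽 → 𝔽 → Set
  Chord k x₀ y₀ x y = ∃₂ λ r s → r ∈ Fix × s ∈ Fix × x ≡ r * k + s * x₀ × y ≡ s * y₀

  Graph : 𝔽 → 𝔽 → 𝔽 → 𝔽 → Set
  Graph M N x y = x ≡ M * y + N * conj y

  -- The cases are the dimensions 2, 1 and 0 of the intersection with `y = 0`.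
  data Shape (m : Lineη) : Set where
    infinity : W m ≃ Infinity → Shape m
    chord    : ∀ {k x₀ y₀} → k ≢ 0# → y₀ ≢ 0# → W m ≃ Chord k x₀ y₀ → Shape m
    graph    : ∀ {M N} → W m ≃ Graph M N → Shape m

  Span≃Graph : ∀ {M N x₁ y₁ x₂ y₂} → wedge y₁ y₂ ≢ 0# → Graph M N x₁ y₁ → Graph M N x₂ y₂ →
    Span x₁ y₁ x₂ y₂ ≃ Graph M N
  Span≃Graph {M} {N} {x₁} {y₁} {x₂} {y₂} w≢0 refl refl = equiv on-graph in-span
    where
    evaluate : ∀ r s → r ∈ Fix → s ∈ Fix →
      r * (M * y₁ + N * conj y₁) + s * (M * y₂ + N * conj y₂) ≡ M * (r * y₁ + s * y₂) + N * conj (r * y₁ + s * y₂)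
    evaluate r s hr hs = combine₂ hr (- (N * conj y₁)) hs (- (N * conj y₂))
      (solve 6 (λ r s m n y₁ y₂ → (r :* (m :* y₁ :+ n :* y₁ ᶜ) :+ s :* (m :* y₂ :+ n :* y₂ ᶜ))
          :- (m :* (r :* y₁ :+ s :* y₂) :+ n :* (r :* y₁ :+ s :* y₂) ᶜ)
        := (:- (n :* y₁ ᶜ)) :* (r ᶜ :- r) :+ (:- (n :* y₂ ᶜ)) :* (s ᶜ :- s)) refl r s M N y₁ y₂)
    on-graph : ∀ {x y} → Span _ y₁ _ y₂ x y → Graph M N x y
    on-graph (r , s , hr , hs , refl , refl) = evaluate r s hr hs
    in-span : ∀ {x y} → Graph M N x y → Span _ y₁ _ y₂ x y
    in-span {x} {y} refl with Fix-basis w≢0 y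
    ... | r , s , hr , hs , refl = r , s , hr , hs , sym (evaluate r s hr hs) , refl

  private
    module ShapeOf {x₁ y₁ x₂ y₂ : 𝔽} (ind : 𝔽q-Independent x₁ y₁ x₂ y₂) where

      first≢0 : ¬ (x₁ ≡ 0# × y₁ ≡ 0#)
      first≢0 = proj₁ (proj₂ (𝔽q-Independent⇒independent ind))

      not-proportional : ∀ {ρ} → ρ ∈ Fix → x₂ ≡ ρ * x₁ → y₂ ≢ ρ * y₁
      not-proportional {ρ} hρ ex ey = 1≢0 (proj₂ (ind (- ρ) 1# (Fix-neg hρ) Fix-1 (at ex) (at ey)))
        where
        at : ∀ {z w} → w ≡ ρ * z → - ρ * z + 1# * w ≡ 0#
        at {z} {w} e = combine₁ e 1# (solve 3 (λ ρ z w → ((:- ρ) :* z :+ 𝟙 :* w) :- 𝟘 := 𝟙 :* (w :- ρ :* z)) refl ρ z w)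

      Span≃Infinity : y₁ ≡ 0# → y₂ ≡ 0# → Span x₁ y₁ x₂ y₂ ≃ Infinity
      Span≃Infinity y₁≡0 y₂≡0 = equiv
        (λ { (r , s , _ , _ , _ , refl) → trans (cong₂ (λ u v → r * u + s * v) y₁≡0 y₂≡0) (solve 2 (λ r s → r :* 𝟘 :+ s :* 𝟘 := 𝟘) refl r s) })
        (λ {x} y≡0 → let r , s , hr , hs , e = Fix-basis w≢0 x in
          r , s , hr , hs , e , trans y≡0 (sym (trans (cong₂ (λ u v → r * u + s * v) y₁≡0 y₂≡0) (solve 2 (λ r s → r :* 𝟘 :+ s :* 𝟘 := 𝟘) refl r s))))
        where
        w≢0 : wedge x₁ x₂ ≢ 0#
        w≢0 w≡0 = let ρ , hρ , e = wedge-zero (λ x₁≡0 → first≢0 (x₁≡0 , y₁≡0)) w≡0 in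
          not-proportional hρ e (trans y₂≡0 (sym (trans (cong (ρ *_) y₁≡0) (zeroʳ ρ))))

      -- Subtracting `ρ` times the first basis vector from the second eliminates y, which leaves the
      -- intersection with `y = 0`.
      Span≃Chord : ∀ {ρ} → ρ ∈ Fix → y₂ ≡ ρ * y₁ → (x₂ - ρ * x₁ ≢ 0#) × Span x₁ y₁ x₂ y₂ ≃ Chord (x₂ - ρ * x₁) x₁ y₁
      Span≃Chord {ρ} hρ y₂≡ = (λ e → not-proportional hρ (x-y≡0⇒x≡y e) y₂≡) , equiv
        (λ { {x} {y} (r , s , hr , hs , ex , ey) → s , r + s * ρ , hs , Fix-+ hr (Fix-* hs hρ) ,
          combine₁ ex 1# (solve 6 (λ x r s ρ x₁ x₂ → x :- (s :* (x₂ :- ρ :* x₁) :+ (r :+ s :* ρ) :* x₁)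
            := 𝟙 :* (x :- (r :* x₁ :+ s :* x₂))) refl x r s ρ x₁ x₂) ,
          combine₂ ey 1# y₂≡ s (solve 6 (λ y r s ρ y₁ y₂ → y :- (r :+ s :* ρ) :* y₁
            := 𝟙 :* (y :- (r :* y₁ :+ s :* y₂)) :+ s :* (y₂ :- ρ :* y₁)) refl y r s ρ y₁ y₂) })
        (λ { {x} {y} (r , s , hr , hs , ex , ey) → s - r * ρ , r , Fix-+ hs (Fix-neg (Fix-* hr hρ)) , hr ,
          combine₁ ex 1# (solve 6 (λ x r s ρ x₁ x₂ → x :- ((s :- r :* ρ) :* x₁ :+ r :* x₂)
            := 𝟙 :* (x :- (r :* (x₂ :- ρ :* x₁) :+ s :* x₁))) refl x r s ρ x₁ x₂) ,
          combine₂ ey 1# y₂≡ (- r) (solve 6 (λ y r s ρ y₁ y₂ → y :- ((s :- r :* ρ) :* y₁ :+ r :* y₂)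
            := 𝟙 :* (y :- s :* y₁) :+ (:- r) :* (y₂ :- ρ :* y₁)) refl y r s ρ y₁ y₂) })

      Span≃Chord′ : y₁ ≡ 0# → Span x₁ y₁ x₂ y₂ ≃ Chord x₁ x₂ y₂
      Span≃Chord′ refl = equiv
        (λ { {x} {y} (r , s , hr , hs , ex , ey) → r , s , hr , hs , ex ,
          trans ey (solve 3 (λ r s y₂ → r :* 𝟘 :+ s :* y₂ := s :* y₂) refl r s y₂) })
        (λ { {x} {y} (r , s , hr , hs , ex , ey) → r , s , hr , hs , ex ,
          trans ey (solve 3 (λ r s y₂ → s :* y₂ := r :* 𝟘 :+ s :* y₂) refl r s y₂) })

      -- Cramer's rule for the two equations `x = M y + N ȳ` at the basis vectors; their determinant
      -- is `wedge y₁ y₂`.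
      Span≃Graph′ : wedge y₁ y₂ ≢ 0# → ∃₂ λ M N → Span x₁ y₁ x₂ y₂ ≃ Graph M N
      Span≃Graph′ w≢0 = let i , wi≡1 = inverse (wedge y₁ y₂) w≢0 in
        (x₁ * conj y₂ - x₂ * conj y₁) * i , (y₁ * x₂ - y₂ * x₁) * i ,
        Span≃Graph w≢0
          (combine₁ wi≡1 (- x₁) (solve 5 (λ x₁ y₁ x₂ y₂ i → x₁ :- ((x₁ :* y₂ ᶜ :- x₂ :* y₁ ᶜ) :* i :* y₁ :+ (y₁ :* x₂ :- y₂ :* x₁) :* i :* y₁ ᶜ)
            := (:- x₁) :* ((y₁ :* y₂ ᶜ :- y₁ ᶜ :* y₂) :* i :- 𝟙)) refl x₁ y₁ x₂ y₂ i))
          (combine₁ wi≡1 (- x₂) (solve 5 (λ x₁ y₁ x₂ y₂ i → x₂ :- ((x₁ :* y₂ ᶜ :- x₂ :* y₁ ᶜ) :* i :* y₂ :+ (y₁ :* x₂ :- y₂ :* x₁) :* i :* y₂ ᶜ)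
            := (:- x₂) :* ((y₁ :* y₂ ᶜ :- y₁ ᶜ :* y₂) :* i :- 𝟙)) refl x₁ y₁ x₂ y₂ i))

  opaque
    shape : ∀ m → Shape m
    shape m = classify (wedge y₁ y₂ ≟ 0#) (y₁ ≟ 0#) (y₂ ≟ 0#)
      where
      open Basis (basis m)
      open ShapeOf independent
      classify : Dec (wedge y₁ y₂ ≡ 0#) → Dec (y₁ ≡ 0#) → Dec (y₂ ≡ 0#) → Shape m
      classify (no w≢0)  _         _          = let M , N , h = Span≃Graph′ w≢0 in graph (≃-trans spans h)
      classify (yes w≡0) (no y₁≢0) _          = let ρ , hρ , e = wedge-zero y₁≢0 w≡0
                                                    k≢0 , h = Span≃Chord hρ e in chord k≢0 y₁≢0 (≃-trans spans h)
      classify (yes w≡0) (yes y₁≡0) (no y₂≢0) = chord (λ x₁≡0 → first≢0 (x₁≡0 , y₁≡0)) y₂≢0 (≃-trans spans (Span≃Chord′ y₁≡0))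
      classify (yes w≡0) (yes y₁≡0) (yes y₂≡0) = infinity (≃-trans spans (Span≃Infinity y₁≡0 y₂≡0))

  opaque
    chord-line : ∀ {k y₀} x₀ → k ≢ 0# → y₀ ≢ 0# → ∃ λ m → W m ≃ Chord k x₀ y₀
    chord-line {k} {y₀} x₀ k≢0 y₀≢0 = let m , h = span-line ind in m , ≃-trans h (ShapeOf.Span≃Chord′ ind refl)
      where
      ind : 𝔽q-Independent k 0# x₀ y₀
      ind r s hr hs ex ey = r≡0 , s≡0
        where
        s≡0 : s ≡ 0#
        s≡0 = *-cancel-0 y₀≢0 (trans (solve 3 (λ r s y₀ → y₀ :* s := r :* 𝟘 :+ s :* y₀) refl r s y₀) ey)
        r≡0 : r ≡ 0#
        r≡0 = *-cancel-0 k≢0 (combine₂ ex 1# s≡0 (- x₀) (solve 4 (λ r s k x₀ → k :* r :- 𝟘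
          := 𝟙 :* ((r :* k :+ s :* x₀) :- 𝟘) :+ (:- x₀) :* (s :- 𝟘)) refl r s k x₀))

  opaque
    graph-line : ∀ M N → ∃ λ m → W m ≃ Graph M N
    graph-line M N = let m , h = span-line ind in m , ≃-trans h (Span≃Graph wedge-1-ω refl refl)
      where
      ind : 𝔽q-Independent (M * 1# + N * conj 1#) 1# (M * ω + N * conj ω) ω
      ind r s hr hs _ e = r≡0 , s≡0
        where
        s≡0 : s ≡ 0#
        s≡0 = *-cancel-0 ω̄-ω≢0 (combine₄ (trans (cong conj e) conj-0) 1# e (- 1#) hr (- 1#) hs (- conj ω)
          (solve 3 (λ r s w → (w ᶜ :- w) :* s :- 𝟘 := 𝟙 :* ((r :* 𝟙 :+ s :* w) ᶜ :- 𝟘) :+ (:- 𝟙) :* ((r :* 𝟙 :+ s :* w) :- 𝟘)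
            :+ (:- 𝟙) :* (r ᶜ :- r) :+ (:- (w ᶜ)) :* (s ᶜ :- s)) refl r s ω))
        r≡0 : r ≡ 0#
        r≡0 = combine₂ e 1# s≡0 (- ω) (solve 3 (λ r s w → r :- 𝟘 := 𝟙 :* ((r :* 𝟙 :+ s :* w) :- 𝟘) :+ (:- w) :* (s :- 𝟘)) refl r s ω)

  opaque
    infinity-line : ∃ λ m → W m ≃ Infinity
    infinity-line = let m , h = span-line ind in m , ≃-trans h (ShapeOf.Span≃Infinity ind refl refl)
      where
      ind : 𝔽q-Independent 1# 0# ω 0#
      ind r s hr hs e _ = r≡0 , s≡0
        where
        s≡0 : s ≡ 0#
        s≡0 = *-cancel-0 ω̄-ω≢0 (combine₄ (trans (cong conj e) conj-0) 1# e (- 1#) hr (- 1#) hs (- conj ω)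
          (solve 3 (λ r s w → (w ᶜ :- w) :* s :- 𝟘 := 𝟙 :* ((r :* 𝟙 :+ s :* w) ᶜ :- 𝟘) :+ (:- 𝟙) :* ((r :* 𝟙 :+ s :* w) :- 𝟘)
            :+ (:- 𝟙) :* (r ᶜ :- r) :+ (:- (w ᶜ)) :* (s ᶜ :- s)) refl r s ω))
        r≡0 : r ≡ 0#
        r≡0 = combine₂ e 1# s≡0 (- ω) (solve 3 (λ r s w → r :- 𝟘 := 𝟙 :* ((r :* 𝟙 :+ s :* w) :- 𝟘) :+ (:- w) :* (s :- 𝟘)) refl r s ω)

  opaque
    -- The image of `m` under the elation `b`, which sends (x, y) to (x + b y, y).
    translate : ∀ b m → ∃ λ n → W n ≃ λ x y → W m (x - b * y) y
    translate b m = let n , h = span-line ind in n , ≃-trans h (equiv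
        (λ { {x} {y} (r , s , hr , hs , refl , refl) → from spans (r , s , hr , hs , expand r s , refl) })
        (λ {x} {y} w → let r , s , hr , hs , ex , ey = to spans w in r , s , hr , hs ,
          combine₂ ex 1# ey b (solve 9 (λ x y b r s x₁ y₁ x₂ y₂ → x :- (r :* (x₁ :+ b :* y₁) :+ s :* (x₂ :+ b :* y₂))
            := 𝟙 :* ((x :- b :* y) :- (r :* x₁ :+ s :* x₂)) :+ b :* (y :- (r :* y₁ :+ s :* y₂))) refl x y b r s x₁ y₁ x₂ y₂) , ey))
      where
      open Basis (basis m)
      expand : ∀ r s → r * (x₁ + b * y₁) + s * (x₂ + b * y₂) - b * (r * y₁ + s * y₂) ≡ r * x₁ + s * x₂
      expand r s = solve 7 (λ r s b x₁ y₁ x₂ y₂ → r :* (x₁ :+ b :* y₁) :+ s :* (x₂ :+ b :* y₂) :- b :* (r :* y₁ :+ s :* y₂)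
        := r :* x₁ :+ s :* x₂) refl r s b x₁ y₁ x₂ y₂
      ind : 𝔽q-Independent (x₁ + b * y₁) y₁ (x₂ + b * y₂) y₂
      ind r s hr hs ex ey = independent r s hr hs
        (combine₂ ex 1# ey (- b) (solve 7 (λ r s b x₁ y₁ x₂ y₂ → (r :* x₁ :+ s :* x₂) :- 𝟘
          := 𝟙 :* ((r :* (x₁ :+ b :* y₁) :+ s :* (x₂ :+ b :* y₂)) :- 𝟘) :+ (:- b) :* ((r :* y₁ :+ s :* y₂) :- 𝟘)) refl r s b x₁ y₁ x₂ y₂)) ey

  -- The spreads 𝒟η and 𝒮 ℓ

  τη≡ : ∀ p₁ p₂ p₃ p₄ → τ η (p₁ ∷ p₂ ∷ p₃ ∷ p₄ ∷ []) ≡ conj p₃ ∷ conj p₄ ∷ conj p₁ ∷ conj p₂ ∷ []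
  τη≡ p₁ p₂ p₃ p₄ = vec4 (sym (conj≡^q p₃)) (sym (conj≡^q p₄)) (unit p₁) (unit p₂)
    where
    unit : ∀ p → norm η * p ^ q ≡ conj p
    unit p = trans (cong₂ _*_ η∈𝒰 (sym (conj≡^q p))) (*-identityˡ (conj p))

  Joined : 𝔽 → 𝔽 → 𝔽 → 𝔽 → 𝔽 → 𝔽 → Set
  Joined p₁ p₂ p₃ p₄ x y = ∃ λ a → x ≡ a * p₁ + η * conj (a * p₃) × y ≡ a * p₂ + η * conj (a * p₄)

  N≡0⇒≡0 : ∀ {z} → N z ≡ 0# → z ≡ 0#
  N≡0⇒≡0 {z} e with z ≟ 0#
  ... | yes z≡0 = z≡0
  ... | no z≢0  = contradiction e (*-nonzero z≢0 (conj-≢0 z≢0))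

  -- Let `s P + t τ(P)` be a normalised vector of `Ση` and put `z = t - η s̄`. Comparing coordinates
  -- gives `z p̄ = η z̄ p′` for (p, p′) equal to (p₁, p₃) and (p₂, p₄), and taking norms gives
  -- `N z (N p - N p′) = 0`. A pair with distinct norms therefore forces `t = η s̄`.
  Section≃Joined : ∀ {p₁ p₂ p₃ p₄} → N p₁ ≢ N p₃ ⊎ N p₂ ≢ N p₄ →
    Section (p₁ ∷ p₂ ∷ p₃ ∷ p₄ ∷ []) (τ η (p₁ ∷ p₂ ∷ p₃ ∷ p₄ ∷ [])) ≃ Joined p₁ p₂ p₃ p₄
  Section≃Joined {p₁} {p₂} {p₃} {p₄} N≢ = subst (λ v → Section (p₁ ∷ p₂ ∷ p₃ ∷ p₄ ∷ []) v ≃ Joined p₁ p₂ p₃ p₄)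
    (sym (τη≡ p₁ p₂ p₃ p₄)) (equiv forth back)
    where
    relation : ∀ {x s t p p′} → x ≡ s * p + t * conj p′ → η * conj x ≡ s * p′ + t * conj p →
      N (t - η * conj s) * (N p - N p′) ≡ 0#
    relation {x} {s} {t} {p} {p′} e ē = combine₃ h (conj (z * conj p)) (cong conj h) (η * conj z * p′) N-η (z * conj z * p′ * conj p′)
      (solve 4 (λ z p p′ h → z :* z ᶜ :* (p :* p ᶜ :- p′ :* p′ ᶜ) :- 𝟘
        := (z :* p ᶜ) ᶜ :* (z :* p ᶜ :- h :* z ᶜ :* p′) :+ h :* z ᶜ :* p′ :* ((z :* p ᶜ) ᶜ :- (h :* z ᶜ :* p′) ᶜ)
          :+ z :* z ᶜ :* p′ :* p′ ᶜ :* (h :* h ᶜ :- 𝟙)) refl z p p′ η)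
      where
      z = t - η * conj s
      h : z * conj p ≡ η * conj z * p′
      h = combine₃ ē (- 1#) (cong conj e) η N-η (s * p′)
        (solve 6 (λ x s t p p′ h → (t :- h :* s ᶜ) :* p ᶜ :- h :* (t :- h :* s ᶜ) ᶜ :* p′
          := (:- 𝟙) :* (h :* x ᶜ :- (s :* p′ :+ t :* p ᶜ)) :+ h :* (x ᶜ :- (s :* p :+ t :* p′ ᶜ) ᶜ) :+ s :* p′ :* (h :* h ᶜ :- 𝟙)) refl x s t p p′ η)
    cancel : ∀ {z p p′} → N p ≢ N p′ → N z * (N p - N p′) ≡ 0# → z ≡ 0#
    cancel N≢ e = N≡0⇒≡0 (*-cancel-0 (neg-≢0 N≢) (trans (*-comm _ _) e))
    forth : ∀ {x y} → Section (p₁ ∷ p₂ ∷ p₃ ∷ p₄ ∷ []) (conj p₃ ∷ conj p₄ ∷ conj p₁ ∷ conj p₂ ∷ []) x y → Joined p₁ p₂ p₃ p₄ x y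
    forth {x} {y} (s , t , e) = let ex , ey , ex̄ , eȳ = vec4-injective e in
      s , adjust ex (z≡0 ex ey ex̄ eȳ) , adjust ey (z≡0 ex ey ex̄ eȳ)
      where
      z≡0 : x ≡ s * p₁ + t * conj p₃ → y ≡ s * p₂ + t * conj p₄ → η * conj x ≡ s * p₃ + t * conj p₁ → η * conj y ≡ s * p₄ + t * conj p₂ →
        t - η * conj s ≡ 0#
      z≡0 ex ey ex̄ eȳ = [ (λ N≢ → cancel N≢ (relation ex ex̄)) , (λ N≢ → cancel N≢ (relation ey eȳ)) ]′ N≢
      adjust : ∀ {x p p′} → x ≡ s * p + t * conj p′ → t - η * conj s ≡ 0# → x ≡ s * p + η * conj (s * p′)
      adjust {x} {p} {p′} e z≡0 = combine₂ e 1# z≡0 (conj p′) (solve 6 (λ x s t p p′ h → x :- (s :* p :+ h :* (s :* p′) ᶜ)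
        := 𝟙 :* (x :- (s :* p :+ t :* p′ ᶜ)) :+ p′ ᶜ :* ((t :- h :* s ᶜ) :- 𝟘)) refl x s t p p′ η)
    back : ∀ {x y} → Joined p₁ p₂ p₃ p₄ x y → Section (p₁ ∷ p₂ ∷ p₃ ∷ p₄ ∷ []) (conj p₃ ∷ conj p₄ ∷ conj p₁ ∷ conj p₂ ∷ []) x y
    back (a , refl , refl) = a , η * conj a , vec4 (plain p₁ p₃) (plain p₂ p₄) (conjugate p₁ p₃) (conjugate p₂ p₄)
      where
      plain : ∀ p p′ → a * p + η * conj (a * p′) ≡ a * p + η * conj a * conj p′
      plain p p′ = solve 4 (λ a p p′ h → a :* p :+ h :* (a :* p′) ᶜ := a :* p :+ h :* a ᶜ :* p′ ᶜ) refl a p p′ η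
      conjugate : ∀ p p′ → η * conj (a * p + η * conj (a * p′)) ≡ a * p′ + η * conj a * conj p
      conjugate p p′ = combine₁ N-η (a * p′) (solve 4 (λ a p p′ h → h :* (a :* p :+ h :* (a :* p′) ᶜ) ᶜ :- (a :* p′ :+ h :* a ᶜ :* p ᶜ)
        := a :* p′ :* (h :* h ᶜ :- 𝟙)) refl a p p′ η)

  joins⇒ : ∀ ℓ {m} → joins ℓ m → ∃ λ P → P ∈ ℓ × W m ≃ Section (vec P) (τ η (vec P))
  joins⇒ ℓ {m} (P , P∈ℓ , h) = P , P∈ℓ , section-≐⁻¹ {vec (X m)} {vec (Y m)} {vec P} {τ η (vec P)} h

  ⇒joins : ∀ ℓ {m} P → P ∈ ℓ → W m ≃ Section (vec P) (τ η (vec P)) → joins ℓ m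
  ⇒joins ℓ {m} P P∈ℓ h = P , P∈ℓ , section-≐ {vec (X m)} {vec (Y m)} {vec P} {τ η (vec P)} h

  -- The coordinate form of `𝒟η`: the point (s, t, 0, 0) of `t₁` yields `x = (s/t) y`, or `y = 0`
  -- when `t = 0`.
  Dη : Lineη → Set
  Dη m = W m ≃ Infinity ⊎ ∃ λ M → W m ≃ Graph M 0#

  private
    t₁-point : 𝔽 → 𝔽 → Vec 𝔽 4
    t₁-point s t = s ∷ t ∷ 0# ∷ 0# ∷ []

    t₁-vector : ∀ s t → s · U₁ ⊕ t · U₂ ≡ t₁-point s t
    t₁-vector s t = vec4
      (solve 2 (λ s t → s :* 𝟙 :+ t :* 𝟘 := s) refl s t) (solve 2 (λ s t → s :* 𝟘 :+ t :* 𝟙 := t) refl s t)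
      (solve 2 (λ s t → s :* 𝟘 :+ t :* 𝟘 := 𝟘) refl s t) (solve 2 (λ s t → s :* 𝟘 :+ t :* 𝟘 := 𝟘) refl s t)

    N-0 : N 0# ≡ 0#
    N-0 = zeroˡ _

    Joined≃Infinity : ∀ {s} → s ≢ 0# → Section (t₁-point s 0#) (τ η (t₁-point s 0#)) ≃ Infinity
    Joined≃Infinity {s} s≢0 = ≃-trans (Section≃Joined (inj₁ λ e → s≢0 (N≡0⇒≡0 (trans e N-0)))) (equiv
      (λ { (a , _ , refl) → solve 2 (λ a h → a :* 𝟘 :+ h :* (a :* 𝟘) ᶜ := 𝟘) refl a η })
      (λ { {x} {y} refl → x * i ,
        combine₁ si≡1 (- x) (solve 4 (λ x s i h → x :- (x :* i :* s :+ h :* (x :* i :* 𝟘) ᶜ) := (:- x) :* (s :* i :- 𝟙)) refl x s i η) ,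
        solve 2 (λ a h → 𝟘 := a :* 𝟘 :+ h :* (a :* 𝟘) ᶜ) refl (x * i) η }))
      where
      i = proj₁ (inverse s s≢0)
      si≡1 = proj₂ (inverse s s≢0)

    Joined≃Graph : ∀ {s t i} → t ≢ 0# → t * i ≡ 1# → Section (t₁-point s t) (τ η (t₁-point s t)) ≃ Graph (s * i) 0#
    Joined≃Graph {s} {t} {i} t≢0 ti≡1 = ≃-trans (Section≃Joined (inj₂ λ e → t≢0 (N≡0⇒≡0 (trans e N-0)))) (equiv
      (λ { {x} {y} (a , refl , refl) → combine₁ ti≡1 (- (a * s))
        (solve 5 (λ a s t i h → (a :* s :+ h :* (a :* 𝟘) ᶜ) :- (s :* i :* (a :* t :+ h :* (a :* 𝟘) ᶜ) :+ 𝟘 :* (a :* t :+ h :* (a :* 𝟘) ᶜ) ᶜ)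
          := (:- (a :* s)) :* (t :* i :- 𝟙)) refl a s t i η) })
      (λ { {x} {y} refl → y * i ,
        solve 4 (λ y s i h → s :* i :* y :+ 𝟘 :* y ᶜ := y :* i :* s :+ h :* (y :* i :* 𝟘) ᶜ) refl y s i η ,
        combine₁ ti≡1 (- y) (solve 4 (λ y t i h → y :- (y :* i :* t :+ h :* (y :* i :* 𝟘) ᶜ) := (:- y) :* (t :* i :- 𝟙)) refl y t i η) }))

  opaque
    𝒟η⇒Dη : ∀ {m} → 𝒟η m → Dη m
    𝒟η⇒Dη {m} D with joins⇒ t₁ {m} D
    ... | P , (s , t , e) , h = go (s ≟ 0#) (t ≟ 0#)
      where
      vec≡ : vec P ≡ t₁-point s t
      vec≡ = trans e (t₁-vector s t)
      h′ : W m ≃ Section (t₁-point s t) (τ η (t₁-point s t))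
      h′ = subst (λ v → W m ≃ Section v (τ η v)) vec≡ h
      go : Dec (s ≡ 0#) → Dec (t ≡ 0#) → Dη m
      go (yes refl) (yes refl) = contradiction vec≡ (nonzero P)
      go (no s≢0)   (yes refl) = inj₁ (≃-trans h′ (Joined≃Infinity s≢0))
      go _          (no t≢0)   = inj₂ (_ , ≃-trans h′ (Joined≃Graph t≢0 (proj₂ (inverse t t≢0))))

  opaque
    Dη⇒𝒟η : ∀ {m} → Dη m → 𝒟η m
    Dη⇒𝒟η {m} (inj₁ h) = ⇒joins t₁ {m} (point (t₁-point 1# 0#) (1≢0 ∘ cong Vec.head)) (1# , 0# , sym (t₁-vector 1# 0#))
      (≃-trans h (≃-sym (Joined≃Infinity 1≢0)))
    Dη⇒𝒟η {m} (inj₂ (M , h)) = ⇒joins t₁ {m} (point (t₁-point M 1#) (1≢0 ∘ cong (Vec.head ∘ Vec.tail))) (M , 1# , sym (t₁-vector M 1#))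
      (≃-trans (subst (λ z → W m ≃ Graph z 0#) (sym (*-identityʳ M)) h) (≃-sym (Joined≃Graph 1≢0 (*-identityˡ 1#))))

  Twisted : 𝔽 → 𝔽 → 𝔽 → 𝔽 → 𝔽 → 𝔽 → Set
  Twisted g h c s x y = ∃ λ a → x ≡ twist h (s * a) + c * twist g a × y ≡ twist g a

  -- The coordinate form of 𝒮 ℓ for ℓ = ⟨ apex , foot ⟩, defined below.
  TwistedSpread : 𝔽 → 𝔽 → 𝔽 → Lineη → Set
  TwistedSpread g h c m = W m ≃ Infinity ⊎ ∃ λ s → W m ≃ Twisted g h c s

  module _ {g h : 𝔽} (c : 𝔽) (Ng≢1 : N g ≢ 1#) (Nh≢1 : N h ≢ 1#) where

    -- `apex` is the vertex of the pencil with `αu = η h̄`. `foot` is the image of (0, 1, 0, η ḡ)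
    -- under the elation `c` and lies in the plane with `αv = η ḡ`. The factor `η` and the
    -- conjugations cancel when a point is joined to its image under `τ η`, leaving `twist h` and
    -- `twist g`.
    apex foot : Vec 𝔽 4
    apex = 1# ∷ 0# ∷ η * conj h ∷ 0# ∷ []
    foot = c ∷ 1# ∷ η * conj g * conj c ∷ η * conj g ∷ []

    private
      S≃ : ∀ s t → N (s * 1# + t * c) ≢ N (s * (η * conj h) + t * (η * conj g * conj c)) ⊎
        N (s * 0# + t * 1#) ≢ N (s * 0# + t * (η * conj g)) →
        Section (s · apex ⊕ t · foot) (τ η (s · apex ⊕ t · foot)) ≃
        (λ x y → ∃ λ a → x ≡ twist h (a * s) + c * twist g (a * t) × y ≡ twist g (a * t))
      S≃ s t N≢ = ≃-trans (Section≃Joined N≢) (equiv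
        (λ { (a , ex , ey) → a , trans ex (first a) , trans ey (second a) })
        (λ { (a , ex , ey) → a , trans ex (sym (first a)) , trans ey (sym (second a)) }))
        where
        first : ∀ a → a * (s * 1# + t * c) + η * conj (a * (s * (η * conj h) + t * (η * conj g * conj c))) ≡ twist h (a * s) + c * twist g (a * t)
        first a = combine₁ N-η (h * conj (a * s) + c * (g * conj (a * t)))
          (solve 7 (λ a s t c g h e → (a :* (s :* 𝟙 :+ t :* c) :+ e :* (a :* (s :* (e :* h ᶜ) :+ t :* (e :* g ᶜ :* c ᶜ))) ᶜ)
            :- ((a :* s :+ h :* (a :* s) ᶜ) :+ c :* (a :* t :+ g :* (a :* t) ᶜ))
            := (h :* (a :* s) ᶜ :+ c :* (g :* (a :* t) ᶜ)) :* (e :* e ᶜ :- 𝟙)) refl a s t c g h η)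
        second : ∀ a → a * (s * 0# + t * 1#) + η * conj (a * (s * 0# + t * (η * conj g))) ≡ twist g (a * t)
        second a = combine₁ N-η (g * conj (a * t))
          (solve 5 (λ a s t g e → (a :* (s :* 𝟘 :+ t :* 𝟙) :+ e :* (a :* (s :* 𝟘 :+ t :* (e :* g ᶜ))) ᶜ)
            :- (a :* t :+ g :* (a :* t) ᶜ) := g :* (a :* t) ᶜ :* (e :* e ᶜ :- 𝟙)) refl a s t g η)

      N≢₁ : ∀ {s} → s ≢ 0# → N (s * 1# + 0# * c) ≢ N (s * (η * conj h) + 0# * (η * conj g * conj c))
      N≢₁ {s} s≢0 e = s≢0 (N≡0⇒≡0 (*-cancel-0 (neg-≢0 (≢-sym Nh≢1)) (combine₂ e 1# N-η (s * conj s * h * conj h)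
        (solve 5 (λ s c g h e → (𝟙 :- h :* h ᶜ) :* (s :* s ᶜ) :- 𝟘
          := 𝟙 :* ((s :* 𝟙 :+ 𝟘 :* c) :* (s :* 𝟙 :+ 𝟘 :* c) ᶜ :- (s :* (e :* h ᶜ) :+ 𝟘 :* (e :* g ᶜ :* c ᶜ)) :* (s :* (e :* h ᶜ) :+ 𝟘 :* (e :* g ᶜ :* c ᶜ)) ᶜ)
            :+ s :* s ᶜ :* h :* h ᶜ :* (e :* e ᶜ :- 𝟙)) refl s c g h η))))

      N≢₂ : ∀ {s t} → t ≢ 0# → N (s * 0# + t * 1#) ≢ N (s * 0# + t * (η * conj g))
      N≢₂ {s} {t} t≢0 e = t≢0 (N≡0⇒≡0 (*-cancel-0 (neg-≢0 (≢-sym Ng≢1)) (combine₂ e 1# N-η (t * conj t * g * conj g)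
        (solve 4 (λ s t g e → (𝟙 :- g :* g ᶜ) :* (t :* t ᶜ) :- 𝟘
          := 𝟙 :* ((s :* 𝟘 :+ t :* 𝟙) :* (s :* 𝟘 :+ t :* 𝟙) ᶜ :- (s :* 𝟘 :+ t :* (e :* g ᶜ)) :* (s :* 𝟘 :+ t :* (e :* g ᶜ)) ᶜ)
            :+ t :* t ᶜ :* g :* g ᶜ :* (e :* e ᶜ :- 𝟙)) refl s t g η))))

      S≃Infinity : ∀ {s} → s ≢ 0# → Section (s · apex ⊕ 0# · foot) (τ η (s · apex ⊕ 0# · foot)) ≃ Infinity
      S≃Infinity {s} s≢0 = ≃-trans (S≃ s 0# (inj₁ (N≢₁ s≢0))) (equiv
        (λ { (a , _ , refl) → solve 2 (λ a g → a :* 𝟘 :+ g :* (a :* 𝟘) ᶜ := 𝟘) refl a g })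
        (λ { {x} refl → let b , e = twist-surjective Nh≢1 x ; i , si≡1 = inverse s s≢0 in b * i ,
          trans (sym e) (combine₂ si≡1 (- b) (trans (cong conj si≡1) conj-1) (- (h * conj b)) (solve 6 (λ b s i c g h →
            (b :+ h :* b ᶜ) :- ((b :* i :* s :+ h :* (b :* i :* s) ᶜ) :+ c :* (b :* i :* 𝟘 :+ g :* (b :* i :* 𝟘) ᶜ))
            := (:- b) :* (s :* i :- 𝟙) :+ (:- (h :* b ᶜ)) :* ((s :* i) ᶜ :- 𝟙)) refl b s i c g h)) ,
          solve 2 (λ a g → 𝟘 := a :* 𝟘 :+ g :* (a :* 𝟘) ᶜ) refl (b * i) g }))

      S≃Twisted : ∀ {s t i} → t ≢ 0# → t * i ≡ 1# → Section (s · apex ⊕ t · foot) (τ η (s · apex ⊕ t · foot)) ≃ Twisted g h c (s * i)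
      S≃Twisted {s} {t} {i} t≢0 ti≡1 = ≃-trans (S≃ s t (inj₂ (N≢₂ t≢0))) (equiv
        (λ { (a , refl , refl) → a * t , cong (λ z → twist h z + c * twist g (a * t)) (combine₁ ti≡1 (- (a * s))
          (solve 4 (λ a s t i → a :* s :- s :* i :* (a :* t) := (:- (a :* s)) :* (t :* i :- 𝟙)) refl a s t i)) , refl })
        (λ { (a , refl , refl) → a * i , cong₂ (λ z w → twist h z + c * twist g w)
            (solve 3 (λ a s i → s :* i :* a := a :* i :* s) refl a s i) (unscale a) , cong (twist g) (unscale a) }))
        where
        unscale : ∀ a → a ≡ a * i * t
        unscale a = combine₁ ti≡1 (- a) (solve 3 (λ a t i → a :- a :* i :* t := (:- a) :* (t :* i :- 𝟙)) refl a t i)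

    module _ {ℓ : PointSet} (on-ℓ : ℓ ≐ ⟨ apex , foot ⟩) where

      opaque
        joins⇒TwistedSpread : ∀ {m} → joins ℓ m → TwistedSpread g h c m
        joins⇒TwistedSpread {m} J with joins⇒ ℓ {m} J
        ... | P , P∈ℓ , hW with proj₁ on-ℓ {P} P∈ℓ
        ...   | s , t , e = go (s ≟ 0#) (t ≟ 0#)
          where
          h′ : W m ≃ Section (s · apex ⊕ t · foot) (τ η (s · apex ⊕ t · foot))
          h′ = subst (λ v → W m ≃ Section v (τ η v)) e hW
          go : Dec (s ≡ 0#) → Dec (t ≡ 0#) → TwistedSpread g h c m
          go (yes refl) (yes refl) = contradiction (trans e (0·⊕0· apex foot)) (nonzero P)
          go (no s≢0)   (yes refl) = inj₁ (≃-trans h′ (S≃Infinity s≢0))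
          go _          (no t≢0)   = inj₂ (_ , ≃-trans h′ (S≃Twisted t≢0 (proj₂ (inverse t t≢0))))

      opaque
        TwistedSpread⇒joins : ∀ {m} → TwistedSpread g h c m → joins ℓ m
        TwistedSpread⇒joins {m} (inj₁ hW) = ⇒joins ℓ {m} P (proj₂ on-ℓ {P} (1# , 0# , refl)) (≃-trans hW (≃-sym (S≃Infinity 1≢0)))
          where
          P : Point
          P = point (1# · apex ⊕ 0# · foot) λ e → 1≢0 (trans (solve 1 (λ c → 𝟙 := 𝟙 :* 𝟙 :+ 𝟘 :* c) refl c) (cong Vec.head e))
        TwistedSpread⇒joins {m} (inj₂ (s , hW)) = ⇒joins ℓ {m} P (proj₂ on-ℓ {P} (s , 1# , refl))
          (≃-trans (subst (λ z → W m ≃ Twisted g h c z) (sym (*-identityʳ s)) hW) (≃-sym (S≃Twisted 1≢0 (*-identityˡ 1#))))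
          where
          P : Point
          P = point (s · apex ⊕ 1# · foot) λ e → 1≢0 (trans (solve 1 (λ s → 𝟙 := s :* 𝟘 :+ 𝟙 :* 𝟙) refl s) (cong (Vec.head ∘ Vec.tail) e))

  -- Elations and reguli

  Shifted : 𝔽 → (𝔽 → 𝔽 → Set) → 𝔽 → 𝔽 → Set
  Shifted b Q x y = Q (x - b * y) y

  private
    elation-ι′ : ∀ b k x y → elation b (k · ι′ η x y) ≡ k · ι′ η (x + b * y) y
    elation-ι′ b k x y = vec4
      (solve 4 (λ b k x y → k :* x :+ b :* (k :* y) := k :* (x :+ b :* y)) refl b k x y) refl
      (trans (cong (λ b̄ → k * (η * conj x) + b̄ * (k * (η * conj y))) (sym (conj≡^q b)))
        (solve 5 (λ b k x y h → k :* (h :* x ᶜ) :+ b ᶜ :* (k :* (h :* y ᶜ)) := k :* (h :* (x :+ b :* y) ᶜ)) refl b k x y η)) refl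

    elation-Coordinates : ∀ b n → Coordinates (λ P → ∃ λ Y → Y ∈ pts n × P ∼ elation b (vec Y)) (Shifted b (W n))
    elation-Coordinates b n = record
      { coordinates = λ { P (Q , Q∈n , k , e) → let x , y , l , e′ , w , _ = section-coordinates Q Q∈n in
          x + b * y , y , k * l ,
          subst (λ z → W n z y) (solve 3 (λ x b y → x := x :+ b :* y :- b :* y) refl x b y) w ,
          trans e (trans (cong (λ v → k · elation b v) e′) (trans (cong (k ·_) (elation-ι′ b l x y)) (·-· k l _))) }
      ; member = λ P {x} {y} {k} w ≢0 e → let ≢0′ = λ o → ≢0 (shift-origin b x y o) in
          pt (x - b * y) y ≢0′ , (w , pt∈Ση ≢0′) , k ,
          trans e (cong (k ·_) (begin
            ι′ η x y                                 ≡⟨ cong (λ z → ι′ η z y) (solve 3 (λ x b y → x := x :- b :* y :+ b :* y) refl x b y) ⟩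
            ι′ η (x - b * y + b * y) y               ≡⟨ 1· ι′ η (x - b * y + b * y) y ⟨
            1# · ι′ η (x - b * y + b * y) y          ≡⟨ elation-ι′ b 1# (x - b * y) y ⟨
            elation b (1# · ι′ η (x - b * y) y)      ≡⟨ cong (elation b) (1· ι′ η (x - b * y) y) ⟩
            elation b (ι′ η (x - b * y) y) ∎))
      ; at-origin = Section-origin (solve 1 (λ b → 𝟘 :- b :* 𝟘 := 𝟘) refl b , refl)
      ; scale = λ {x} {y} {x′} {y′} {k} w e → let ex , ey , ex̄ , eȳ = vec4-injective e in
          Section-scale (vec4
            (combine₂ ex 1# ey (- b) (solve 6 (λ b k x y x′ y′ → (x :- b :* y) :- k :* (x′ :- b :* y′) := 𝟙 :* (x :- k :* x′) :+ (:- b) :* (y :- k :* y′)) refl b k x y x′ y′))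
            ey
            (combine₂ ex̄ 1# eȳ (- conj b) (solve 7 (λ b k x y x′ y′ h → h :* (x :- b :* y) ᶜ :- k :* (h :* (x′ :- b :* y′) ᶜ)
              := 𝟙 :* (h :* x ᶜ :- k :* (h :* x′ ᶜ)) :+ (:- (b ᶜ)) :* (h :* y ᶜ :- k :* (h :* y′ ᶜ))) refl b k x y x′ y′ η))
            eȳ) w
      }
      where
      open ≡-Reasoning
      shift-origin : ∀ b x y → Origin (x - b * y) y → Origin x y
      shift-origin b x y (e , refl) = trans (solve 2 (λ x b → x := x :- b :* 𝟘) refl x b) e , refl

  image⇒ : ∀ b T m → image b T m → ∃ λ n → n ∈ T × W m ≃ Shifted b (W n)
  image⇒ b T m (n , n∈T , h) = n , n∈T , ≐⇒≃ (elation-Coordinates b n) {m} h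

  ⇒image : ∀ b T m n → n ∈ T → W m ≃ Shifted b (W n) → image b T m
  ⇒image b T m n n∈T h = n , n∈T , ≃⇒≐ (elation-Coordinates b n) {m} h

  Reg : 𝔽 → 𝔽 → Lineη → Set
  Reg c d m = W m ≃ Infinity ⊎ ∃ λ r → r ∈ Fix × W m ≃ Graph (c + d * r) 0#

  Meet-≃ : ∀ {m n l} → W m ≃ W n → Meet m l → Meet n l
  Meet-≃ h (x , y , ≢0 , w , w′) = x , y , ≢0 , to h w , w′

  private
    Chord-scale : ∀ {k x₀ y₀ r x y} → r ∈ Fix → Chord k x₀ y₀ x y → Chord k x₀ y₀ (r * x) (r * y)
    Chord-scale {k} {x₀} {y₀} {r} hr (s , t , hs , ht , refl , refl) = r * s , r * t , Fix-* hr hs , Fix-* hr ht ,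
      solve 5 (λ r s t k x₀ → r :* (s :* k :+ t :* x₀) := r :* s :* k :+ r :* t :* x₀) refl r s t k x₀ ,
      solve 3 (λ r t y₀ → r :* (t :* y₀) := r :* t :* y₀) refl r t y₀

    Chord-k : ∀ {k x₀ y₀} r → r ∈ Fix → Chord k x₀ y₀ (r * k) 0#
    Chord-k {k} {x₀} {y₀} r hr = r , 0# , hr , Fix-0 , solve 3 (λ r k x₀ → r :* k := r :* k :+ 𝟘 :* x₀) refl r k x₀ , sym (zeroˡ y₀)

    Disjoint : (P Q : 𝔽 → 𝔽 → Set) → Set
    Disjoint P Q = ∀ {x y} → P x y → Q x y → Origin x y

    Skew⇒Disjoint : ∀ {m n P Q} → W m ≃ P → W n ≃ Q → Skew m n → Disjoint P Q
    Skew⇒Disjoint {m} {n} hm hn skew {x} {y} p p′ with origin? x y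
    ... | yes o = o
    ... | no ≢0 = contradiction (Meet⇒≬ {m} {n} (x , y , ≢0 , from hm p , from hn p′)) skew

    module SkewChords {k₁ x₁ y₁ k₂ x₂ y₂ : 𝔽} (k₁≢0 : k₁ ≢ 0#) (k₂≢0 : k₂ ≢ 0#) (y₁≢0 : y₁ ≢ 0#) (y₂≢0 : y₂ ≢ 0#)
      (disjoint : Disjoint (Chord k₁ x₁ y₁) (Chord k₂ x₂ y₂)) where

      -- Otherwise both chords would meet `y = 0` in the same point.
      wedge-k : wedge k₁ k₂ ≢ 0#
      wedge-k w≡0 = let r , hr , e = wedge-zero k₁≢0 w≡0 in
        k₂≢0 (proj₁ (disjoint (subst (λ z → Chord k₁ x₁ y₁ z 0#) (sym e) (Chord-k r hr))
          (subst (λ z → Chord k₂ x₂ y₂ z 0#) (*-identityˡ k₂) (Chord-k 1# Fix-1))))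

      -- Otherwise `y₂ = ρ y₁` with `ρ` fixed. Since `k₁` and `k₂` span 𝔽, `x₂ - ρ x₁` splits as
      -- `r k₁ + s k₂`, and (x₂ - s k₂, y₂) is a nonzero vector of both chords.
      wedge-y : wedge y₁ y₂ ≢ 0#
      wedge-y w≡0 =
        let ρ , hρ , e = wedge-zero y₁≢0 w≡0
            r , s , hr , hs , e′ = Fix-basis wedge-k (x₂ - ρ * x₁)
        in y₂≢0 (proj₂ (disjoint {x₂ - s * k₂} {y₂}
          (r , ρ , hr , hρ , combine₁ e′ 1# (solve 7 (λ r s ρ k₁ k₂ x₁ x₂ → (x₂ :- s :* k₂) :- (r :* k₁ :+ ρ :* x₁)
            := 𝟙 :* ((x₂ :- ρ :* x₁) :- (r :* k₁ :+ s :* k₂))) refl r s ρ k₁ k₂ x₁ x₂) , e)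
          (- s , 1# , Fix-neg hs , Fix-1 , solve 3 (λ s k₂ x₂ → x₂ :- s :* k₂ := (:- s) :* k₂ :+ 𝟙 :* x₂) refl s k₂ x₂ , sym (*-identityˡ y₂))))

      opaque
        decompose : ∀ x y → ∃₂ λ x′ y′ → ∃₂ λ x″ y″ →
          Chord k₁ x₁ y₁ x′ y′ × Chord k₂ x₂ y₂ x″ y″ × x ≡ x′ + x″ × y ≡ y′ + y″
        decompose x y =
          let s , t , hs , ht , ey = Fix-basis wedge-y y
              r , r′ , hr , hr′ , ex = Fix-basis wedge-k (x - s * x₁ - t * x₂)
          in r * k₁ + s * x₁ , s * y₁ , r′ * k₂ + t * x₂ , t * y₂ ,
            (r , s , hr , hs , refl , refl) , (r′ , t , hr′ , ht , refl , refl) ,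
            combine₁ ex 1# (solve 9 (λ x s t r r′ k₁ k₂ x₁ x₂ → x :- (r :* k₁ :+ s :* x₁ :+ (r′ :* k₂ :+ t :* x₂))
              := 𝟙 :* ((x :- s :* x₁ :- t :* x₂) :- (r :* k₁ :+ r′ :* k₂))) refl x s t r r′ k₁ k₂ x₁ x₂) , ey

      -- V(4,q) is the direct sum of the two chords, so through every other point
      -- there is a line meeting both.
      transversal : ∀ {x y} → ¬ Chord k₁ x₁ y₁ x y → ¬ Chord k₂ x₂ y₂ x y →
        ∃ λ n → W n x y × (∃₂ λ x′ y′ → ¬ Origin x′ y′ × W n x′ y′ × Chord k₁ x₁ y₁ x′ y′)
          × (∃₂ λ x″ y″ → ¬ Origin x″ y″ × W n x″ y″ × Chord k₂ x₂ y₂ x″ y″)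
      transversal {x} {y} ∉₁ ∉₂ with decompose x y
      ... | x′ , y′ , x″ , y″ , ∈₁ , ∈₂ , refl , refl = build (span-line independent)
        where
        ≢0₁ : ¬ Origin x′ y′
        ≢0₁ (refl , refl) = ∉₂ (subst₂ (Chord k₂ x₂ y₂) (sym (+-identityˡ x″)) (sym (+-identityˡ y″)) ∈₂)
        ≢0₂ : ¬ Origin x″ y″
        ≢0₂ (refl , refl) = ∉₁ (subst₂ (Chord k₁ x₁ y₁) (sym (+-identityʳ x′)) (sym (+-identityʳ y′)) ∈₁)
        multiple : ∀ {r s i z w} → r * i ≡ 1# → r * z + s * w ≡ 0# → z ≡ - (s * i) * w
        multiple {r} {s} {i} {z} {w} ri≡1 e = combine₂ e i ri≡1 (- z) (solve 5 (λ r s i z w → z :- (:- (s :* i)) :* w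
          := i :* ((r :* z :+ s :* w) :- 𝟘) :+ (:- z) :* (r :* i :- 𝟙)) refl r s i z w)
        second : ∀ {r s z w} → r ≡ 0# → r * z + s * w ≡ 0# → s * w ≡ 0#
        second {r} {s} {z} {w} r≡0 e = combine₂ e 1# r≡0 (- z) (solve 4 (λ r s z w → s :* w :- 𝟘
          := 𝟙 :* ((r :* z :+ s :* w) :- 𝟘) :+ (:- z) :* (r :- 𝟘)) refl r s z w)
        independent : 𝔽q-Independent x′ y′ x″ y″
        independent r s hr hs ex ey = go (r ≟ 0#) (s ≟ 0#)
          where
          go : Dec (r ≡ 0#) → Dec (s ≡ 0#) → r ≡ 0# × s ≡ 0#
          go (no r≢0) _ = contradiction (disjoint ∈₁ (subst₂ (Chord k₂ x₂ y₂) (sym (multiple ri≡1 ex)) (sym (multiple ri≡1 ey))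
              (Chord-scale (Fix-neg (Fix-* hs (Fix-inverse ri≡1 hr))) ∈₂))) ≢0₁
            where ri≡1 = proj₂ (inverse r r≢0)
          go (yes r≡0) (no s≢0) = contradiction (*-cancel-0 s≢0 (second r≡0 ex) , *-cancel-0 s≢0 (second r≡0 ey)) ≢0₂
          go (yes r≡0) (yes s≡0) = r≡0 , s≡0
        first-of : ∀ z w → z ≡ 1# * z + 0# * w
        first-of = solve 2 (λ z w → z := 𝟙 :* z :+ 𝟘 :* w) refl
        second-of : ∀ z w → w ≡ 0# * z + 1# * w
        second-of = solve 2 (λ z w → w := 𝟘 :* z :+ 𝟙 :* w) refl
        sum-of : ∀ z w → z + w ≡ 1# * z + 1# * w
        sum-of = solve 2 (λ z w → z :+ w := 𝟙 :* z :+ 𝟙 :* w) refl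
        build : (∃ λ n → W n ≃ Span x′ y′ x″ y″) → _
        build (n , h) = n , from h (1# , 1# , Fix-1 , Fix-1 , sum-of x′ x″ , sum-of y′ y″) ,
          (x′ , y′ , ≢0₁ , from h (1# , 0# , Fix-1 , Fix-0 , first-of x′ x″ , first-of y′ y″) , ∈₁) ,
          (x″ , y″ , ≢0₂ , from h (0# , 1# , Fix-0 , Fix-1 , second-of x′ x″ , second-of y′ y″) , ∈₂)

    Section-U₁U₃ : Section U₁ U₃ ≃ Infinity
    Section-U₁U₃ = equiv
      (λ { (s , t , e) → trans (proj₁ (proj₂ (vec4-injective e))) (solve 2 (λ s t → s :* 𝟘 :+ t :* 𝟘 := 𝟘) refl s t) })
      (λ { {x} refl → x , η * conj x , vec4
        (solve 2 (λ x z → x := x :* 𝟙 :+ z :* 𝟘) refl x (η * conj x))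
        (solve 2 (λ x z → 𝟘 := x :* 𝟘 :+ z :* 𝟘) refl x (η * conj x))
        (solve 2 (λ x z → z := x :* 𝟘 :+ z :* 𝟙) refl x (η * conj x))
        (solve 3 (λ x z h → h :* 𝟘 ᶜ := x :* 𝟘 :+ z :* 𝟘) refl x (η * conj x) η) })

  -- The lines `l₁`, `l₂`, `l₃` are mutually skew and all meet `y = 0`, so they are chords. If
  -- `x = M y` meets `l₁`, then `M` lies in `x₁/y₁ + (k₁/y₁) 𝔽q`; this is the origin of `c` and `d`.
  -- Conversely, through a point of `l₁` off `y = 0` there is a line meeting `l₂` and `l₃`. It
  -- belongs to `R`, hence to `𝒟η`, and the point determines its `M`.
  regulus-form : ∀ {R} → IsRegulusThroughR R →
    ∃₂ λ c d → d ≢ 0# × (∀ m → R m → Reg c d m) × (∀ m → Reg c d m → R m)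
  regulus-form {R} reg with IsRegulusThroughR.regulus reg | IsRegulusThroughR.through reg
  ... | l₁ , l₂ , l₃ , skew₁₂ , skew₁₃ , skew₂₃ , R⊆ , ⊆R | m∞ , m∞∈R , m∞≐ =
    analyse (chord-shape l₁ l₂ skew₁₂ (proj₁ meets∞) (proj₁ (proj₂ meets∞)))
            (chord-shape l₂ l₃ skew₂₃ (proj₁ (proj₂ meets∞)) (proj₂ (proj₂ meets∞)))
            (chord-shape l₃ l₁ (λ (P , P₃ , P₁) → skew₁₃ (P , P₁ , P₃)) (proj₂ (proj₂ meets∞)) (proj₁ meets∞))
    where
    hm∞ : W m∞ ≃ Infinity
    hm∞ = ≃-trans (section-≐⁻¹ {vec (X m∞)} {vec (Y m∞)} {U₁} {U₃} m∞≐) Section-U₁U₃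

    meets : ∀ m → R m → Meet m l₁ × Meet m l₂ × Meet m l₃
    meets m m∈R = let b₁ , b₂ , b₃ = R⊆ {m} m∈R in ≬⇒Meet {m} {l₁} b₁ , ≬⇒Meet {m} {l₂} b₂ , ≬⇒Meet {m} {l₃} b₃

    meets⁻¹ : ∀ m → Meet m l₁ → Meet m l₂ → Meet m l₃ → R m
    meets⁻¹ m b₁ b₂ b₃ = ⊆R {m} (Meet⇒≬ {m} {l₁} b₁ , Meet⇒≬ {m} {l₂} b₂ , Meet⇒≬ {m} {l₃} b₃)

    meets∞ = meets m∞ m∞∈R

    R-≃ : ∀ m n → W m ≃ W n → R m → R n
    R-≃ m n h m∈R = let b₁ , b₂ , b₃ = meets m m∈R in
      meets⁻¹ n (Meet-≃ {m} {n} {l₁} h b₁) (Meet-≃ {m} {n} {l₂} h b₂) (Meet-≃ {m} {n} {l₃} h b₃)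

    IsChord : Lineη → Set
    IsChord l = ∃₂ λ k x₀ → ∃ λ y₀ → k ≢ 0# × y₀ ≢ 0# × W l ≃ Chord k x₀ y₀

    chord-shape : ∀ l l′ → Skew l l′ → Meet m∞ l → Meet m∞ l′ → IsChord l
    chord-shape l l′ skew (x , y , ≢0 , w∞ , w) (x′ , y′ , ≢0′ , w∞′ , w′) with shape l
    ... | chord k≢0 y₀≢0 h = _ , _ , _ , k≢0 , y₀≢0 , h
    ... | infinity h = contradiction (Meet⇒≬ {l} {l′} (x′ , y′ , ≢0′ , from h {x′} {y′} (to hm∞ {x′} {y′} w∞′) , w′)) skew
    ... | graph {M} {N} h = contradiction (trans (to h w) (trans (cong (λ z → M * z + N * conj z) y≡0) (solve 2 (λ m n → m :* 𝟘 :+ n :* 𝟘 ᶜ := 𝟘) refl M N)) , y≡0) ≢0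
      where
      y≡0 : y ≡ 0#
      y≡0 = to hm∞ {x} {y} w∞

    analyse : IsChord l₁ → IsChord l₂ → IsChord l₃ → ∃₂ λ c d → d ≢ 0# × (∀ m → R m → Reg c d m) × (∀ m → Reg c d m → R m)
    analyse (k₁ , x₁ , y₁ , k₁≢0 , y₁≢0 , h₁) (k₂ , x₂ , y₂ , k₂≢0 , y₂≢0 , h₂) (k₃ , x₃ , y₃ , k₃≢0 , y₃≢0 , h₃) =
      x₁ * i , k₁ * i , *-nonzero k₁≢0 i≢0 , forth , back
      where
      i = proj₁ (inverse y₁ y₁≢0)
      y₁i≡1 = proj₂ (inverse y₁ y₁≢0)
      i≢0 : i ≢ 0#
      i≢0 i≡0 = 1≢0 (trans (sym y₁i≡1) (trans (cong (y₁ *_) i≡0) (zeroʳ y₁)))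
      open SkewChords k₂≢0 k₃≢0 y₂≢0 y₃≢0 (Skew⇒Disjoint {l₂} {l₃} h₂ h₃ skew₂₃)

      forth : ∀ m → R m → Reg (x₁ * i) (k₁ * i) m
      forth m m∈R with 𝒟η⇒Dη {m} (IsRegulusThroughR.inside reg {m} m∈R)
      ... | inj₁ h = inj₁ h
      ... | inj₂ (M , h) with meets m m∈R
      ...   | (x , y , ≢0 , w , w₁) , _ with to h₁ w₁
      ...     | r , s , hr , hs , ex , ey = inj₂ (r * j , Fix-* hr (Fix-inverse sj≡1 hs) , subst (λ z → W m ≃ Graph z 0#) M≡ h)
        where
        e : x ≡ M * y + 0# * conj y
        e = to h w
        s≢0 : s ≢ 0#
        s≢0 refl = ≢0 (trans e (trans (cong (λ z → M * z + 0# * conj z) y≡0) (solve 1 (λ m → m :* 𝟘 :+ 𝟘 :* 𝟘 ᶜ := 𝟘) refl M)) , y≡0)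
          where
          y≡0 : y ≡ 0#
          y≡0 = trans ey (zeroˡ y₁)
        j = proj₁ (inverse s s≢0)
        sj≡1 = proj₂ (inverse s s≢0)
        e′ : r * k₁ + s * x₁ ≡ M * (s * y₁)
        e′ = trans (sym ex) (trans e (trans (cong (λ z → M * z + 0# * conj z) ey) (solve 2 (λ m z → m :* z :+ 𝟘 :* z ᶜ := m :* z) refl M (s * y₁))))
        M≡ : M ≡ x₁ * i + k₁ * i * (r * j)
        M≡ = combine₃ e′ (- (i * j)) y₁i≡1 (- M) sj≡1 (x₁ * i - M * (y₁ * i))
          (solve 8 (λ M x₁ i k₁ r j s y₁ → M :- (x₁ :* i :+ k₁ :* i :* (r :* j))
            := (:- (i :* j)) :* ((r :* k₁ :+ s :* x₁) :- M :* (s :* y₁)) :+ (:- M) :* (y₁ :* i :- 𝟙) :+ (x₁ :* i :- M :* (y₁ :* i)) :* (s :* j :- 𝟙))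
            refl M x₁ i k₁ r j s y₁)

      back : ∀ m → Reg (x₁ * i) (k₁ * i) m → R m
      back m (inj₁ h) = R-≃ m∞ m (≃-trans hm∞ (≃-sym h)) m∞∈R
      back m (inj₂ (r , hr , h)) = finish (transversal
          (λ ∈₂ → P≢0 (Skew⇒Disjoint {l₁} {l₂} h₁ h₂ skew₁₂ P∈l₁ ∈₂))
          (λ ∈₃ → P≢0 (Skew⇒Disjoint {l₁} {l₃} h₁ h₃ skew₁₃ P∈l₁ ∈₃)))
        where
        P∈l₁ : Chord k₁ x₁ y₁ (r * k₁ + x₁) y₁
        P∈l₁ = r , 1# , hr , Fix-1 , cong (r * k₁ +_) (sym (*-identityˡ x₁)) , sym (*-identityˡ y₁)
        P≢0 : ¬ Origin (r * k₁ + x₁) y₁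
        P≢0 (_ , e) = y₁≢0 e
        finish : _ → R m
        finish (n , w , (x′ , y′ , ≢0′ , w′ , ∈₂) , (x″ , y″ , ≢0″ , w″ , ∈₃)) = R-≃ n m n≃m n∈R
          where
          n∈R : R n
          n∈R = meets⁻¹ n (_ , _ , P≢0 , w , from h₁ P∈l₁) (x′ , y′ , ≢0′ , w′ , from h₂ ∈₂) (x″ , y″ , ≢0″ , w″ , from h₃ ∈₃)
          n≃m : W n ≃ W m
          n≃m with 𝒟η⇒Dη {n} (IsRegulusThroughR.inside reg {n} n∈R)
          ... | inj₁ h∞ = contradiction (to h∞ {r * k₁ + x₁} {y₁} w) y₁≢0
          ... | inj₂ (M , hM) = ≃-trans (subst (λ z → W n ≃ Graph z 0#) M≡ hM) (≃-sym h)
            where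
            M≡ : M ≡ x₁ * i + k₁ * i * r
            M≡ = combine₂ (to hM w) (- i) y₁i≡1 (- M) (solve 6 (λ M x₁ i k₁ r y₁ → M :- (x₁ :* i :+ k₁ :* i :* r)
              := (:- i) :* ((r :* k₁ :+ x₁) :- (M :* y₁ :+ 𝟘 :* y₁ ᶜ)) :+ (:- M) :* (y₁ :* i :- 𝟙)) refl M x₁ i k₁ r y₁)

  -- Desarguesian spreads

  Twisted₀ : 𝔽 → 𝔽 → 𝔽 → 𝔽 → 𝔽 → 𝔽 → Set
  Twisted₀ i j d s x y = ∃ λ a → x ≡ d * (i * (s * a) + j * conj (s * a)) × y ≡ i * a + j * conj a

  -- With f a = i a + j a^q, the spread with components {(d f (s a) , f a)}.
  ConjugateSpread : 𝔽 → 𝔽 → 𝔽 → Lineη → Set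
  ConjugateSpread i j d m = W m ≃ Infinity ⊎ ∃ λ s → W m ≃ Twisted₀ i j d s

  module _ {i j d : 𝔽} where

    scale-≃ : ∀ {κ} s → κ ≢ 0# → Twisted₀ i j d s ≃ Twisted₀ (i * κ) (j * conj κ) d s
    scale-≃ {κ} s κ≢0 = let λ′ , κλ≡1 = inverse κ κ≢0 in equiv
      (λ { (a , refl , refl) → λ′ * a , at-x (unscale a λ′ κλ≡1) , at-y (unscale a λ′ κλ≡1) })
      (λ { (a , refl , refl) → κ * a ,
        solve 6 (λ i j d κ s a → d :* (i :* κ :* (s :* a) :+ j :* κ ᶜ :* (s :* a) ᶜ) := d :* (i :* (s :* (κ :* a)) :+ j :* (s :* (κ :* a)) ᶜ)) refl i j d κ s a ,
        solve 4 (λ i j κ a → i :* κ :* a :+ j :* κ ᶜ :* a ᶜ := i :* (κ :* a) :+ j :* (κ :* a) ᶜ) refl i j κ a })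
      where
      unscale : ∀ a λ′ → κ * λ′ ≡ 1# → a ≡ κ * (λ′ * a)
      unscale a λ′ e = combine₁ e (- a) (solve 3 (λ κ l a → a :- κ :* (l :* a) := (:- a) :* (κ :* l :- 𝟙)) refl κ λ′ a)
      at-x : ∀ {a b} → a ≡ κ * b → d * (i * (s * a) + j * conj (s * a)) ≡ d * (i * κ * (s * b) + j * conj κ * conj (s * b))
      at-x {_} {b} refl = solve 6 (λ i j d κ s a → d :* (i :* (s :* (κ :* a)) :+ j :* (s :* (κ :* a)) ᶜ) := d :* (i :* κ :* (s :* a) :+ j :* κ ᶜ :* (s :* a) ᶜ)) refl i j d κ s b
      at-y : ∀ {a b} → a ≡ κ * b → i * a + j * conj a ≡ i * κ * b + j * conj κ * conj b
      at-y {_} {b} refl = solve 4 (λ i j κ a → i :* (κ :* a) :+ j :* (κ :* a) ᶜ := i :* κ :* a :+ j :* κ ᶜ :* a ᶜ) refl i j κ b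

    -- Substituting `conj a` for `a` exchanges the two coefficients and conjugates the parameter
    -- `s`.
    swap-≃ : ∀ s → Twisted₀ i j d s ≃ Twisted₀ j i d (conj s)
    swap-≃ s = equiv
      (λ { (a , refl , refl) → conj a ,
        solve 5 (λ i j d s a → d :* (i :* (s :* a) :+ j :* (s :* a) ᶜ) := d :* (j :* (s ᶜ :* a ᶜ) :+ i :* (s ᶜ :* a ᶜ) ᶜ)) refl i j d s a ,
        solve 3 (λ i j a → i :* a :+ j :* a ᶜ := j :* a ᶜ :+ i :* (a ᶜ) ᶜ) refl i j a })
      (λ { (a , refl , refl) → conj a ,
        solve 5 (λ i j d s a → d :* (j :* (s ᶜ :* a) :+ i :* (s ᶜ :* a) ᶜ) := d :* (i :* (s :* a ᶜ) :+ j :* (s :* a ᶜ) ᶜ)) refl i j d s a ,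
        solve 3 (λ i j a → j :* a :+ i :* a ᶜ := i :* a ᶜ :+ j :* (a ᶜ) ᶜ) refl i j a })

  infix 4 _⇔ₛ_

  record _⇔ₛ_ (P Q : Lineη → Set) : Set where
    constructor equivₛ
    field
      into  : ∀ m → P m → Q m
      outof : ∀ m → Q m → P m
  open _⇔ₛ_ public

  ⇔ₛ-sym : ∀ {P Q} → P ⇔ₛ Q → Q ⇔ₛ P
  ⇔ₛ-sym h = equivₛ (outof h) (into h)

  ⇔ₛ-trans : ∀ {P Q R} → P ⇔ₛ Q → Q ⇔ₛ R → P ⇔ₛ R
  ⇔ₛ-trans h k = equivₛ (λ m p → into k m (into h m p)) (λ m r → outof h m (outof k m r))

  module _ {i j d : 𝔽} where

    ConjugateSpread-scale : ∀ {κ} → κ ≢ 0# → ConjugateSpread i j d ⇔ₛ ConjugateSpread (i * κ) (j * conj κ) d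
    ConjugateSpread-scale κ≢0 = equivₛ
      (λ m → [ inj₁ , (λ (s , h) → inj₂ (s , ≃-trans h (scale-≃ s κ≢0))) ]′)
      (λ m → [ inj₁ , (λ (s , h) → inj₂ (s , ≃-trans h (≃-sym (scale-≃ s κ≢0)))) ]′)

    ConjugateSpread-swap : ConjugateSpread i j d ⇔ₛ ConjugateSpread j i d
    ConjugateSpread-swap = equivₛ
      (λ m → [ inj₁ , (λ (s , h) → inj₂ (conj s , ≃-trans h (swap-≃ s))) ]′)
      (λ m → [ inj₁ , (λ (s , h) → inj₂ (conj s , ≃-trans h (subst (λ z → Twisted₀ j i d z ≃ Twisted₀ i j d (conj s)) (conj-involutive s) (≃-sym (swap-≃ (conj s)))))) ]′)

  module _ {g h d : 𝔽} (d≢0 : d ≢ 0#) (hd̄≡dg : h * conj d ≡ d * g) where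
    private
      -- The factor `d` is absorbed into the argument, since `d g z̄ = h conj (d z)`. This is what
      -- `h` is for.
      Twisted₀≃Twisted : ∀ s → Twisted₀ 1# g d s ≃ Twisted g h 0# (d * s)
      Twisted₀≃Twisted s = equiv
        (λ { (a , ex , ey) → a , trans ex (at-x a) , trans ey (at-y a) })
        (λ { (a , ex , ey) → a , trans ex (sym (at-x a)) , trans ey (sym (at-y a)) })
        where
        at-x : ∀ a → d * (1# * (s * a) + g * conj (s * a)) ≡ twist h (d * s * a) + 0# * twist g a
        at-x a = combine₁ hd̄≡dg (- conj (s * a)) (solve 5 (λ d s a g h → d :* (𝟙 :* (s :* a) :+ g :* (s :* a) ᶜ) :- ((d :* s :* a :+ h :* (d :* s :* a) ᶜ) :+ 𝟘 :* (a :+ g :* a ᶜ))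
          := (:- ((s :* a) ᶜ)) :* (h :* d ᶜ :- d :* g)) refl d s a g h)
        at-y : ∀ a → 1# * a + g * conj a ≡ twist g a
        at-y a = cong (_+ g * conj a) (*-identityˡ a)

    ConjugateSpread⇔TwistedSpread : ConjugateSpread 1# g d ⇔ₛ TwistedSpread g h 0#
    ConjugateSpread⇔TwistedSpread = equivₛ
      (λ m → [ inj₁ , (λ (s , e) → inj₂ (d * s , ≃-trans e (Twisted₀≃Twisted s))) ]′)
      (λ m → [ inj₁ , (λ (s , e) → let t , dt≡1 = inverse d d≢0 in inj₂ (t * s ,
        ≃-trans e (≃-sym (subst (λ z → Twisted₀ 1# g d (t * s) ≃ Twisted g h 0# z)
          (sym (combine₁ dt≡1 (- s) (solve 3 (λ d t s → s :- d :* (t :* s) := (:- s) :* (d :* t :- 𝟙)) refl d t s)))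
          (Twisted₀≃Twisted (t * s)))))) ]′)

  module _ {S : LineSet} (D : IsDesarguesian S) where
    open IsDesarguesian D
    open IsSpread isSpread

    private
      fst snd : Vec 𝔽 2 → 𝔽
      fst = Vec.head
      snd = Vec.head ∘ Vec.tail

      η₂ : ∀ (v : Vec 𝔽 2) → v ≡ fst v ∷ snd v ∷ []
      η₂ (x ∷ y ∷ []) = refl

      φ-homogeneous : ∀ c v → c ∈ Fix → φ (c · v) ≡ c · φ v
      φ-homogeneous c v hc = homogeneous c v (Fix⇒𝔽q hc)

      φ-0 : ∀ v → φ (0# · v) ≡ 𝟎
      φ-0 v = trans (φ-homogeneous 0# v Fix-0) (0· φ v)

      φ-kernel : ∀ {v} → φ v ≡ 𝟎 → v ≡ 𝟎
      φ-kernel {v} e = trans (proj₁ bijective (trans e (sym (φ-0 v)))) (0· v)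

      Component : Vec 𝔽 2 → 𝔽 → 𝔽 → Set
      Component w x y = ∃ λ c → φ (c · w) ≡ x ∷ y ∷ []

      component-Coordinates : ∀ w → Coordinates (λ P → ∃ λ c → P ∼ ι η (φ (c · w))) (Component w)
      component-Coordinates w = record
        { coordinates = λ { P (c , k , e) → fst (φ (c · w)) , snd (φ (c · w)) , k , (c , η₂ _) ,
            trans e (trans (cong (λ v → k · ι η v) (η₂ (φ (c · w)))) (cong (k ·_) (ι≡ι′ η _ _))) }
        ; member = λ P {x} {y} {k} (c , e) _ e′ → c , k , trans e′ (cong (k ·_) (trans (sym (ι≡ι′ η x y)) (cong (ι η) (sym e))))
        ; at-origin = 0# , φ-0 w
        ; scale = scaled
        }
        where
        -- Normalised vectors that differ by a scalar differ by a fixed one, and `φ` is homogeneous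
        -- only for those.
        scaled : ∀ {x y x′ y′ k} → Component w x′ y′ → ι′ η x y ≡ k · ι′ η x′ y′ → Component w x y
        scaled {x} {y} {x′} {y′} {k} (c , e) eι with origin? x′ y′ | vec4-injective eι
        ... | no ≢0 | ex , ey , _ = k * c , trans (cong φ (sym (·-· k c w)))
              (trans (φ-homogeneous k (c · w) (multiplier-fixed eι ≢0)) (trans (cong (k ·_) e) (sym (cong₂ (λ u v → u ∷ v ∷ []) ex ey))))
        ... | yes (refl , refl) | ex , ey , _ = 0# , trans (φ-0 w) (sym (cong₂ (λ u v → u ∷ v ∷ []) (trans ex (zeroʳ k)) (trans ey (zeroʳ k))))

      S⇒ : ∀ m → S m → ∃ λ w → w ≢ 𝟎 × W m ≃ Component w
      S⇒ m m∈S = let w , w≢0 , h = proj₁ reduction {m} m∈S in w , w≢0 , ≐⇒≃ (component-Coordinates w) {m} h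

      ⇒S : ∀ m w → w ≢ 𝟎 → W m ≃ Component w → S m
      ⇒S m w w≢0 h = proj₂ reduction {m} (w , w≢0 , ≃⇒≐ (component-Coordinates w) {m} h)

      +-· : ∀ a b (w : Vec 𝔽 2) → (a + b) · w ≡ a · w ⊕ b · w
      +-· a b (x ∷ y ∷ []) = cong₂ (λ u v → u ∷ v ∷ []) (distrib x) (distrib y)
        where
        distrib : ∀ z → (a + b) * z ≡ a * z + b * z
        distrib = solve 3 (λ a b z → (a :+ b) :* z := a :* z :+ b :* z) refl a b

      ·-zero : ∀ {a} {w : Vec 𝔽 2} → w ≢ 𝟎 → a · w ≡ 𝟎 → a ≡ 0#
      ·-zero {a} {x ∷ y ∷ []} w≢0 e with a ≟ 0#
      ... | yes a≡0 = a≡0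
      ... | no a≢0  = contradiction (cong₂ (λ u v → u ∷ v ∷ []) (*-cancel-0 a≢0 (cong fst e)) (*-cancel-0 a≢0 (cong snd e))) w≢0

      det : Vec 𝔽 2 → Vec 𝔽 2 → 𝔽
      det u v = fst u * snd v - snd u * fst v

      parallel : ∀ u v → det u v ≡ 0# → fst u · v ≡ fst v · u × snd u · v ≡ snd v · u
      parallel (p₁ ∷ p₂ ∷ []) (r₁ ∷ r₂ ∷ []) e =
        cong₂ (λ u v → u ∷ v ∷ []) (*-comm p₁ r₁) (combine₁ e 1# (solve 4 (λ p₁ p₂ r₁ r₂ → p₁ :* r₂ :- r₁ :* p₂
          := 𝟙 :* ((p₁ :* r₂ :- p₂ :* r₁) :- 𝟘)) refl p₁ p₂ r₁ r₂)) ,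
        cong₂ (λ u v → u ∷ v ∷ []) (combine₁ e (- 1#) (solve 4 (λ p₁ p₂ r₁ r₂ → p₂ :* r₁ :- r₂ :* p₁
          := (:- 𝟙) :* ((p₁ :* r₂ :- p₂ :* r₁) :- 𝟘)) refl p₁ p₂ r₁ r₂)) (*-comm p₂ r₂)

      opaque
        decompose-at : ∀ {u v} → det u v ≢ 0# → ∀ w → ∃₂ λ b a → w ≡ b · u ⊕ a · v
        decompose-at {p₁ ∷ p₂ ∷ []} {r₁ ∷ r₂ ∷ []} det≢0 (z₁ ∷ z₂ ∷ []) with inverse _ det≢0
        ... | i , e = (z₁ * r₂ - z₂ * r₁) * i , (p₁ * z₂ - p₂ * z₁) * i , cong₂ (λ u v → u ∷ v ∷ [])
          (combine₁ e (- z₁) (solve 7 (λ p₁ p₂ r₁ r₂ z₁ z₂ i → z₁ :- ((z₁ :* r₂ :- z₂ :* r₁) :* i :* p₁ :+ (p₁ :* z₂ :- p₂ :* z₁) :* i :* r₁)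
            := (:- z₁) :* ((p₁ :* r₂ :- p₂ :* r₁) :* i :- 𝟙)) refl p₁ p₂ r₁ r₂ z₁ z₂ i))
          (combine₁ e (- z₂) (solve 7 (λ p₁ p₂ r₁ r₂ z₁ z₂ i → z₂ :- ((z₁ :* r₂ :- z₂ :* r₁) :* i :* p₂ :+ (p₁ :* z₂ :- p₂ :* z₁) :* i :* r₂)
            := (:- z₂) :* ((p₁ :* r₂ :- p₂ :* r₁) :* i :- 𝟙)) refl p₁ p₂ r₁ r₂ z₁ z₂ i))

    module _ {d : 𝔽} (d≢0 : d ≢ 0#) {m∞ m₀ m₁ : Lineη}
      (h∞ : W m∞ ≃ Infinity) (h₀ : W m₀ ≃ Graph 0# 0#) (h₁ : W m₁ ≃ Graph d 0#)
      (m∞∈S : S m∞) (m₀∈S : S m₀) (m₁∈S : S m₁) where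

      private
        w∞ w₀ w₁ : Vec 𝔽 2
        w∞ = proj₁ (S⇒ m∞ m∞∈S)
        w₀ = proj₁ (S⇒ m₀ m₀∈S)
        w₁ = proj₁ (S⇒ m₁ m₁∈S)

        w∞≢0 : w∞ ≢ 𝟎
        w∞≢0 = proj₁ (proj₂ (S⇒ m∞ m∞∈S))
        w₀≢0 : w₀ ≢ 𝟎
        w₀≢0 = proj₁ (proj₂ (S⇒ m₀ m₀∈S))
        w₁≢0 : w₁ ≢ 𝟎
        w₁≢0 = proj₁ (proj₂ (S⇒ m₁ m₁∈S))

        c∞ : W m∞ ≃ Component w∞
        c∞ = proj₂ (proj₂ (S⇒ m∞ m∞∈S))
        c₀ : W m₀ ≃ Component w₀
        c₀ = proj₂ (proj₂ (S⇒ m₀ m₀∈S))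
        c₁ : W m₁ ≃ Component w₁
        c₁ = proj₂ (proj₂ (S⇒ m₁ m₁∈S))

        -- In the basis `w∞`, `w₀` of 𝔽² the map `φ` sends (b, a) to (B∞ b, A₀ a), because the two
        -- components go to `y = 0` and `x = 0`.
        A₀ B∞ : 𝔽 → 𝔽
        A₀ a = snd (φ (a · w₀))
        B∞ b = fst (φ (b · w∞))

        φ-w₀ : ∀ a → φ (a · w₀) ≡ 0# ∷ A₀ a ∷ []
        φ-w₀ a = trans (η₂ _) (cong (_∷ A₀ a ∷ []) (trans (to h₀ (from c₀ (a , η₂ _)))
          (solve 1 (λ z → 𝟘 :* z :+ 𝟘 :* z ᶜ := 𝟘) refl (A₀ a))))

        φ-w∞ : ∀ b → φ (b · w∞) ≡ B∞ b ∷ 0# ∷ []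
        φ-w∞ b = trans (η₂ _) (cong (λ z → B∞ b ∷ z ∷ []) (to h∞ {B∞ b} {snd (φ (b · w∞))} (from c∞ (b , η₂ _))))

        A-+ : ∀ a b → A₀ (a + b) ≡ A₀ a + A₀ b
        A-+ a b = cong snd (trans (cong φ (+-· a b w₀)) (trans (additive (a · w₀) (b · w₀)) (cong₂ _⊕_ (φ-w₀ a) (φ-w₀ b))))

        A-* : ∀ r a → r ∈ Fix → A₀ (r * a) ≡ r * A₀ a
        A-* r a hr = cong snd (trans (cong φ (sym (·-· r a w₀))) (trans (φ-homogeneous r (a · w₀) hr) (cong (r ·_) (φ-w₀ a))))

        A-kernel : ∀ {a} → A₀ a ≡ 0# → a ≡ 0#
        A-kernel {a} e = ·-zero w₀≢0 (φ-kernel (trans (φ-w₀ a) (cong (λ z → 0# ∷ z ∷ []) e)))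

        A-0 : A₀ 0# ≡ 0#
        A-0 = cong snd (φ-0 w₀)

        B-0 : B∞ 0# ≡ 0#
        B-0 = cong fst (φ-0 w∞)

        -- A vector common to both components would be mapped into `y = 0` and into `x = 0`, hence
        -- to the origin.
        det≢0 : det w∞ w₀ ≢ 0#
        det≢0 det≡0 = w∞≢0 (trans (η₂ w∞) (cong₂ (λ u v → u ∷ v ∷ [])
            (vanish (proj₁ (parallel w∞ w₀ det≡0))) (vanish (proj₂ (parallel w∞ w₀ det≡0)))))
          where
          vanish : ∀ {p r} → p · w₀ ≡ r · w∞ → p ≡ 0#
          vanish {p} {r} e = A-kernel (cong snd (trans (sym (φ-w₀ p)) (trans (cong φ e) (φ-w∞ r))))

        φ-at : ∀ {w b a} → w ≡ b · w∞ ⊕ a · w₀ → ∀ c → φ (c · w) ≡ B∞ (c * b) ∷ A₀ (c * a) ∷ []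
        φ-at {w} {b} {a} refl c = begin
          φ (c · (b · w∞ ⊕ a · w₀))               ≡⟨ cong φ (·-combination c b a w∞ w₀) ⟩
          φ ((c * b) · w∞ ⊕ (c * a) · w₀)         ≡⟨ additive _ _ ⟩
          φ ((c * b) · w∞) ⊕ φ ((c * a) · w₀)     ≡⟨ cong₂ _⊕_ (φ-w∞ (c * b)) (φ-w₀ (c * a)) ⟩
          B∞ (c * b) + 0# ∷ 0# + A₀ (c * a) ∷ []    ≡⟨ cong₂ (λ u v → u ∷ v ∷ []) (+-identityʳ _) (+-identityˡ _) ⟩
          B∞ (c * b) ∷ A₀ (c * a) ∷ [] ∎
          where open ≡-Reasoning

        -- The component of `w₁ = b₀ w∞ + a₀ w₀` is mapped onto `x = d y`, so
        -- `B∞ (c b₀) = d A₀ (c a₀)` for all `c`. Neither coefficient vanishes, and `κ = a₀ / b₀`.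
        B≡dA : ∃ λ κ → κ ≢ 0# × ∀ b → B∞ b ≡ d * A₀ (κ * b)
        B≡dA = κ , *-nonzero β≢0 a₀≢0 , λ b → trans (cong B∞ (unscale b)) (trans (on-graph (b * β)) (cong (λ z → d * A₀ z) (rescale b)))
          where
          decomposition = decompose-at det≢0 w₁
          b₀ a₀ : 𝔽
          b₀ = proj₁ decomposition
          a₀ = proj₁ (proj₂ decomposition)
          φ-w₁ : ∀ c → φ (c · w₁) ≡ B∞ (c * b₀) ∷ A₀ (c * a₀) ∷ []
          φ-w₁ = φ-at (proj₂ (proj₂ decomposition))
          on-graph : ∀ c → B∞ (c * b₀) ≡ d * A₀ (c * a₀)
          on-graph c = trans (to h₁ (from c₁ (c , φ-w₁ c))) (solve 2 (λ d z → d :* z :+ 𝟘 :* z ᶜ := d :* z) refl d (A₀ (c * a₀)))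
          a₀≢0 : a₀ ≢ 0#
          a₀≢0 a₀≡0 = 1≢0 (·-zero w₁≢0 (φ-kernel (trans (φ-w₁ 1#) (cong₂ (λ u v → u ∷ v ∷ [])
              (trans (on-graph 1#) (trans (cong (d *_) A≡0) (zeroʳ d))) A≡0))))
            where
            A≡0 : A₀ (1# * a₀) ≡ 0#
            A≡0 = trans (cong A₀ (trans (*-identityˡ a₀) a₀≡0)) A-0
          b₀≢0 : b₀ ≢ 0#
          b₀≢0 b₀≡0 = a₀≢0 (trans (sym (*-identityˡ a₀)) (A-kernel (*-cancel-0 d≢0
            (trans (sym (on-graph 1#)) (trans (cong B∞ (trans (*-identityˡ b₀) b₀≡0)) B-0)))))
          β κ : 𝔽
          β = proj₁ (inverse b₀ b₀≢0)
          κ = β * a₀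
          b₀β≡1 : b₀ * β ≡ 1#
          b₀β≡1 = proj₂ (inverse b₀ b₀≢0)
          β≢0 : β ≢ 0#
          β≢0 β≡0 = 1≢0 (trans (sym b₀β≡1) (trans (cong (b₀ *_) β≡0) (zeroʳ b₀)))
          unscale : ∀ b → b ≡ b * β * b₀
          unscale b = combine₁ b₀β≡1 (- b) (solve 3 (λ b β b₀ → b :- b :* β :* b₀ := (:- b) :* (b₀ :* β :- 𝟙)) refl b β b₀)
          rescale : ∀ b → b * β * a₀ ≡ κ * b
          rescale b = solve 3 (λ b β a₀ → b :* β :* a₀ := β :* a₀ :* b) refl b β a₀

        Graph-A : 𝔽 → 𝔽 → 𝔽 → Set
        Graph-A s x y = ∃ λ a → x ≡ d * A₀ (s * a) × y ≡ A₀ a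

        forth : ∀ m → S m → W m ≃ Infinity ⊎ ∃ λ s → W m ≃ Graph-A s
        forth m m∈S = go (a ≟ 0#)
          where
          w : Vec 𝔽 2
          w = proj₁ (S⇒ m m∈S)
          w≢0 : w ≢ 𝟎
          w≢0 = proj₁ (proj₂ (S⇒ m m∈S))
          hw : W m ≃ Component w
          hw = proj₂ (proj₂ (S⇒ m m∈S))
          decomposition = decompose-at det≢0 w
          b a : 𝔽
          b = proj₁ decomposition
          a = proj₁ (proj₂ decomposition)
          φ-w : ∀ c → φ (c · w) ≡ B∞ (c * b) ∷ A₀ (c * a) ∷ []
          φ-w = φ-at (proj₂ (proj₂ decomposition))
          κ : 𝔽
          κ = proj₁ B≡dA
          go : Dec (a ≡ 0#) → W m ≃ Infinity ⊎ ∃ λ s → W m ≃ Graph-A s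
          go (yes a≡0) = inj₁ (≃-trans hw (equiv
            (λ { (c , e) → trans (cong snd (trans (sym e) (φ-w c))) (A≡0 c) })
            (λ { {x} refl → let c , e = to c∞ (from h∞ {x} refl) in c * i ,
              trans (φ-w (c * i)) (cong₂ (λ u v → u ∷ v ∷ []) (trans (cong B∞ (unscale c)) (cong fst (trans (sym (φ-w∞ c)) e))) (A≡0 (c * i))) })))
            where
            A≡0 : ∀ c → A₀ (c * a) ≡ 0#
            A≡0 c = trans (cong A₀ (trans (cong (c *_) a≡0) (zeroʳ c))) A-0
            b≢0 : b ≢ 0#
            b≢0 b≡0 = 1≢0 (·-zero w≢0 (φ-kernel (trans (φ-w 1#) (cong₂ (λ u v → u ∷ v ∷ [])
              (trans (cong B∞ (trans (*-identityˡ b) b≡0)) B-0) (A≡0 1#)))))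
            i = proj₁ (inverse b b≢0)
            bi≡1 = proj₂ (inverse b b≢0)
            unscale : ∀ c → c * i * b ≡ c
            unscale c = combine₁ bi≡1 c (solve 3 (λ c b i → c :* i :* b :- c := c :* (b :* i :- 𝟙)) refl c b i)
          go (no a≢0) = inj₂ (κ * b * i , ≃-trans hw (equiv
            (λ { (c , e) → c * a , trans (cong fst (trans (sym e) (φ-w c))) (trans (proj₂ (proj₂ B≡dA) (c * b)) (cong (λ z → d * A₀ z) (ratio c))) ,
              cong snd (trans (sym e) (φ-w c)) })
            (λ { (e , refl , refl) → e * i , trans (φ-w (e * i)) (cong₂ (λ u v → u ∷ v ∷ [])
              (trans (proj₂ (proj₂ B≡dA) (e * i * b)) (cong (λ z → d * A₀ z) (solve 4 (λ κ e i b → κ :* (e :* i :* b) := κ :* b :* i :* e) refl κ e i b)))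
              (cong A₀ (unscale e))) })))
            where
            i = proj₁ (inverse a a≢0)
            ai≡1 = proj₂ (inverse a a≢0)
            unscale : ∀ c → c * i * a ≡ c
            unscale c = combine₁ ai≡1 c (solve 3 (λ c a i → c :* i :* a :- c := c :* (a :* i :- 𝟙)) refl c a i)
            ratio : ∀ c → κ * (c * b) ≡ κ * b * i * (c * a)
            ratio c = combine₁ ai≡1 (- (κ * b * c)) (solve 5 (λ κ b i c a → κ :* (c :* b) :- κ :* b :* i :* (c :* a) := (:- (κ :* b :* c)) :* (a :* i :- 𝟙)) refl κ b i c a)

        back : ∀ m → W m ≃ Infinity ⊎ (∃ λ s → W m ≃ Graph-A s) → S m
        back m (inj₁ h) = respects {m∞} {m} (≃⇒≈ {m∞} {m} (≃-trans h∞ (≃-sym h))) m∞∈S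
        back m (inj₂ (s , h)) = ⇒S m w w≢0 (≃-trans h (equiv
          (λ { (e , refl , refl) → e , trans (φ-w e) (cong₂ (λ u v → u ∷ v ∷ []) (at e) (cong A₀ (*-identityʳ e))) })
          (λ { (c , e) → c , trans (cong fst (trans (sym e) (φ-w c))) (at c) , trans (cong snd (trans (sym e) (φ-w c))) (cong A₀ (*-identityʳ c)) })))
          where
          κ i : 𝔽
          κ = proj₁ B≡dA
          i = proj₁ (inverse κ (proj₁ (proj₂ B≡dA)))
          κi≡1 : κ * i ≡ 1#
          κi≡1 = proj₂ (inverse κ (proj₁ (proj₂ B≡dA)))
          w : Vec 𝔽 2
          w = (i * s) · w∞ ⊕ 1# · w₀
          φ-w : ∀ c → φ (c · w) ≡ B∞ (c * (i * s)) ∷ A₀ (c * 1#) ∷ []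
          φ-w = φ-at {w} refl
          at : ∀ c → B∞ (c * (i * s)) ≡ d * A₀ (s * c)
          at c = trans (proj₂ (proj₂ B≡dA) (c * (i * s))) (cong (λ z → d * A₀ z)
            (combine₁ κi≡1 (s * c) (solve 4 (λ κ c i s → κ :* (c :* (i :* s)) :- s :* c := s :* c :* (κ :* i :- 𝟙)) refl κ c i s)))
          w≢0 : w ≢ 𝟎
          w≢0 w≡0 = 1≢0 (trans (sym (*-identityˡ 1#)) (A-kernel (cong snd (trans (sym (φ-w 1#)) (trans (cong (λ v → φ (1# · v)) w≡0) (trans (cong φ (1·0 1#)) (trans (sym (cong φ (0· w₀))) (φ-0 w₀))))))))
            where
            1·0 : ∀ c → c · 𝟎 {2} ≡ 𝟎
            1·0 c = cong₂ (λ u v → u ∷ v ∷ []) (zeroʳ c) (zeroʳ c)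

      -- All components are expressed through `A₀`, which is linear over the fixed field. If
      -- `N i = N j`, then `A₀` kills `ī z - j z̄` for every `z`; being injective, it would have
      -- `i = j = 0` and so vanish.
      conjugate-form : ∃₂ λ i j → N i ≢ N j × S ⇔ₛ ConjugateSpread i j d
      conjugate-form with linear-form A₀ A-+ A-*
      ... | i , j , form = i , j , N≢ , equivₛ
        (λ m m∈S → [ inj₁ , (λ (s , h) → inj₂ (s , ≃-trans h (equal s))) ]′ (forth m m∈S))
        (λ m c → back m ([ inj₁ , (λ (s , h) → inj₂ (s , ≃-trans h (≃-sym (equal s)))) ]′ c))
        where
        equal : ∀ s → Graph-A s ≃ Twisted₀ i j d s
        equal s = equiv
          (λ { (a , ex , ey) → a , trans ex (cong (d *_) (form (s * a))) , trans ey (form a) })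
          (λ { (a , ex , ey) → a , trans ex (cong (d *_) (sym (form (s * a)))) , trans ey (sym (form a)) })
        N≢ : N i ≢ N j
        N≢ e = 1≢0 (A-kernel (trans (form 1#) (trans (cong₂ (λ u v → u * 1# + v * conj 1#) i≡0 j≡0)
            (solve 1 (λ z → 𝟘 :* z :+ 𝟘 :* z ᶜ := 𝟘) refl 1#))))
          where
          kernel : ∀ z → conj i * z + - j * conj z ≡ 0# * z + 0# * conj z
          kernel z = trans (A-kernel (trans (form (conj i * z + - j * conj z)) (combine₁ e z
            (solve 3 (λ i j z → (i :* (i ᶜ :* z :+ (:- j) :* z ᶜ) :+ j :* (i ᶜ :* z :+ (:- j) :* z ᶜ) ᶜ) :- 𝟘
              := z :* (i :* i ᶜ :- j :* j ᶜ)) refl i j z))))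
            (solve 1 (λ z → 𝟘 := 𝟘 :* z :+ 𝟘 :* z ᶜ) refl z)
          ī,-j≡0 = coefficients kernel
          i≡0 : i ≡ 0#
          i≡0 = trans (sym (conj-involutive i)) (trans (cong conj (proj₁ ī,-j≡0)) conj-0)
          j≡0 : j ≡ 0#
          j≡0 = combine₁ (proj₂ ī,-j≡0) (- 1#) (solve 1 (λ j → j :- 𝟘 := (:- 𝟙) :* ((:- j) :- 𝟘)) refl j)

  -- Normal form of a Desarguesian spread by the norm of its coefficient

  Admissible : 𝔽 → Set
  Admissible x = x ∈ A ⊎ (¬ (2 ∣ q) × x ≡ - 1#)

  admissible-or-inverse : ∀ {x y} → x ∈ Fix → x ≢ 0# → x ≢ 1# → x * y ≡ 1# → Admissible x ⊎ Admissible y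
  admissible-or-inverse {x} {y} hx x≢0 x≢1 xy≡1 = go (2 ∣? q)
    where
    x∈𝔽q* : x ∈ 𝔽q*
    x∈𝔽q* = Fix⇒𝔽q hx , x≢0
    inverse-in-A : x ∈ inverses A → y ∈ A
    inverse-in-A (z , z∈A , xz≡1) = subst A (*-cancelˡ x≢0 (trans xz≡1 (sym xy≡1))) z∈A
    go : Dec (2 ∣ q) → Admissible x ⊎ Admissible y
    go (yes even) with proj₂ (proj₁ (proj₂ (q-even even))) x∈𝔽q*
    ... | inj₁ 1≡x              = contradiction (sym 1≡x) x≢1
    ... | inj₂ (inj₁ x∈A)       = inj₁ (inj₁ x∈A)
    ... | inj₂ (inj₂ x∈A⁻¹)     = inj₂ (inj₁ (inverse-in-A x∈A⁻¹))
    go (no odd) with proj₂ (proj₁ (proj₁ (proj₂ (q-odd odd)))) x∈𝔽q*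
    ... | inj₁ (inj₁ 1≡x)       = contradiction (sym 1≡x) x≢1
    ... | inj₁ (inj₂ -1≡x)      = inj₁ (inj₂ (odd , sym -1≡x))
    ... | inj₂ (inj₁ x∈A)       = inj₁ (inj₁ x∈A)
    ... | inj₂ (inj₂ x∈A⁻¹)     = inj₂ (inj₁ (inverse-in-A x∈A⁻¹))

  record NormalForm (d : 𝔽) (S : Lineη → Set) : Set where
    field
      g          : 𝔽
      g≢0        : g ≢ 0#
      Ng≢1       : N g ≢ 1#
      admissible : Admissible (N g)
      form       : S ⇔ₛ ConjugateSpread 1# g d

  -- Together with `y = 0` these graphs make up `𝒟η`. This is the degenerate case in which one of
  -- `i`, `j` vanishes.
  ContainsGraphs : (Lineη → Set) → Set
  ContainsGraphs S = ∀ M m → W m ≃ Graph M 0# → S m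

  module _ {d : 𝔽} (d≢0 : d ≢ 0#) where

    private
      graphs : ∀ {i} → i ≢ 0# → ContainsGraphs (ConjugateSpread i 0# d)
      graphs {i} i≢0 M m h = inj₂ (M * e , ≃-trans h (equiv
        (λ { {x} {y} refl → y * k ,
          combine₂ de≡1 (- (M * y)) ik≡1 (- (M * y * (d * e))) (solve 6 (λ M y d e i k → (M :* y :+ 𝟘 :* y ᶜ) :- d :* (i :* (M :* e :* (y :* k)) :+ 𝟘 :* (M :* e :* (y :* k)) ᶜ)
            := (:- (M :* y)) :* (d :* e :- 𝟙) :+ (:- (M :* y :* (d :* e))) :* (i :* k :- 𝟙)) refl M y d e i k) ,
          combine₁ ik≡1 (- y) (solve 3 (λ y i k → y :- (i :* (y :* k) :+ 𝟘 :* (y :* k) ᶜ) := (:- y) :* (i :* k :- 𝟙)) refl y i k) })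
        (λ { (a , refl , refl) → combine₁ de≡1 (M * i * a) (solve 5 (λ M a d e i →
          d :* (i :* (M :* e :* a) :+ 𝟘 :* (M :* e :* a) ᶜ) :- (M :* (i :* a :+ 𝟘 :* a ᶜ) :+ 𝟘 :* (i :* a :+ 𝟘 :* a ᶜ) ᶜ)
            := M :* i :* a :* (d :* e :- 𝟙)) refl M a d e i) })))
        where
        e k : 𝔽
        e = proj₁ (inverse d d≢0)
        k = proj₁ (inverse i i≢0)
        de≡1 : d * e ≡ 1#
        de≡1 = proj₂ (inverse d d≢0)
        ik≡1 : i * k ≡ 1#
        ik≡1 = proj₂ (inverse i i≢0)

      reciprocal-norms : ∀ {i j κ l} → i * κ ≡ 1# → j * l ≡ 1# → N (j * conj κ) * N (i * conj l) ≡ 1#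
      reciprocal-norms {i} {j} {κ} {l} iκ≡1 jl≡1 = trans
        (solve 4 (λ i j κ l → (j :* κ ᶜ) :* (j :* κ ᶜ) ᶜ :* ((i :* l ᶜ) :* (i :* l ᶜ) ᶜ) := (i :* κ) :* (i :* κ) ᶜ :* ((j :* l) :* (j :* l) ᶜ)) refl i j κ l)
        (trans (cong₂ (λ u v → u * conj u * (v * conj v)) iκ≡1 jl≡1) (solve 1 (λ z → 𝟙 :* 𝟙 ᶜ :* (𝟙 :* 𝟙 ᶜ) := 𝟙) refl 0#))

      N-quotient≢1 : ∀ {i j κ} → i * κ ≡ 1# → N i ≢ N j → N (j * conj κ) ≢ 1#
      N-quotient≢1 {i} {j} {κ} iκ≡1 N≢ e = N≢ (combine₃ e (- N i) iκ≡1 (N j * conj i * conj κ) (trans (cong conj iκ≡1) conj-1) (N j)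
        (solve 3 (λ i j κ → i :* i ᶜ :- j :* j ᶜ := (:- (i :* i ᶜ)) :* ((j :* κ ᶜ) :* (j :* κ ᶜ) ᶜ :- 𝟙)
          :+ (j :* j ᶜ :* i ᶜ :* κ ᶜ) :* (i :* κ :- 𝟙) :+ (j :* j ᶜ) :* ((i :* κ) ᶜ :- 𝟙)) refl i j κ))

    opaque
      -- Scaling `i a + j ā` to have leading coefficient 1 gives `g₁`; doing so after exchanging `i`
      -- and `j` gives `g₂`. Their norms are reciprocal and different from 1, so one of the two is
      -- admissible.
      normal-form : ∀ {S i j} → N i ≢ N j → S ⇔ₛ ConjugateSpread i j d → ContainsGraphs S ⊎ NormalForm d S
      normal-form {S} {i} {j} N≢ h = go (i ≟ 0#) (j ≟ 0#)
        where
        swapped : S ⇔ₛ ConjugateSpread j i d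
        swapped = ⇔ₛ-trans h (ConjugateSpread-swap {i} {j} {d})
        go : Dec (i ≡ 0#) → Dec (j ≡ 0#) → ContainsGraphs S ⊎ NormalForm d S
        go (yes i≡0) (yes j≡0) = contradiction (cong N (trans i≡0 (sym j≡0))) N≢
        go (no i≢0)  (yes j≡0) = inj₁ λ M m e → outof h m (subst (λ z → ConjugateSpread i z d m) (sym j≡0) (graphs i≢0 M m e))
        go (yes i≡0) (no j≢0)  = inj₁ λ M m e → outof swapped m (subst (λ z → ConjugateSpread j z d m) (sym i≡0) (graphs j≢0 M m e))
        go (no i≢0)  (no j≢0)  = inj₂ (choose (admissible-or-inverse (N-∈Fix g₁) Ng₁≢0 (N-quotient≢1 iκ≡1 N≢) reciprocal))
          where
          κ l g₁ g₂ : 𝔽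
          κ = proj₁ (inverse i i≢0)
          l = proj₁ (inverse j j≢0)
          g₁ = j * conj κ
          g₂ = i * conj l
          iκ≡1 : i * κ ≡ 1#
          iκ≡1 = proj₂ (inverse i i≢0)
          jl≡1 : j * l ≡ 1#
          jl≡1 = proj₂ (inverse j j≢0)
          inverse≢0 : ∀ {x y} → x * y ≡ 1# → y ≢ 0#
          inverse≢0 {x} e y≡0 = 1≢0 (trans (sym e) (trans (cong (x *_) y≡0) (zeroʳ x)))
          reciprocal : N g₁ * N g₂ ≡ 1#
          reciprocal = reciprocal-norms iκ≡1 jl≡1
          g₁≢0 : g₁ ≢ 0#
          g₁≢0 = *-nonzero j≢0 (conj-≢0 (inverse≢0 iκ≡1))
          Ng₁≢0 : N g₁ ≢ 0#
          Ng₁≢0 = *-nonzero g₁≢0 (conj-≢0 g₁≢0)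
          choose : Admissible (N g₁) ⊎ Admissible (N g₂) → NormalForm d S
          choose (inj₁ ok) = record { g = g₁ ; g≢0 = g₁≢0 ; Ng≢1 = N-quotient≢1 iκ≡1 N≢ ; admissible = ok
            ; form = subst (λ z → S ⇔ₛ ConjugateSpread z g₁ d) iκ≡1 (⇔ₛ-trans h (ConjugateSpread-scale (inverse≢0 iκ≡1))) }
          choose (inj₂ ok) = record { g = g₂ ; g≢0 = *-nonzero i≢0 (conj-≢0 (inverse≢0 jl≡1)) ; Ng≢1 = N-quotient≢1 jl≡1 (≢-sym N≢) ; admissible = ok
            ; form = subst (λ z → S ⇔ₛ ConjugateSpread z g₂ d) jl≡1 (⇔ₛ-trans swapped (ConjugateSpread-scale (inverse≢0 jl≡1))) }

  -- Chords and opposite reguli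

  Infinity≄Chord : ∀ {m k x₀ y₀} → y₀ ≢ 0# → W m ≃ Infinity → W m ≃ Chord k x₀ y₀ → ⊥
  Infinity≄Chord {m} {k} {x₀} {y₀} y₀≢0 h h′ = y₀≢0 (to h {x₀} {y₀} (from h′ (0# , 1# , Fix-0 , Fix-1 ,
    solve 2 (λ k x₀ → x₀ := 𝟘 :* k :+ 𝟙 :* x₀) refl k x₀ , sym (*-identityˡ y₀))))

  Graph≄Chord : ∀ {m k x₀ y₀ M L} → k ≢ 0# → W m ≃ Graph M L → W m ≃ Chord k x₀ y₀ → ⊥
  Graph≄Chord {m} {k} {x₀} {y₀} {M} {L} k≢0 h h′ = k≢0 (trans (to h {k} {0#} (from h′ (1# , 0# , Fix-1 , Fix-0 ,
    solve 2 (λ k x₀ → k := 𝟙 :* k :+ 𝟘 :* x₀) refl k x₀ , sym (zeroˡ y₀)))) (solve 2 (λ M L → M :* 𝟘 :+ L :* 𝟘 ᶜ := 𝟘) refl M L))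

  Infinity≄Graph : ∀ {m M L} → W m ≃ Infinity → W m ≃ Graph M L → ⊥
  Infinity≄Graph {m} {M} {L} h h′ = 1≢0 (to h {M * 1# + L * conj 1#} {1#} (from h′ refl))

  Graph-injective : ∀ {m M L M′ L′} → W m ≃ Graph M L → W m ≃ Graph M′ L′ → M ≡ M′ × L ≡ L′
  Graph-injective h h′ = coefficients λ a → to h′ (from h refl)

  chord∉Dη : ∀ {m k x₀ y₀} → k ≢ 0# → y₀ ≢ 0# → W m ≃ Chord k x₀ y₀ → ¬ 𝒟η m
  chord∉Dη {m} k≢0 y₀≢0 h D with 𝒟η⇒Dη {m} D
  ... | inj₁ h∞ = Infinity≄Chord {m} y₀≢0 h∞ h
  ... | inj₂ (M , hM) = Graph≄Chord {m} k≢0 hM h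

  Opposite : (Lineη → Set) → Lineη → Set
  Opposite R m = ∀ l → R l → Meet m l

  opposite⇒Opposite : ∀ {R m} → opposite R m → Opposite R m
  opposite⇒Opposite {R} {m} o l l∈R = ≬⇒Meet {m} {l} (o l l∈R)

  Opposite⇒opposite : ∀ {R m} → Opposite R m → opposite R m
  Opposite⇒opposite {R} {m} o l l∈R = Meet⇒≬ {m} {l} (o l l∈R)

  -- For every fixed `r` the chord contains (c + d r, 1), a point of `x = (c + d r) y`.
  chord-Opposite : ∀ {c d m} → d ≢ 0# → W m ≃ Chord d c 1# → Opposite (Reg c d) m
  chord-Opposite {c} {d} {m} d≢0 h l (inj₁ h∞) = d , 0# , (λ (d≡0 , _) → d≢0 d≡0) ,
    from h (1# , 0# , Fix-1 , Fix-0 , solve 2 (λ d c → d := 𝟙 :* d :+ 𝟘 :* c) refl d c , sym (zeroˡ 1#)) , from h∞ {d} {0#} refl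
  chord-Opposite {c} {d} {m} d≢0 h l (inj₂ (r , hr , hl)) = c + d * r , 1# , (λ (_ , 1≡0) → 1≢0 1≡0) ,
    from h (r , 1# , hr , Fix-1 , solve 3 (λ d c r → c :+ d :* r := r :* d :+ 𝟙 :* c) refl d c r , sym (*-identityˡ 1#)) ,
    from hl (solve 3 (λ d c r → c :+ d :* r := (c :+ d :* r) :* 𝟙 :+ 𝟘 :* 𝟙 ᶜ) refl d c r)

  -- A chord meets `x = M y` only if `M y₀` lies in `x₀ + k 𝔽q`. Taking `M = c` and `M = c + d` and
  -- subtracting bounds `d` as well. Thus a chord determines the regulus to which it can be
  -- opposite.
  Opposite-chord : ∀ {c d m k x₀ y₀} → W m ≃ Chord k x₀ y₀ → Opposite (Reg c d) m →
    ∃₂ λ e f → e ∈ Fix × f ∈ Fix × c * y₀ ≡ x₀ + k * e × d * y₀ ≡ k * f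
  Opposite-chord {c} {d} {m} {k} {x₀} {y₀} h o = let e , he , eq = at 0# Fix-0 ; e′ , he′ , eq′ = at 1# Fix-1 in
    e , e′ - e , he , Fix-+ he′ (Fix-neg he) ,
    combine₁ eq 1# (solve 6 (λ c d k x₀ y₀ e → c :* y₀ :- (x₀ :+ k :* e) := 𝟙 :* ((c :+ d :* 𝟘) :* y₀ :- (x₀ :+ k :* e))) refl c d k x₀ y₀ e) ,
    combine₂ eq′ 1# eq (- 1#) (solve 7 (λ c d k x₀ y₀ e e′ → d :* y₀ :- k :* (e′ :- e)
      := 𝟙 :* ((c :+ d :* 𝟙) :* y₀ :- (x₀ :+ k :* e′)) :+ (:- 𝟙) :* ((c :+ d :* 𝟘) :* y₀ :- (x₀ :+ k :* e))) refl c d k x₀ y₀ e e′)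
    where
    at : ∀ r → r ∈ Fix → ∃ λ e → e ∈ Fix × (c + d * r) * y₀ ≡ x₀ + k * e
    at r hr with graph-line (c + d * r) 0#
    ... | l , hl with o l (inj₂ (r , hr , hl))
    ...   | x , y , ≢0 , w , w′ with to h w
    ...     | ρ , σ , hρ , hσ , ex , ey = ρ * j , Fix-* hρ (Fix-inverse σj≡1 hσ) ,
          combine₄ (to hl w′) (- j) ex j ey (- (j * (c + d * r))) σj≡1 (x₀ - (c + d * r) * y₀)
            (solve 9 (λ M k x₀ y₀ x y ρ σ j → M :* y₀ :- (x₀ :+ k :* (ρ :* j))
              := (:- j) :* (x :- (M :* y :+ 𝟘 :* y ᶜ)) :+ j :* (x :- (ρ :* k :+ σ :* x₀)) :+ (:- (j :* M)) :* (y :- σ :* y₀)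
                :+ (x₀ :- M :* y₀) :* (σ :* j :- 𝟙)) refl (c + d * r) k x₀ y₀ x y ρ σ j)
      where
      σ≢0 : σ ≢ 0#
      σ≢0 refl = ≢0 (trans (to hl w′) (trans (cong (λ z → (c + d * r) * z + 0# * conj z) y≡0)
        (solve 1 (λ M → M :* 𝟘 :+ 𝟘 :* 𝟘 ᶜ := 𝟘) refl (c + d * r))) , y≡0)
        where
        y≡0 : y ≡ 0#
        y≡0 = trans ey (zeroˡ y₀)
      j : 𝔽
      j = proj₁ (inverse σ σ≢0)
      σj≡1 : σ * j ≡ 1#
      σj≡1 = proj₂ (inverse σ σ≢0)

  -- The chord meets the line `y = 0` of `S` without being equal to it, so it cannot belong to the
  -- spread `S`.
  switch-chord : ∀ {S R T : LineSet} {m m∞ k x₀ y₀} → IsSpread S → T ≐ switch S R → S m∞ → W m∞ ≃ Infinity →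
    k ≢ 0# → y₀ ≢ 0# → W m ≃ Chord k x₀ y₀ → T m → opposite R m
  switch-chord {S} {R} {T} {m} {m∞} {k} {x₀} {y₀} spread T≐ m∞∈S h∞ k≢0 y₀≢0 h m∈T with proj₁ T≐ {m} m∈T
  ... | inj₂ o = o
  ... | inj₁ (m∈S , _) = contradiction (≃-trans (≈⇒≃ {m} {m∞} m≈m∞) h∞) (λ h′ → Infinity≄Chord {m} y₀≢0 h′ h)
    where
    ≢0 : ¬ Origin k 0#
    ≢0 (k≡0 , _) = k≢0 k≡0
    m≈m∞ : m ≈ m∞
    m≈m∞ = IsSpread.unique spread (pt k 0# ≢0) m m∞ m∈S m∞∈S
      (from h (1# , 0# , Fix-1 , Fix-0 , solve 2 (λ k x₀ → k := 𝟙 :* k :+ 𝟘 :* x₀) refl k x₀ , sym (zeroˡ y₀)) , pt∈Ση ≢0)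
      (from h∞ {k} {0#} refl , pt∈Ση ≢0)

  -- Switched spreads

  Shifted-inverse : ∀ {b m n} → W m ≃ Shifted b (W n) → W n ≃ Shifted (- b) (W m)
  Shifted-inverse {b} {m} {n} h = equiv
    (λ {x} {y} w → from h (subst (λ z → W n z y) (solve 3 (λ x y b → x := x :- (:- b) :* y :- b :* y) refl x y b) w))
    (λ {x} {y} w → subst (λ z → W n z y) (solve 3 (λ x y b → x :- (:- b) :* y :- b :* y := x) refl x y b) (to h w))

  module Shift {b c₀ c₁ : 𝔽} (c₁≡ : c₁ ≡ c₀ + b) where

    Twisted-shift : ∀ {m n g h s} → W m ≃ Shifted b (W n) → W n ≃ Twisted g h c₀ s → W m ≃ Twisted g h c₁ s
    Twisted-shift {m} {n} {g} {h} {s} hm hn = ≃-trans hm (equiv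
      (λ {x} {y} w → let a , ex , ey = to hn w in a ,
        combine₃ ex 1# ey b c₁≡ (- twist g a) (solve 7 (λ x y b c c′ t z → x :- (z :+ c′ :* t)
          := 𝟙 :* ((x :- b :* y) :- (z :+ c :* t)) :+ b :* (y :- t) :+ (:- t) :* (c′ :- (c :+ b))) refl x y b c₀ c₁ (twist g a) (twist h (s * a))) , ey)
      (λ { {x} {y} (a , ex , ey) → from hn (a ,
        combine₃ ex 1# ey (- b) c₁≡ (twist g a) (solve 7 (λ x y b c c′ t z → (x :- b :* y) :- (z :+ c :* t)
          := 𝟙 :* (x :- (z :+ c′ :* t)) :+ (:- b) :* (y :- t) :+ t :* (c′ :- (c :+ b))) refl x y b c₀ c₁ (twist g a) (twist h (s * a))) , ey) }))

    Infinity-shift : ∀ {m n} → W m ≃ Shifted b (W n) → W n ≃ Infinity → W m ≃ Infinity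
    Infinity-shift {m} {n} hm hn = equiv (λ {x} {y} w → to hn {x - b * y} {y} (to hm w)) (λ {x} {y} e → from hm (from hn {x - b * y} {y} e))

    Graph-shift : ∀ {m n M M′} → M′ ≡ M + b → W m ≃ Shifted b (W n) → W n ≃ Graph M 0# → W m ≃ Graph M′ 0#
    Graph-shift {m} {n} {M} {M′} e hm hn = ≃-trans hm (equiv
      (λ {x} {y} w → combine₂ (to hn w) 1# e (- y) (solve 5 (λ x y b M M′ → x :- (M′ :* y :+ 𝟘 :* y ᶜ)
        := 𝟙 :* ((x :- b :* y) :- (M :* y :+ 𝟘 :* y ᶜ)) :+ (:- y) :* (M′ :- (M :+ b))) refl x y b M M′))
      (λ {x} {y} w → from hn (combine₂ w 1# e y (solve 5 (λ x y b M M′ → (x :- b :* y) :- (M :* y :+ 𝟘 :* y ᶜ)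
        := 𝟙 :* (x :- (M′ :* y :+ 𝟘 :* y ᶜ)) :+ y :* (M′ :- (M :+ b))) refl x y b M M′))))

    TwistedSpread-shift : ∀ {m n g h} → W m ≃ Shifted b (W n) → TwistedSpread g h c₀ n → TwistedSpread g h c₁ m
    TwistedSpread-shift {m} {n} hm (inj₁ hn)       = inj₁ (Infinity-shift {m} {n} hm hn)
    TwistedSpread-shift {m} {n} hm (inj₂ (s , hn)) = inj₂ (s , Twisted-shift {m} {n} hm hn)

    Reg-shift : ∀ {m n d} → W m ≃ Shifted b (W n) → Reg c₀ d n → Reg c₁ d m
    Reg-shift {m} {n} hm (inj₁ hn)                = inj₁ (Infinity-shift {m} {n} hm hn)
    Reg-shift {m} {n} {d} hm (inj₂ (r , hr , hn)) = inj₂ (r , hr , Graph-shift {m} {n}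
      (combine₁ c₁≡ 1# (solve 5 (λ c c′ b d r → (c′ :+ d :* r) :- (c :+ d :* r :+ b) := 𝟙 :* (c′ :- (c :+ b))) refl c₀ c₁ b d r)) hm hn)

    Meet-shift : ∀ {m n l k} → W m ≃ Shifted b (W n) → W l ≃ Shifted b (W k) → Meet n k → Meet m l
    Meet-shift {m} {n} {l} {k} hm hl (x , y , ≢0 , w , w′) = x + b * y , y ,
      (λ { (e , refl) → ≢0 (trans (solve 2 (λ x b → x := x :+ b :* 𝟘) refl x b) e , refl) }) ,
      from hm (subst (λ z → W n z y) back w) , from hl (subst (λ z → W k z y) back w′)
      where
      back : x ≡ x + b * y - b * y
      back = solve 3 (λ x y b → x := x :+ b :* y :- b :* y) refl x y b

  c₀≡c₁-b : ∀ {b c₀ c₁} → c₁ ≡ c₀ + b → c₀ ≡ c₁ + - b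
  c₀≡c₁-b {b} {c₀} {c₁} e = combine₁ e (- 1#) (solve 3 (λ b c c′ → c :- (c′ :+ (:- b)) := (:- 𝟙) :* (c′ :- (c :+ b))) refl b c₀ c₁)

  module _ {g h d : 𝔽} (d≢0 : d ≢ 0#) (hd̄≡dg : h * conj d ≡ d * g) (Ng≢1 : N g ≢ 1#) where

    -- Take norms in `h d̄ = d g`.
    Nh≡Ng : N h ≡ N g
    Nh≡Ng = *-cancel-≡ (*-nonzero d≢0 (conj-≢0 d≢0)) (combine₂ hd̄≡dg (conj h * d) (cong conj hd̄≡dg) (d * g)
      (solve 3 (λ g h d → d :* d ᶜ :* (h :* h ᶜ :- g :* g ᶜ) :- 𝟘
        := h ᶜ :* d :* (h :* d ᶜ :- d :* g) :+ d :* g :* ((h :* d ᶜ) ᶜ :- (d :* g) ᶜ)) refl g h d))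

    -- For `s = d r` with `r` fixed one has `h s̄ = s g`, hence `twist h (s a) = s (twist g a)`.
    Twisted≃Graph : ∀ c r → r ∈ Fix → Twisted g h c (d * r) ≃ Graph (c + d * r) 0#
    Twisted≃Graph c r hr = equiv
      (λ { (a , refl , refl) → on-graph a })
      (λ { {x} {y} refl → let a , e = twist-surjective Ng≢1 y in
        a , sym (trans (on-graph a) (cong (λ z → (c + d * r) * z + 0# * conj z) e)) , sym e })
      where
      on-graph : ∀ a → twist h (d * r * a) + c * twist g a ≡ (c + d * r) * twist g a + 0# * conj (twist g a)
      on-graph a = combine₂ hd̄≡dg (r * conj a) hr (h * conj d * conj a)
        (solve 6 (λ g h d r c a → ((d :* r :* a :+ h :* (d :* r :* a) ᶜ) :+ c :* (a :+ g :* a ᶜ))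
          :- ((c :+ d :* r) :* (a :+ g :* a ᶜ) :+ 𝟘 :* (a :+ g :* a ᶜ) ᶜ)
          := r :* a ᶜ :* (h :* d ᶜ :- d :* g) :+ h :* d ᶜ :* a ᶜ :* (r ᶜ :- r)) refl g h d r c a)

    Reg⇒Dη : ∀ {c m} → Reg c d m → Dη m
    Reg⇒Dη (inj₁ hm)            = inj₁ hm
    Reg⇒Dη (inj₂ (r , hr , hm)) = inj₂ (_ , hm)

    Reg⇒TwistedSpread : ∀ {c m} → Reg c d m → TwistedSpread g h c m
    Reg⇒TwistedSpread (inj₁ hm)                = inj₁ hm
    Reg⇒TwistedSpread {c} (inj₂ (r , hr , hm)) = inj₂ (d * r , ≃-trans hm (≃-sym (Twisted≃Graph c r hr)))

    -- Comparing coefficients with `x = M y` gives `s = M - c` and `h s̄ = s g`. Together with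
    -- `h d̄ = d g` this makes `s / d` fixed.
    Dη∩TwistedSpread⇒Reg : g ≢ 0# → ∀ {c m} → Dη m → TwistedSpread g h c m → Reg c d m
    Dη∩TwistedSpread⇒Reg g≢0 (inj₁ hm) _ = inj₁ hm
    Dη∩TwistedSpread⇒Reg g≢0 {c} {m} (inj₂ (M , hm)) (inj₁ hm′) = inj₁ hm′
    Dη∩TwistedSpread⇒Reg g≢0 {c} {m} (inj₂ (M , hm)) (inj₂ (s , hm′)) =
      inj₂ (s * j , sj-fixed , subst (λ z → W m ≃ Graph z 0#) M≡ hm)
      where
      j : 𝔽
      j = proj₁ (inverse d d≢0)
      dj≡1 : d * j ≡ 1#
      dj≡1 = proj₂ (inverse d d≢0)
      compare : s + c ≡ M × h * conj s + c * g ≡ M * g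
      compare = coefficients λ a → trans (solve 5 (λ s c g h a → (s :+ c) :* a :+ (h :* s ᶜ :+ c :* g) :* a ᶜ
          := (s :* a :+ h :* (s :* a) ᶜ) :+ c :* (a :+ g :* a ᶜ)) refl s c g h a)
        (trans (to hm (from hm′ (a , refl , refl))) (solve 3 (λ M g a → M :* (a :+ g :* a ᶜ) :+ 𝟘 :* (a :+ g :* a ᶜ) ᶜ
          := M :* a :+ M :* g :* a ᶜ) refl M g a))
      hs̄≡sg : h * conj s ≡ s * g
      hs̄≡sg = combine₂ (proj₂ compare) 1# (proj₁ compare) (- g) (solve 5 (λ s c g h M → h :* s ᶜ :- s :* g
        := 𝟙 :* ((h :* s ᶜ :+ c :* g) :- M :* g) :+ (:- g) :* ((s :+ c) :- M)) refl s c g h M)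
      g*[s̄d-sd̄]≡0 : d * g * (conj s * d - s * conj d) ≡ 0#
      g*[s̄d-sd̄]≡0 = combine₂ hd̄≡dg (- (conj s * d)) hs̄≡sg (d * conj d)
        (solve 4 (λ s d g h → d :* g :* (s ᶜ :* d :- s :* d ᶜ) :- 𝟘
          := (:- (s ᶜ :* d)) :* (h :* d ᶜ :- d :* g) :+ d :* d ᶜ :* (h :* s ᶜ :- s :* g)) refl s d g h)
      s̄d≡sd̄ : conj s * d ≡ s * conj d
      s̄d≡sd̄ = *-cancel-≡ (*-nonzero d≢0 g≢0) g*[s̄d-sd̄]≡0
      sj-fixed : s * j ∈ Fix
      sj-fixed = combine₃ s̄d≡sd̄ (j * conj j) dj≡1 (- (conj s * conj j)) (trans (cong conj dj≡1) conj-1) (s * j)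
        (solve 3 (λ s j d → (s :* j) ᶜ :- s :* j := j :* j ᶜ :* (s ᶜ :* d :- s :* d ᶜ) :+ (:- (s ᶜ :* j ᶜ)) :* (d :* j :- 𝟙)
          :+ s :* j :* ((d :* j) ᶜ :- 𝟙)) refl s j d)
      M≡ : M ≡ c + d * (s * j)
      M≡ = combine₂ (proj₁ compare) (- 1#) dj≡1 (- s) (solve 5 (λ s c d j M → M :- (c :+ d :* (s :* j))
        := (:- 𝟙) :* ((s :+ c) :- M) :+ (:- s) :* (d :* j :- 𝟙)) refl s c d j M)

  Switched : 𝔽 → 𝔽 → 𝔽 → 𝔽 → Lineη → Set
  Switched g h d c m = (TwistedSpread g h c m × ¬ Reg c d m) ⊎ Opposite (Reg c d) m

  switch⇔Switched : ∀ {S R g h d c} → S ⇔ₛ TwistedSpread g h c → R ⇔ₛ Reg c d → switch S R ⇔ₛ Switched g h d c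
  switch⇔Switched {S} {R} (equivₛ S⇒ ⇒S) (equivₛ R⇒ ⇒R) = equivₛ
    (λ m → [ (λ (m∈S , m∉R) → inj₁ (S⇒ m m∈S , λ r → m∉R (⇒R m r))) ,
      (λ o → inj₂ λ l l∈ → opposite⇒Opposite {R} {m} o l (⇒R l l∈)) ]′)
    (λ m → [ (λ (m∈S , m∉R) → inj₁ (⇒S m m∈S , λ r → m∉R (R⇒ m r))) ,
      (λ o → inj₂ (Opposite⇒opposite {R} {m} λ l l∈ → o l (R⇒ l l∈))) ]′)

  -- An elation changes only the parameter `c`. For the opposite regulus, a line of the target
  -- regulus is first translated back to the source.
  Switched-shift : ∀ {g h d b c₀ c₁ m n} → c₁ ≡ c₀ + b → W m ≃ Shifted b (W n) →
    Switched g h d c₀ n → Switched g h d c₁ m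
  Switched-shift {b = b} {c₀} {c₁} {m} {n} e hm (inj₁ (n∈ , n∉)) =
    inj₁ (Shift.TwistedSpread-shift e {m} {n} hm n∈ , λ r → n∉ (Shift.Reg-shift (c₀≡c₁-b e) {n} {m} (Shifted-inverse {b} {m} {n} hm) r))
  Switched-shift {b = b} {c₀} {c₁} {m} {n} e hm (inj₂ o) = inj₂ λ l l∈ → let k , hk = translate (- b) l in
    Shift.Meet-shift e {m} {n} {l} {k} hm
      (subst (λ z → W l ≃ Shifted z (W k)) (solve 1 (λ b → :- (:- b) := b) refl b) (Shifted-inverse { - b} {k} {l} hk))
      (o k (Shift.Reg-shift (c₀≡c₁-b e) {k} {l} hk l∈))

  -- Pencils

  InSpan : Vec 𝔽 4 → Vec 𝔽 4 → Vec 𝔽 4 → Set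
  InSpan a b v = ∃₂ λ s t → v ≡ s · a ⊕ t · b

  private
    ·-𝟎 : ∀ {n} c → c · 𝟎 {n} ≡ 𝟎
    ·-𝟎 {zero}  c = refl
    ·-𝟎 {suc n} c = cong₂ _∷_ (zeroʳ c) (·-𝟎 c)

    substitute : ∀ {n} s t a₁ a₂ b₁ b₂ (p r : Vec 𝔽 n) →
      s · (a₁ · p ⊕ a₂ · r) ⊕ t · (b₁ · p ⊕ b₂ · r) ≡ (s * a₁ + t * b₁) · p ⊕ (s * a₂ + t * b₂) · r
    substitute s t a₁ a₂ b₁ b₂ [] [] = refl
    substitute s t a₁ a₂ b₁ b₂ (x ∷ p) (y ∷ r) = cong₂ _∷_
      (solve 8 (λ s t a₁ a₂ b₁ b₂ x y → s :* (a₁ :* x :+ a₂ :* y) :+ t :* (b₁ :* x :+ b₂ :* y)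
        := (s :* a₁ :+ t :* b₁) :* x :+ (s :* a₂ :+ t :* b₂) :* y) refl s t a₁ a₂ b₁ b₂ x y) (substitute s t a₁ a₂ b₁ b₂ p r)

    ⊕-cong : ∀ {n s s′ t t′} {a b : Vec 𝔽 n} → s ≡ s′ → t ≡ t′ → s · a ⊕ t · b ≡ s′ · a ⊕ t′ · b
    ⊕-cong refl refl = refl

    first-of : ∀ {n} (a b : Vec 𝔽 n) → 1# · a ⊕ 0# · b ≡ a
    first-of [] [] = refl
    first-of (x ∷ a) (y ∷ b) = cong₂ _∷_ (solve 2 (λ x y → 𝟙 :* x :+ 𝟘 :* y := x) refl x y) (first-of a b)

    second-of : ∀ {n} (a b : Vec 𝔽 n) → 0# · a ⊕ 1# · b ≡ b
    second-of [] [] = refl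
    second-of (x ∷ a) (y ∷ b) = cong₂ _∷_ (solve 2 (λ x y → 𝟘 :* x :+ 𝟙 :* y := y) refl x y) (second-of a b)

  span-trans : ∀ {a b p r v} → InSpan p r a → InSpan p r b → InSpan a b v → InSpan p r v
  span-trans {p = p} {r} (a₁ , a₂ , refl) (b₁ , b₂ , refl) (s , t , e) = _ , _ , trans e (substitute s t a₁ a₂ b₁ b₂ p r)

  -- Cramer's rule in the coordinates with respect to `p` and `r`. If the determinant were 0, then
  -- `b₁ a - a₁ b` and `b₂ a - a₂ b` would vanish, which by independence forces `a = 0`.
  span-reverse : ∀ {a b p r} → Independent a b → InSpan p r a → InSpan p r b → ∀ {v} → InSpan p r v → InSpan a b v
  span-reverse {p = p} {r} ind (a₁ , a₂ , refl) (b₁ , b₂ , refl) (s , t , refl) =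
    (s * b₂ - t * b₁) * i , (t * a₁ - s * a₂) * i , sym (trans (substitute _ _ a₁ a₂ b₁ b₂ p r) (⊕-cong at-p at-r))
    where
    D : 𝔽
    D = a₁ * b₂ - a₂ * b₁
    combination : ∀ s t → s * a₁ + t * b₁ ≡ 0# → s * a₂ + t * b₂ ≡ 0# → s ≡ 0# × t ≡ 0#
    combination s t e e′ = ind s t (trans (substitute s t a₁ a₂ b₁ b₂ p r) (trans (⊕-cong e e′) (0·⊕0· p r)))
    D≢0 : D ≢ 0#
    D≢0 D≡0 = 1≢0 (proj₁ (combination 1# 0# (at a₁ b₁ a₁≡0) (at a₂ b₂ a₂≡0)))
      where
      first : b₁ ≡ 0# × - a₁ ≡ 0#
      first = combination b₁ (- a₁) (solve 2 (λ a b → b :* a :+ (:- a) :* b := 𝟘) refl a₁ b₁)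
        (combine₁ D≡0 (- 1#) (solve 4 (λ a₁ a₂ b₁ b₂ → (b₁ :* a₂ :+ (:- a₁) :* b₂) :- 𝟘 := (:- 𝟙) :* ((a₁ :* b₂ :- a₂ :* b₁) :- 𝟘)) refl a₁ a₂ b₁ b₂))
      second : b₂ ≡ 0# × - a₂ ≡ 0#
      second = combination b₂ (- a₂)
        (combine₁ D≡0 1# (solve 4 (λ a₁ a₂ b₁ b₂ → (b₂ :* a₁ :+ (:- a₂) :* b₁) :- 𝟘 := 𝟙 :* ((a₁ :* b₂ :- a₂ :* b₁) :- 𝟘)) refl a₁ a₂ b₁ b₂))
        (solve 2 (λ a b → b :* a :+ (:- a) :* b := 𝟘) refl a₂ b₂)
      neg≡0 : ∀ {x} → - x ≡ 0# → x ≡ 0#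
      neg≡0 {x} e = combine₁ e (- 1#) (solve 1 (λ x → x :- 𝟘 := (:- 𝟙) :* ((:- x) :- 𝟘)) refl x)
      a₁≡0 : a₁ ≡ 0#
      a₁≡0 = neg≡0 (proj₂ first)
      a₂≡0 : a₂ ≡ 0#
      a₂≡0 = neg≡0 (proj₂ second)
      at : ∀ a b → a ≡ 0# → 1# * a + 0# * b ≡ 0#
      at a b a≡0 = combine₁ a≡0 1# (solve 2 (λ a b → (𝟙 :* a :+ 𝟘 :* b) :- 𝟘 := 𝟙 :* (a :- 𝟘)) refl a b)
    i : 𝔽
    i = proj₁ (inverse D D≢0)
    Di≡1 : D * i ≡ 1#
    Di≡1 = proj₂ (inverse D D≢0)
    at-p : (s * b₂ - t * b₁) * i * a₁ + (t * a₁ - s * a₂) * i * b₁ ≡ s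
    at-p = combine₁ Di≡1 s (solve 7 (λ s t a₁ a₂ b₁ b₂ i → ((s :* b₂ :- t :* b₁) :* i :* a₁ :+ (t :* a₁ :- s :* a₂) :* i :* b₁) :- s
      := s :* ((a₁ :* b₂ :- a₂ :* b₁) :* i :- 𝟙)) refl s t a₁ a₂ b₁ b₂ i)
    at-r : (s * b₂ - t * b₁) * i * a₂ + (t * a₁ - s * a₂) * i * b₂ ≡ t
    at-r = combine₁ Di≡1 t (solve 7 (λ s t a₁ a₂ b₁ b₂ i → ((s :* b₂ :- t :* b₁) :* i :* a₂ :+ (t :* a₁ :- s :* a₂) :* i :* b₂) :- t
      := t :* ((a₁ :* b₂ :- a₂ :* b₁) :* i :- 𝟙)) refl s t a₁ a₂ b₁ b₂ i)

  spans-≐ : ∀ {a b p r} → Independent a b → InSpan p r a → InSpan p r b → ⟨ p , r ⟩ ≐ ⟨ a , b ⟩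
  spans-≐ ind ha hb = (λ {P} → span-reverse ind ha hb) , (λ {P} → span-trans ha hb)

  module Pencil {α u v : 𝔽} (α≢0 : α ≢ 0#) (Nu≡1 : N u ≡ 1#) (Nv≡1 : N v ≡ 1#) where

    e₁ : Vec 𝔽 4
    e₁ = 1# ∷ 0# ∷ α * u ∷ 0# ∷ []

    -- A second point of the line, normalised to have second coordinate 1: the image of (0, 1, 0,
    -- αv) under the elation `c`.
    e₂ : 𝔽 → Vec 𝔽 4
    e₂ c = c ∷ 1# ∷ α * v * conj c ∷ α * v ∷ []

    independent : ∀ c → Independent e₁ (e₂ c)
    independent c s t e with vec4-injective e
    ... | h₁ , h₂ , _ = combine₂ h₁ 1# h₂ (- c) (solve 3 (λ s t c → s :- 𝟘 := 𝟙 :* ((s :* 𝟙 :+ t :* c) :- 𝟘) :+ (:- c) :* ((s :* 𝟘 :+ t :* 𝟙) :- 𝟘)) refl s t c) ,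
      combine₁ h₂ 1# (solve 2 (λ s t → t :- 𝟘 := 𝟙 :* ((s :* 𝟘 :+ t :* 𝟙) :- 𝟘)) refl s t)

    line : 𝔽 → Line
    line c = record { a = e₁ ; b = e₂ c ; independent = independent c }

    private
      x₀ y₀ : 𝔽
      x₀ = proj₁ (hilbert90 Nu≡1)
      y₀ = proj₁ (hilbert90 Nv≡1)
      x₀≢0 : x₀ ≢ 0#
      x₀≢0 = proj₁ (proj₂ (hilbert90 Nu≡1))
      y₀≢0 : y₀ ≢ 0#
      y₀≢0 = proj₁ (proj₂ (hilbert90 Nv≡1))
      x̄₀ : conj x₀ ≡ u * x₀
      x̄₀ = proj₂ (proj₂ (hilbert90 Nu≡1))
      ȳ₀ : conj y₀ ≡ v * y₀
      ȳ₀ = proj₂ (proj₂ (hilbert90 Nv≡1))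

      ratio-fixed : ∀ {w z x j} → conj z ≡ w * z → conj x ≡ w * x → x * j ≡ 1# → z * j ∈ Fix
      ratio-fixed {w} {z} {x} {j} z̄ x̄ xj≡1 = combine₄ z̄ (conj j) xj≡1 (- (w * z * conj j)) x̄ (- (z * j * conj j))
        (trans (cong conj xj≡1) conj-1) (z * j)
        (solve 4 (λ w z x j → (z :* j) ᶜ :- z :* j := j ᶜ :* (z ᶜ :- w :* z) :+ (:- (w :* z :* j ᶜ)) :* (x :* j :- 𝟙)
          :+ (:- (z :* j :* j ᶜ)) :* (x ᶜ :- w :* x) :+ z :* j :* ((x :* j) ᶜ :- 𝟙)) refl w z x j)

      in-plane : ∀ {c X} → InSpan e₁ (e₂ c) (vec X) → X ∈ π⟨ α * v ⟩
      in-plane {c} {X} (s , t , e) = trans (cong (λ w → lookup w (Fin.suc (Fin.suc (Fin.suc Fin.zero)))) e)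
        (trans (solve 3 (λ s t g → s :* 𝟘 :+ t :* g := g :* (s :* 𝟘 :+ t :* 𝟙)) refl s t (α * v))
          (cong (λ w → α * v * lookup w (Fin.suc Fin.zero)) (sym e)))

      -- x₀ and y₀ are chosen so that these vectors lie on Σ_α.
      a b : 𝔽 → Vec 𝔽 4
      a c = x₀ · e₁
      b c = y₀ · e₂ c

      ab-combination : ∀ c s t → s · a c ⊕ t · b c ≡ (s * x₀) · e₁ ⊕ (t * y₀) · e₂ c
      ab-combination c s t = cong₂ _⊕_ (·-· s x₀ e₁) (·-· t y₀ (e₂ c))

      Baer-combination : ∀ c s t → s ∈ Fix → t ∈ Fix →
        (s * x₀) · e₁ ⊕ (t * y₀) · e₂ c ≡ ι′ α (s * x₀ + t * y₀ * c) (t * y₀)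
      Baer-combination c s t hs ht = vec4
        (solve 5 (λ s t x y c → s :* x :* 𝟙 :+ t :* y :* c := s :* x :+ t :* y :* c) refl s t x₀ y₀ c)
        (solve 4 (λ s t x y → s :* x :* 𝟘 :+ t :* y :* 𝟙 := t :* y) refl s t x₀ y₀)
        (combine₄ hs (- (α * conj x₀)) ht (- (α * conj y₀ * conj c)) x̄₀ (- (α * s)) ȳ₀ (- (α * t * conj c))
          (solve 8 (λ s t x y c α u v → (s :* x :* (α :* u) :+ t :* y :* (α :* v :* c ᶜ)) :- α :* (s :* x :+ t :* y :* c) ᶜ
            := (:- (α :* x ᶜ)) :* (s ᶜ :- s) :+ (:- (α :* y ᶜ :* c ᶜ)) :* (t ᶜ :- t) :+ (:- (α :* s)) :* (x ᶜ :- u :* x)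
              :+ (:- (α :* t :* c ᶜ)) :* (y ᶜ :- v :* y)) refl s t x₀ y₀ c α u v))
        (combine₂ ht (- (α * conj y₀)) ȳ₀ (- (α * t))
          (solve 6 (λ s t x y α v → (s :* x :* 𝟘 :+ t :* y :* (α :* v)) :- α :* (t :* y) ᶜ
            := (:- (α :* y ᶜ)) :* (t ᶜ :- t) :+ (:- (α :* t)) :* (y ᶜ :- v :* y)) refl s t x₀ y₀ α v))

      Baer-coordinates : ∀ X → X ∈ Baer α → ∃₂ λ x y → ∃ λ k → k ≢ 0# × vec X ≡ k · ι′ α x y
      Baer-coordinates X ((x ∷ y ∷ []) , k , e) = x , y , k ,
        (λ k≡0 → nonzero X (trans e (trans (cong (_· ι α (x ∷ y ∷ [])) k≡0) (0· ι α (x ∷ y ∷ []))))) , trans e (cong (k ·_) (ι≡ι′ α x y))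

    -- A point of Σ_α on the line, with coordinates x and y, satisfies `ȳ = v y` and, for
    -- `z = x - y c`, `z̄ = u z`. So `y / y₀` and `z / x₀` are fixed, and these are its coordinates
    -- in the subline.
    baer-subline : ∀ c → IsBaerSubline (on (line c) ∩ (π⟨ α * v ⟩ ∩ Baer α))
    baer-subline c = a c , b c , ab-independent ,
      (λ {X} → forth X) , (λ {X} → back X)
      where
      j₁ j₂ : 𝔽
      j₁ = proj₁ (inverse x₀ x₀≢0)
      j₂ = proj₁ (inverse y₀ y₀≢0)
      x₀j₁≡1 : x₀ * j₁ ≡ 1#
      x₀j₁≡1 = proj₂ (inverse x₀ x₀≢0)
      y₀j₂≡1 : y₀ * j₂ ≡ 1#
      y₀j₂≡1 = proj₂ (inverse y₀ y₀≢0)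
      ab-independent : Independent (a c) (b c)
      ab-independent s t e = let sx≡0 , ty≡0 = independent c (s * x₀) (t * y₀) (trans (sym (ab-combination c s t)) e) in
        *-cancel-0 x₀≢0 (trans (*-comm x₀ s) sx≡0) , *-cancel-0 y₀≢0 (trans (*-comm y₀ t) ty≡0)
      forth : ∀ X → X ∈ on (line c) ∩ (π⟨ α * v ⟩ ∩ Baer α) → ∃₂ λ s t → s ∈ 𝔽q × t ∈ 𝔽q × X ∼ s · a c ⊕ t · b c
      forth X ((s , t , e) , _ , X∈Baer) with Baer-coordinates X X∈Baer
      ... | x , y , k , k≢0 , e′ with vec4-injective (trans (sym e) e′)
      ...   | h₁ , h₂ , h₃ , h₄ = z * j₁ , y * j₂ , Fix⇒𝔽q (ratio-fixed z̄ x̄₀ x₀j₁≡1) , Fix⇒𝔽q (ratio-fixed ȳ ȳ₀ y₀j₂≡1) , k ,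
          trans e (sym (trans (cong (k ·_) (ab-combination c (z * j₁) (y * j₂)))
            (trans (·-combination k _ _ e₁ (e₂ c)) (⊕-cong at-s at-t))))
        where
        z : 𝔽
        z = x - y * c
        ky≡t : k * y ≡ t
        ky≡t = combine₁ h₂ (- 1#) (solve 4 (λ s t k y → k :* y :- t := (:- 𝟙) :* ((s :* 𝟘 :+ t :* 𝟙) :- k :* y)) refl s t k y)
        kx≡ : k * x ≡ s + t * c
        kx≡ = combine₁ h₁ (- 1#) (solve 5 (λ s t k x c → k :* x :- (s :+ t :* c) := (:- 𝟙) :* ((s :* 𝟙 :+ t :* c) :- k :* x)) refl s t k x c)
        kz≡s : k * z ≡ s
        kz≡s = combine₂ kx≡ 1# ky≡t (- c) (solve 6 (λ k x y c s t → k :* (x :- y :* c) :- s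
          := 𝟙 :* (k :* x :- (s :+ t :* c)) :+ (:- c) :* (k :* y :- t)) refl k x y c s t)
        ȳ : conj y ≡ v * y
        ȳ = *-cancel-≡ (*-nonzero k≢0 α≢0) (combine₂ h₄ (- 1#) ky≡t (- (α * v)) (solve 6 (λ s t k y α v → k :* α :* (y ᶜ :- v :* y) :- 𝟘
          := (:- 𝟙) :* ((s :* 𝟘 :+ t :* (α :* v)) :- k :* (α :* y ᶜ)) :+ (:- (α :* v)) :* (k :* y :- t)) refl s t k y α v))
        z̄ : conj z ≡ u * z
        z̄ = *-cancel-≡ (*-nonzero k≢0 α≢0) (combine₄ h₃ (- 1#) kz≡s (- (α * u)) ky≡t (- (α * v * conj c)) ȳ (- (k * α * conj c))
          (solve 9 (λ s t k x y c α u v → k :* α :* ((x :- y :* c) ᶜ :- u :* (x :- y :* c)) :- 𝟘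
            := (:- 𝟙) :* ((s :* (α :* u) :+ t :* (α :* v :* c ᶜ)) :- k :* (α :* x ᶜ)) :+ (:- (α :* u)) :* (k :* (x :- y :* c) :- s)
              :+ (:- (α :* v :* c ᶜ)) :* (k :* y :- t) :+ (:- (k :* α :* c ᶜ)) :* (y ᶜ :- v :* y)) refl s t k x y c α u v))
        at-s : k * (z * j₁ * x₀) ≡ s
        at-s = combine₂ kz≡s 1# x₀j₁≡1 (k * z) (solve 5 (λ k z j x s → k :* (z :* j :* x) :- s
          := 𝟙 :* (k :* z :- s) :+ k :* z :* (x :* j :- 𝟙)) refl k z j₁ x₀ s)
        at-t : k * (y * j₂ * y₀) ≡ t
        at-t = combine₂ ky≡t 1# y₀j₂≡1 (k * y) (solve 5 (λ k z j x s → k :* (z :* j :* x) :- s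
          := 𝟙 :* (k :* z :- s) :+ k :* z :* (x :* j :- 𝟙)) refl k y j₂ y₀ t)
      back : ∀ X → (∃₂ λ s t → s ∈ 𝔽q × t ∈ 𝔽q × X ∼ s · a c ⊕ t · b c) → X ∈ on (line c) ∩ (π⟨ α * v ⟩ ∩ Baer α)
      back X (s , t , hs , ht , k , e) = X∈ , in-plane {c} {X} X∈ ,
        ((s * x₀ + t * y₀ * c) ∷ (t * y₀) ∷ []) , k , trans e (cong (k ·_) (trans (ab-combination c s t)
          (trans (Baer-combination c s t (𝔽q⇒Fix hs) (𝔽q⇒Fix ht)) (sym (ι≡ι′ α (s * x₀ + t * y₀ * c) (t * y₀))))))
        where
        X∈ : InSpan e₁ (e₂ c) (vec X)
        X∈ = _ , _ , trans e (trans (cong (k ·_) (ab-combination c s t)) (·-combination k (s * x₀) (t * y₀) e₁ (e₂ c)))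

    line∈pencil : ∀ c → line c ∈ pencil α u v
    line∈pencil c = (λ {X} → in-plane {c} {X}) , (1# , 0# , sym (first-of e₁ (e₂ c))) , baer-subline c

    line≢r : ∀ c → ¬ (on (line c) ≐ r-U₁)
    line≢r c (⊆r , _) with ⊆r {point (e₂ c) (1≢0 ∘ cong (Vec.head ∘ Vec.tail))} (0# , 1# , sym (second-of e₁ (e₂ c)))
    ... | s , t , e = 1≢0 (trans (proj₁ (proj₂ (vec4-injective e))) (solve 2 (λ s t → s :* 𝟘 :+ t :* 𝟘 := 𝟘) refl s t))

    -- The Baer subline supplies two points `p` and `r` that span the line. If both lay on `r-U₁`,
    -- the line would be `r-U₁`. Otherwise one of them is proportional to some `e₂ c` and spans the
    -- line together with the vertex.
    pencil-form : ∀ ℓ → ℓ ∈ pencil α u v → ¬ (on ℓ ≐ r-U₁) → ∃ λ c → on ℓ ≐ ⟨ e₁ , e₂ c ⟩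
    pencil-form ℓ (_ , P∈ℓ , p , r , ind , _ , ⊇) ℓ≢r =
      decide (locate p-point (proj₂ p∈)) (locate r-point (proj₂ r∈))
      where
      p≢0 : p ≢ 𝟎
      p≢0 p≡0 = 1≢0 (proj₁ (ind 1# 0# (trans (first-of p r) p≡0)))
      r≢0 : r ≢ 𝟎
      r≢0 r≡0 = 1≢0 (proj₂ (ind 0# 1# (trans (second-of p r) r≡0)))
      p-point r-point : Point
      p-point = point p p≢0
      r-point = point r r≢0
      p∈ : p-point ∈ on ℓ ∩ (π⟨ α * v ⟩ ∩ Baer α)
      p∈ = ⊇ {p-point} (1# , 0# , Fix⇒𝔽q Fix-1 , Fix⇒𝔽q Fix-0 , 1# , trans (sym (first-of p r)) (sym (1· _)))
      r∈ : r-point ∈ on ℓ ∩ (π⟨ α * v ⟩ ∩ Baer α)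
      r∈ = ⊇ {r-point} (0# , 1# , Fix⇒𝔽q Fix-0 , Fix⇒𝔽q Fix-1 , 1# , trans (sym (second-of p r)) (sym (1· _)))

      locate : ∀ X → X ∈ (π⟨ α * v ⟩ ∩ Baer α) → InSpan U₁ U₃ (vec X) ⊎ ∃ λ c → ∃₂ λ k l → l * k ≡ 1# × vec X ≡ k · e₂ c
      locate X (X∈π , X∈Baer) with Baer-coordinates X X∈Baer
      ... | x , y , k , k≢0 , e with y ≟ 0#
      ...   | yes y≡0 = inj₁ (k * x , k * (α * conj x) , trans e (trans (cong (λ z → k · ι′ α x z) y≡0) (vec4
              (solve 3 (λ k x z → k :* x := k :* x :* 𝟙 :+ k :* z :* 𝟘) refl k x (α * conj x))
              (solve 3 (λ k x z → k :* 𝟘 := k :* x :* 𝟘 :+ k :* z :* 𝟘) refl k x (α * conj x))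
              (solve 3 (λ k x z → k :* z := k :* x :* 𝟘 :+ k :* z :* 𝟙) refl k x (α * conj x))
              (solve 4 (λ k x z α → k :* (α :* 𝟘 ᶜ) := k :* x :* 𝟘 :+ k :* z :* 𝟘) refl k x (α * conj x) α))))
      ...   | no y≢0 = inj₂ (x * i , k * y , proj₁ (inverse (k * y) ky≢0) , trans (*-comm _ _) (proj₂ (inverse (k * y) ky≢0)) , trans e (vec4
              (combine₁ yi≡1 (- (k * x)) (solve 4 (λ k x y i → k :* x :- k :* y :* (x :* i) := (:- (k :* x)) :* (y :* i :- 𝟙)) refl k x y i))
              (sym (*-identityʳ (k * y)))
              (combine₂ ȳ (- (k * α * conj (x * i))) ȳī≡1 (- (k * α * conj x)) (solve 6 (λ k x y i α v → k :* (α :* x ᶜ) :- k :* y :* (α :* v :* (x :* i) ᶜ)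
                := (:- (k :* α :* (x :* i) ᶜ)) :* (v :* y :- y ᶜ) :+ (:- (k :* α :* x ᶜ)) :* ((y :* i) ᶜ :- 𝟙)) refl k x y i α v))
              (combine₁ ȳ (- (k * α)) (solve 4 (λ k y α v → k :* (α :* y ᶜ) :- k :* y :* (α :* v) := (:- (k :* α)) :* (v :* y :- y ᶜ)) refl k y α v))))
        where
        ky≢0 : k * y ≢ 0#
        ky≢0 = *-nonzero k≢0 y≢0
        i : 𝔽
        i = proj₁ (inverse y y≢0)
        yi≡1 : y * i ≡ 1#
        yi≡1 = proj₂ (inverse y y≢0)
        ȳī≡1 : conj (y * i) ≡ 1#
        ȳī≡1 = trans (cong conj yi≡1) conj-1
        in-π : k * (α * conj y) ≡ α * v * (k * y)
        in-π = trans (cong (λ w → lookup w (Fin.suc (Fin.suc (Fin.suc Fin.zero)))) (sym e)) (trans X∈π (cong (λ w → α * v * lookup w (Fin.suc Fin.zero)) e))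
        ȳ : v * y ≡ conj y
        ȳ = *-cancel-≡ (*-nonzero k≢0 α≢0) (combine₁ in-π (- 1#) (solve 4 (λ k y α v → k :* α :* (v :* y :- y ᶜ) :- 𝟘
          := (:- 𝟙) :* (k :* (α :* y ᶜ) :- α :* v :* (k :* y))) refl k y α v))

      through : ∀ {w c k l} → InSpan (Line.a ℓ) (Line.b ℓ) w → l * k ≡ 1# → w ≡ k · e₂ c → ∃ λ c → on ℓ ≐ ⟨ e₁ , e₂ c ⟩
      through {w} {c} {k} {l} (s , t , e) lk≡1 w≡ = c , spans-≐ (independent c) P∈ℓ (l * s , l * t , (begin
        e₂ c               ≡⟨ 1· e₂ c ⟨
        1# · e₂ c          ≡⟨ cong (_· e₂ c) lk≡1 ⟨
        (l * k) · e₂ c     ≡⟨ ·-· l k (e₂ c) ⟨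
        l · (k · e₂ c)     ≡⟨ cong (l ·_) (trans (sym w≡) e) ⟩
        l · (s · Line.a ℓ ⊕ t · Line.b ℓ) ≡⟨ ·-combination l s t (Line.a ℓ) (Line.b ℓ) ⟩
        (l * s) · Line.a ℓ ⊕ (l * t) · Line.b ℓ ∎))
        where open ≡-Reasoning

      Located : Vec 𝔽 4 → Set
      Located w = InSpan U₁ U₃ w ⊎ ∃ λ c → ∃₂ λ k l → l * k ≡ 1# × w ≡ k · e₂ c

      decide : Located p → Located r → ∃ λ c → on ℓ ≐ ⟨ e₁ , e₂ c ⟩
      decide (inj₂ (c , k , l , lk≡1 , e)) _ = through (proj₁ p∈) lk≡1 e
      decide (inj₁ _) (inj₂ (c , k , l , lk≡1 , e)) = through (proj₁ r∈) lk≡1 e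
      decide (inj₁ hp) (inj₁ hr) = contradiction
        ((λ {X} X∈ → span-trans hp hr (span-reverse ind (proj₁ p∈) (proj₁ r∈) X∈)) ,
         (λ {X} X∈ → span-trans (proj₁ p∈) (proj₁ r∈) (span-reverse ind hp hr X∈))) ℓ≢r

  -- Hall parallelisms

  private
    N-norms : Injective _≡_ _≡_ (N ∘ Λ)
    N-norms {i} {j} e = Λ-norms (trans (norm≡ (Λ i)) (trans e (sym (norm≡ (Λ j)))))

  open NormTransversal Λ Λ-nonzero N-norms public

  ⇔ₛ⇒≐ : ∀ {P Q : LineSet} → P ⇔ₛ Q → P ≐ Q
  ⇔ₛ⇒≐ h = (λ {m} → into h m) , (λ {m} → outof h m)

  ≐⇒⇔ₛ : ∀ {P Q : LineSet} → P ≐ Q → P ⇔ₛ Q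
  ≐⇒⇔ₛ (f , g) = equivₛ (λ m → f {m}) (λ m → g {m})

  -- The coefficients of the graphs are `d (e + f r)`, and `e + f r` runs through the fixed field
  -- with `r`.
  Reg-reparametrise : ∀ {c d d′ e f} → e ∈ Fix → f ∈ Fix → d′ ≢ 0# → c ≡ d * e → d′ ≡ d * f → Reg c d′ ⇔ₛ Reg 0# d
  Reg-reparametrise {c} {d} {d′} {e} {f} he hf d′≢0 refl refl = equivₛ
    (λ m → [ inj₁ , (λ (r , hr , h) → inj₂ (e + f * r , Fix-+ he (Fix-* hf hr) , subst (λ z → W m ≃ Graph z 0#)
      (solve 4 (λ d e f r → d :* e :+ d :* f :* r := 𝟘 :+ d :* (e :+ f :* r)) refl d e f r) h)) ]′)
    (λ m → [ inj₁ , (λ (r , hr , h) → inj₂ ((r - e) * i , Fix-* (Fix-+ hr (Fix-neg he)) (Fix-inverse fi≡1 hf) , subst (λ z → W m ≃ Graph z 0#)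
      (combine₁ fi≡1 (- (d * (r - e))) (solve 5 (λ d e f r i → (𝟘 :+ d :* r) :- (d :* e :+ d :* f :* ((r :- e) :* i))
        := (:- (d :* (r :- e))) :* (f :* i :- 𝟙)) refl d e f r i)) h)) ]′)
    where
    f≢0 : f ≢ 0#
    f≢0 f≡0 = d′≢0 (trans (cong (d *_) f≡0) (zeroʳ d))
    i : 𝔽
    i = proj₁ (inverse f f≢0)
    fi≡1 : f * i ≡ 1#
    fi≡1 = proj₂ (inverse f f≢0)

  module _ {g h d : 𝔽} (d≢0 : d ≢ 0#) (hd̄≡dg : h * conj d ≡ d * g) (Ng≢1 : N g ≢ 1#) where

    private
      t : 𝔽
      t = proj₁ (inverse (1# - N g) (neg-≢0 (≢-sym Ng≢1)))
      [1-Ng]t≡1 : (1# - N g) * t ≡ 1#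
      [1-Ng]t≡1 = proj₂ (inverse (1# - N g) (neg-≢0 (≢-sym Ng≢1)))
      t-fixed : t ∈ Fix
      t-fixed = Fix-inverse [1-Ng]t≡1 (Fix-1-N g)
      t≢0 : t ≢ 0#
      t≢0 t≡0 = 1≢0 (trans (sym [1-Ng]t≡1) (trans (cong ((1# - N g) *_) t≡0) (zeroʳ _)))

    -- They solve `s a + h s̄ ā = M y + L ȳ` for `y = twist g a`: comparing coefficients of `a` and
    -- `ā` gives `M + ḡ L = s` and `g M + L = h s̄`, with determinant `1 - N g`.
    Mᵗ Lᵗ : 𝔽 → 𝔽
    Mᵗ s = (s - h * conj g * conj s) * t
    Lᵗ s = (h * conj s - g * s) * t

    Twisted≃Graph-ML : ∀ c s → Twisted g h c s ≃ Graph (c + Mᵗ s) (Lᵗ s)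
    Twisted≃Graph-ML c s = equiv
      (λ { (a , refl , refl) → on-graph a })
      (λ { {x} {y} refl → let a , e = twist-surjective Ng≢1 y in
        a , sym (trans (on-graph a) (cong (λ z → (c + Mᵗ s) * z + Lᵗ s * conj z) e)) , sym e })
      where
      on-graph : ∀ a → twist h (s * a) + c * twist g a ≡ (c + Mᵗ s) * twist g a + Lᵗ s * conj (twist g a)
      on-graph a = combine₁ [1-Ng]t≡1 (- twist h (s * a)) (solve 6 (λ g h s c t a →
        ((s :* a :+ h :* (s :* a) ᶜ) :+ c :* (a :+ g :* a ᶜ))
          :- ((c :+ (s :- h :* g ᶜ :* s ᶜ) :* t) :* (a :+ g :* a ᶜ) :+ (h :* s ᶜ :- g :* s) :* t :* (a :+ g :* a ᶜ) ᶜ)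
        := (:- (s :* a :+ h :* (s :* a) ᶜ)) :* ((𝟙 :- g :* g ᶜ) :* t :- 𝟙)) refl g h s c t a)

    -- The equation involves only `g` and `h`, so it confines all values of `Lᵗ` to one line over
    -- the fixed field. It rests on `N h = N g`.
    Lᵗ-conj : ∀ s → h * conj (Lᵗ s) ≡ - (conj g * Lᵗ s)
    Lᵗ-conj s = combine₂ t-fixed (h * conj (h * conj s - g * s)) (Nh≡Ng d≢0 hd̄≡dg Ng≢1) (s * t)
      (solve 4 (λ g h s t → h :* ((h :* s ᶜ :- g :* s) :* t) ᶜ :- (:- (g ᶜ :* ((h :* s ᶜ :- g :* s) :* t)))
        := h :* (h :* s ᶜ :- g :* s) ᶜ :* (t ᶜ :- t) :+ s :* t :* (h :* h ᶜ :- g :* g ᶜ)) refl g h s t)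

    Lᵗ-scale : ∀ {r} s → r ∈ Fix → Lᵗ (r * s) ≡ r * Lᵗ s
    Lᵗ-scale {r} s hr = combine₁ hr (h * conj s * t) (solve 5 (λ g h s t r → (h :* (r :* s) ᶜ :- g :* (r :* s)) :* t :- r :* ((h :* s ᶜ :- g :* s) :* t)
      := h :* s ᶜ :* t :* (r ᶜ :- r)) refl g h s t r)

    Lᵗ≢0 : g ≢ 0# → ∃ λ s → Lᵗ s ≢ 0#
    Lᵗ≢0 g≢0 with (h * conj 1# - g * 1#) ≟ 0#
    ... | no ≢0 = 1# , *-nonzero ≢0 t≢0
    ... | yes e = ω , *-nonzero (λ e′ → *-nonzero g≢0 ω̄-ω≢0 (combine₂ e′ 1# e (- conj ω)
        (solve 3 (λ g h w → g :* (w ᶜ :- w) :- 𝟘 := 𝟙 :* ((h :* w ᶜ :- g :* w) :- 𝟘) :+ (:- (w ᶜ)) :* ((h :* 𝟙 ᶜ :- g :* 𝟙) :- 𝟘)) refl g h ω))) t≢0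

    TwistedSpread≄Chord : ∀ {c m k x₀ y₀} → k ≢ 0# → y₀ ≢ 0# → TwistedSpread g h c m → W m ≃ Chord k x₀ y₀ → ⊥
    TwistedSpread≄Chord {c} {m} k≢0 y₀≢0 (inj₁ hm)       hm′ = Infinity≄Chord {m} y₀≢0 hm hm′
    TwistedSpread≄Chord {c} {m} k≢0 y₀≢0 (inj₂ (s , hm)) hm′ = Graph≄Chord {m} k≢0 (≃-trans hm (Twisted≃Graph-ML c s)) hm′

  -- The members of a parallelism invariant under E

  module Classification (Π : Pred LineSet 0ℓ) (hall-parallelism : IsHallParallelism Π) (E-inv : E-invariant Π) where
    open IsHallParallelism hall-parallelism
    open IsParallelism isParallelism

    𝒟η∈Π : Π 𝒟η
    𝒟η∈Π = proj₂ members {𝒟η} (inj₁ (id , id))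

    -- The member of `Π` through the chord `m` spanned by (d, 0) and (0, 1), in normal form. As `m`
    -- is opposite to `Reg 0 d`, the switched regulus is the one with `c = 0` and direction `d`.
    record HallData (d : 𝔽) : Set₁ where
      field
        T    : LineSet
        T∈Π  : Π T
        m    : Lineη
        hm   : W m ≃ Chord d 0# 1#
        m∈T  : T m
        g h  : 𝔽
        d≢0  : d ≢ 0#
        g≢0  : g ≢ 0#
        hd̄≡dg : h * conj d ≡ d * g
        Ng≢1 : N g ≢ 1#
        admissible : Admissible (N g)
        T⇔   : T ⇔ₛ Switched g h d 0#

    private
      module HallSpreadData {d : 𝔽} (d≢0 : d ≢ 0#) {T : LineSet} (T∈Π : Π T) {m : Lineη} (hm : W m ≃ Chord d 0# 1#) (m∈T : T m)
        {S R : LineSet} (R-reg : IsRegulusThroughR R) (D : IsDesarguesian S) (R⊆S : R ⊆ S) (T≐ : T ≐ switch S R) where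

        m∞ m₀ m₁ : Lineη
        m∞ = proj₁ infinity-line
        m₀ = proj₁ (graph-line 0# 0#)
        m₁ = proj₁ (graph-line d 0#)

        h∞ : W m∞ ≃ Infinity
        h∞ = proj₂ infinity-line

        opaque
          -- The chord `m` lies in the opposite of `R`, a regulus with some parameters `c` and `d′`.
          -- By `Opposite-chord` both are fixed multiples of `d`.
          R⇔ : R ⇔ₛ Reg 0# d
          R⇔ = let c , d′ , d′≢0 , R⇒ , ⇒R = regulus-form R-reg in reparametrise d′≢0 R⇒ ⇒R
            where
            reparametrise : ∀ {c d′} → d′ ≢ 0# → (∀ m → R m → Reg c d′ m) → (∀ m → Reg c d′ m → R m) → R ⇔ₛ Reg 0# d
            reparametrise {c} {d′} d′≢0 R⇒ ⇒R = finish (Opposite-chord {c} {d′} {m} hm (λ l l∈ → opposite⇒Opposite {R} {m} opp l (⇒R l l∈)))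
              where
              opp : opposite R m
              opp = switch-chord {S} {R} {T} {m} {m∞} (IsDesarguesian.isSpread D) T≐ (R⊆S {m∞} (⇒R m∞ (inj₁ h∞))) h∞ d≢0 1≢0 hm m∈T
              finish : (∃₂ λ e f → e ∈ Fix × f ∈ Fix × c * 1# ≡ 0# + d * e × d′ * 1# ≡ d * f) → R ⇔ₛ Reg 0# d
              finish (e , f , he , hf , ec , ed) = ⇔ₛ-trans (equivₛ R⇒ ⇒R) (Reg-reparametrise he hf d′≢0
                (trans (sym (*-identityʳ c)) (trans ec (+-identityˡ _))) (trans (sym (*-identityʳ d′)) ed))

        in-R : ∀ {n M} r → r ∈ Fix → W n ≃ Graph M 0# → M ≡ 0# + d * r → R n
        in-R {n} r hr hn refl = outof R⇔ n (inj₂ (r , hr , hn))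

        opaque
          -- Otherwise `T` would contain `x = d ω y`, which is outside `R` because `ω` is not fixed.
          -- This is also a line of `𝒟η`, so `T` would equal `𝒟η`, although it contains the chord
          -- `m`.
          no-graphs : ¬ ContainsGraphs S
          no-graphs graphs = chord∉Dη {m} d≢0 1≢0 hm (proj₁ (unique n T 𝒟η T∈Π 𝒟η∈Π n∈T (Dη⇒𝒟η {n} (inj₂ (_ , hn)))) {m} m∈T)
            where
            n : Lineη
            n = proj₁ (graph-line (d * ω) 0#)
            hn : W n ≃ Graph (d * ω) 0#
            hn = proj₂ (graph-line (d * ω) 0#)
            n∉R : ¬ R n
            n∉R n∈R with into R⇔ n n∈R
            ... | inj₁ h = Infinity≄Graph {n} h hn
            ... | inj₂ (r , hr , h) = ω∉Fix (subst (_∈ Fix) (sym (*-cancelˡ d≢0 (trans (proj₁ (Graph-injective {n} hn h)) (+-identityˡ _)))) hr)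
            n∈T : T n
            n∈T = proj₂ T≐ {n} (inj₁ (graphs (d * ω) n hn , n∉R))

        opaque
          hall-data-from : NormalForm d S → HallData d
          hall-data-from nf = record
            { T = T ; T∈Π = T∈Π ; m = m ; hm = hm ; m∈T = m∈T ; g = g ; h = d * g * conj j ; d≢0 = d≢0 ; g≢0 = g≢0
            ; hd̄≡dg = hd̄≡dg ; Ng≢1 = Ng≢1 ; admissible = admissible
            ; T⇔ = ⇔ₛ-trans (≐⇒⇔ₛ T≐) (switch⇔Switched
                (⇔ₛ-trans form (ConjugateSpread⇔TwistedSpread d≢0 hd̄≡dg)) R⇔)
            }
            where
            open NormalForm nf
            j : 𝔽
            j = proj₁ (inverse d d≢0)
            hd̄≡dg : d * g * conj j * conj d ≡ d * g
            hd̄≡dg = combine₁ (trans (cong conj (proj₂ (inverse d d≢0))) conj-1) (d * g)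
              (solve 3 (λ d g j → d :* g :* j ᶜ :* d ᶜ :- d :* g := d :* g :* ((d :* j) ᶜ :- 𝟙)) refl d g j)

        result : HallData d
        result = conclude (conjugate-form D d≢0 {m∞} {m₀} {m₁} h∞ (proj₂ (graph-line 0# 0#)) (proj₂ (graph-line d 0#))
            (R⊆S {m∞} (outof R⇔ m∞ (inj₁ h∞)))
            (R⊆S {m₀} (in-R {m₀} 0# Fix-0 (proj₂ (graph-line 0# 0#)) (solve 1 (λ d → 𝟘 := 𝟘 :+ d :* 𝟘) refl d)))
            (R⊆S {m₁} (in-R {m₁} 1# Fix-1 (proj₂ (graph-line d 0#)) (solve 1 (λ d → d := 𝟘 :+ d :* 𝟙) refl d))))
          where
          conclude : (∃₂ λ i j → N i ≢ N j × S ⇔ₛ ConjugateSpread i j d) → HallData d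
          conclude (i , j , N≢ , S⇔) = [ (λ graphs → contradiction graphs no-graphs) , hall-data-from ]′ (normal-form d≢0 {S} N≢ S⇔)

    ≐-hall : ∀ {T : LineSet} {i} → T ≐ hall i → ∃₂ λ S R → IsRegulusThroughR R × IsDesarguesian S × R ⊆ S × T ≐ switch S R
    ≐-hall {T} {i} (f , g) = let R , R-reg , S , D , R⊆S , (f′ , g′) = hall-spread i in
      S , R , R-reg , D , R⊆S , (λ {m} t → f′ {m} (f {m} t)) , (λ {m} s → g {m} (g′ {m} s))

    opaque
      -- The search starts from a line instead of a regulus: some member of `Π` covers the chord,
      -- and it is a Hall spread because `𝒟η` contains no chords.
      hall-data : ∀ {d} → d ≢ 0# → HallData d
      hall-data {d} d≢0 = go (chord-line 0# d≢0 1≢0)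
        where
        go : (∃ λ m → W m ≃ Chord d 0# 1#) → HallData d
        go (m , hm) = from-cover (covers m)
          where
          classify : ∀ {T} → Π T → T m → (T ≐ 𝒟η ⊎ ∃ λ i → T ≐ hall i) → HallData d
          classify T∈Π m∈T (inj₁ T≐𝒟η) = contradiction (proj₁ T≐𝒟η {m} m∈T) (chord∉Dη {m} d≢0 1≢0 hm)
          classify {T} T∈Π m∈T (inj₂ (i , T≐hall)) = let S , R , R-reg , D , R⊆S , T≐ = ≐-hall {T} {i} T≐hall in
            HallSpreadData.result d≢0 {T} T∈Π {m} hm m∈T {S} {R} R-reg D (λ {n} → R⊆S {n}) T≐
          from-cover : (∃ λ T → Π T × T m) → HallData d
          from-cover (T , T∈Π , m∈T) = classify {T} T∈Π m∈T (proj₁ members {T} T∈Π)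

    module _ {d : 𝔽} (D : HallData d) where
      open HallData D

      image-form : ∀ b → image b T ⇔ₛ Switched g h d b
      image-form b = equivₛ forth back
        where
        forth : ∀ n → image b T n → Switched g h d b n
        forth n n∈ = let l , l∈T , hn = image⇒ b T n n∈ in
          Switched-shift {m = n} {l} (sym (+-identityˡ b)) hn (into T⇔ l l∈T)
        back : ∀ n → Switched g h d b n → image b T n
        back n n∈ = let l , hl = translate (- b) n in
          ⇒image b T n l (outof T⇔ l (Switched-shift {m = l} {n} (sym (-‿inverseʳ b)) hl n∈))
            (subst (λ z → W n ≃ Shifted z (W l)) (solve 1 (λ b → :- (:- b) := b) refl b) (Shifted-inverse { - b} {l} {n} hl))

      Nh≡ : N h ≡ N g
      Nh≡ = Nh≡Ng d≢0 hd̄≡dg Ng≢1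

      h≢0 : h ≢ 0#
      h≢0 h≡0 = *-nonzero g≢0 (conj-≢0 g≢0) (trans (sym Nh≡) (trans (cong (_* conj h) h≡0) (zeroˡ (conj h))))

      Nh≢1 : N h ≢ 1#
      Nh≢1 e = Ng≢1 (trans (sym Nh≡) e)

    module _ {d d′ : 𝔽} (D : HallData d) (D′ : HallData d′) where
      private
        module D = HallData D
        module D′ = HallData D′

      -- The quotient `h / g` equals `d / d̄`, which determines `d` up to a fixed factor.
      h*g-distinct : wedge d d′ ≢ 0# → D.h * D′.g ≢ D.g * D′.h
      h*g-distinct w≢0 e = w≢0 (*-cancel-0 (*-nonzero D.g≢0 D′.g≢0) (combine₃ D.hd̄≡dg (- (conj d′ * D′.g)) D′.hd̄≡dg (conj d * D.g) e (conj d * conj d′)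
        (solve 6 (λ g h d g′ h′ d′ → g :* g′ :* (d :* d′ ᶜ :- d ᶜ :* d′) :- 𝟘
          := (:- (d′ ᶜ :* g′)) :* (h :* d ᶜ :- d :* g) :+ d ᶜ :* g :* (h′ :* d′ ᶜ :- d′ :* g′) :+ d ᶜ :* d′ ᶜ :* (h :* g′ :- g :* h′))
          refl D.g D.h d D′.g D′.h d′)))

      -- If h ḡ′ = ḡ h′ then the nonzero x^q-coefficients of the two spread sets lie in
      -- a common 𝔽q-line, so a translate of T has a line with graph coefficient
      -- in common with T′.
      hḡ-distinct : wedge d d′ ≢ 0# → D.h * conj D′.g ≢ conj D.g * D′.h
      hḡ-distinct w≢0 e = w≢0 (trans (cong₂ (λ u v → d * u - conj d * v) (cong conj d′≡) d′≡)
          (combine₁ hf (d * conj d) (solve 2 (λ d f → (d :* (d :* f) ᶜ :- d ᶜ :* (d :* f)) :- 𝟘 := d :* d ᶜ :* (f ᶜ :- f)) refl d f)))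
        where
        M L M′ L′ : 𝔽 → 𝔽
        M  = Mᵗ D.d≢0 D.hd̄≡dg D.Ng≢1
        L  = Lᵗ D.d≢0 D.hd̄≡dg D.Ng≢1
        M′ = Mᵗ D′.d≢0 D′.hd̄≡dg D′.Ng≢1
        L′ = Lᵗ D′.d≢0 D′.hd̄≡dg D′.Ng≢1
        s₀ s′ : 𝔽
        s₀ = proj₁ (Lᵗ≢0 D.d≢0 D.hd̄≡dg D.Ng≢1 D.g≢0)
        s′ = proj₁ (Lᵗ≢0 D′.d≢0 D′.hd̄≡dg D′.Ng≢1 D′.g≢0)
        L≢0 : L s₀ ≢ 0#
        L≢0 = proj₂ (Lᵗ≢0 D.d≢0 D.hd̄≡dg D.Ng≢1 D.g≢0)
        L′≢0 : L′ s′ ≢ 0#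
        L′≢0 = proj₂ (Lᵗ≢0 D′.d≢0 D′.hd̄≡dg D′.Ng≢1 D′.g≢0)
        parallel-wedge : ∀ {l l′} → D.h * conj l ≡ - (conj D.g * l) → D′.h * conj l′ ≡ - (conj D′.g * l′) → D.h * D′.h * wedge l l′ ≡ 0#
        parallel-wedge {l} {l′} el el′ = combine₃ el (- (D′.h * l′)) el′ (D.h * l) e (- (l * l′))
          (solve 6 (λ g h l g′ h′ l′ → h :* h′ :* (l :* l′ ᶜ :- l ᶜ :* l′) :- 𝟘
            := (:- (h′ :* l′)) :* (h :* l ᶜ :- (:- (g ᶜ :* l))) :+ h :* l :* (h′ :* l′ ᶜ :- (:- (g′ ᶜ :* l′)))
              :+ (:- (l :* l′)) :* (h :* g′ ᶜ :- g ᶜ :* h′)) refl D.g D.h l D′.g D′.h l′)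
        multiple : ∃ λ r → r ∈ Fix × L′ s′ ≡ r * L s₀
        multiple = wedge-zero L≢0 (*-cancel-0 (*-nonzero (h≢0 D) (h≢0 D′))
          (parallel-wedge (Lᵗ-conj D.d≢0 D.hd̄≡dg D.Ng≢1 s₀) (Lᵗ-conj D′.d≢0 D′.hd̄≡dg D′.Ng≢1 s′)))
        -- The choice of `s` makes the coefficients of `ȳ` agree, and the elation `b` then makes
        -- those of `y` agree.
        s b : 𝔽
        s = proj₁ multiple * s₀
        b = M′ s′ - M s
        L≡ : L s ≡ L′ s′
        L≡ = trans (Lᵗ-scale D.d≢0 D.hd̄≡dg D.Ng≢1 s₀ (proj₁ (proj₂ multiple))) (sym (proj₂ (proj₂ multiple)))
        n k : Lineη
        n = proj₁ (graph-line (0# + M′ s′) (L′ s′))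
        k = proj₁ (chord-line {d} {1#} b D.d≢0 1≢0)
        hn : W n ≃ Graph (0# + M′ s′) (L′ s′)
        hn = proj₂ (graph-line (0# + M′ s′) (L′ s′))
        hk : W k ≃ Chord d b 1#
        hk = proj₂ (chord-line {d} {1#} b D.d≢0 1≢0)
        not-Reg : ∀ {c d} → ¬ Reg c d n
        not-Reg (inj₁ h)           = Infinity≄Graph {n} h hn
        not-Reg (inj₂ (r , _ , h)) = L′≢0 (proj₂ (Graph-injective {n} hn h))
        n∈T′ : D′.T n
        n∈T′ = outof D′.T⇔ n (inj₁ (inj₂ (s′ , ≃-trans hn (≃-sym (Twisted≃Graph-ML D′.d≢0 D′.hd̄≡dg D′.Ng≢1 0# s′))) , not-Reg))
        n∈T : image b D.T n
        n∈T = outof (image-form D b) n (inj₁ (inj₂ (s , ≃-trans hn′ (≃-sym (Twisted≃Graph-ML D.d≢0 D.hd̄≡dg D.Ng≢1 b s))) , not-Reg))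
          where
          hn′ : W n ≃ Graph (b + M s) (L s)
          hn′ = subst₂ (λ u v → W n ≃ Graph u v) (solve 2 (λ u v → 𝟘 :+ u := u :- v :+ v) refl (M′ s′) (M s)) (sym L≡) hn
        -- Sharing `n`, the translate of `T` and `T′` coincide, so the chord `k` of the translate
        -- lies in `T′`. There it can only belong to the opposite regulus, which makes `d′` a fixed
        -- multiple of `d`.
        k∈T′ : D′.T k
        k∈T′ = proj₁ (unique n (image b D.T) D′.T (E-inv b D.T D.T∈Π) D′.T∈Π n∈T n∈T′) {k}
          (outof (image-form D b) k (inj₂ (chord-Opposite {b} {d} {k} D.d≢0 hk)))
        proportional : ∃₂ λ e f → e ∈ Fix × f ∈ Fix × 0# * 1# ≡ b + d * e × d′ * 1# ≡ d * f
        proportional = [ (λ (k∈ , _) → contradiction hk (TwistedSpread≄Chord D′.d≢0 D′.hd̄≡dg D′.Ng≢1 {0#} {k} D.d≢0 1≢0 k∈)) ,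
          Opposite-chord {0#} {d′} {k} hk ]′ (into D′.T⇔ k k∈T′)
        f : 𝔽
        f = proj₁ (proj₂ proportional)
        hf : f ∈ Fix
        hf = proj₁ (proj₂ (proj₂ (proj₂ proportional)))
        d′≡ : d′ ≡ d * f
        d′≡ = trans (sym (*-identityʳ d′)) (proj₂ (proj₂ (proj₂ (proj₂ (proj₂ proportional)))))

  -- The good set of an invariant parallelism

  module Representation (Π : Pred LineSet 0ℓ) (hall-parallelism : IsHallParallelism Π) (E-inv : E-invariant Π) where
    open Classification Π hall-parallelism E-inv
    open IsHallParallelism hall-parallelism
    open IsParallelism isParallelism
    open HallData

    data-at : ∀ i → HallData (direction i)
    data-at i = hall-data (direction≢0 i)

    α-index : ∀ i → ∃ λ j → N (Λ j) ≡ N (g (data-at i))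
    α-index i = norm-onto (N-∈Fix _) (*-nonzero (g≢0 (data-at i)) (conj-≢0 (g≢0 (data-at i))))

    -- `α i` has the norm of `g`, which is also the norm of `h`. Since `N η = 1`, dividing `η h̄`
    -- and `η ḡ` by `α i` gives elements of norm 1.
    α α⁻¹ u v : Fin (suc q) → 𝔽
    α i = Λ (proj₁ (α-index i))
    α⁻¹ i = proj₁ (inverse (α i) (Λ-nonzero _))
    u i = η * conj (h (data-at i)) * α⁻¹ i
    v i = η * conj (g (data-at i)) * α⁻¹ i

    αα⁻¹≡1 : ∀ i → α i * α⁻¹ i ≡ 1#
    αα⁻¹≡1 i = proj₂ (inverse (α i) (Λ-nonzero _))

    αu≡ : ∀ i → α i * u i ≡ η * conj (h (data-at i))
    αu≡ i = combine₁ (αα⁻¹≡1 i) z (solve 3 (λ a b z → a :* (z :* b) :- z := z :* (a :* b :- 𝟙)) refl (α i) (α⁻¹ i) z)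
      where
      z : 𝔽
      z = η * conj (h (data-at i))

    αv≡ : ∀ i → α i * v i ≡ η * conj (g (data-at i))
    αv≡ i = combine₁ (αα⁻¹≡1 i) z (solve 3 (λ a b z → a :* (z :* b) :- z := z :* (a :* b :- 𝟙)) refl (α i) (α⁻¹ i) z)
      where
      z : 𝔽
      z = η * conj (g (data-at i))

    unit-quotient : ∀ {a b x y} → a * b ≡ 1# → N a ≡ N y → N x ≡ N y → N (η * conj x * b) ≡ 1#
    unit-quotient {a} {b} {x} {y} ab≡1 ea ex = trans
      (solve 3 (λ b x e → (e :* x ᶜ :* b) :* (e :* x ᶜ :* b) ᶜ := e :* e ᶜ :* ((x :* x ᶜ) :* (b :* b ᶜ))) refl b x η)
      (trans (cong₂ (λ p r → p * (r * N b)) N-η (trans ex (sym ea)))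
        (trans (solve 2 (λ a b → 𝟙 :* (a :* a ᶜ :* (b :* b ᶜ)) := (a :* b) :* (a :* b) ᶜ) refl a b)
          (trans (cong N ab≡1) (solve 1 (λ z → 𝟙 :* 𝟙 ᶜ := 𝟙) refl 0#))))

    Nu≡1 : ∀ i → N (u i) ≡ 1#
    Nu≡1 i = unit-quotient (αα⁻¹≡1 i) (proj₂ (α-index i)) (Nh≡ (data-at i))

    Nv≡1 : ∀ i → N (v i) ≡ 1#
    Nv≡1 i = unit-quotient {x = g (data-at i)} (αα⁻¹≡1 i) (proj₂ (α-index i)) refl

    -- The two products are `η²` times the conjugates of `h g′` and `g h′`.
    uv-distinct : ∀ i j → i ≢ j → (α i * u i) * (α j * v j) ≢ (α i * v i) * (α j * u j)
    uv-distinct i j i≢j e = h*g-distinct (data-at i) (data-at j) (direction-wedge i j i≢j)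
      (combine₂ (cong conj e′) (η * η) N-η (- ((η * conj η + 1#) * (hᵢ * gⱼ - gᵢ * hⱼ)))
        (solve 5 (λ h g h′ g′ e → h :* g′ :- g :* h′ := e :* e :* ((e :* h ᶜ :* (e :* g′ ᶜ)) ᶜ :- (e :* g ᶜ :* (e :* h′ ᶜ)) ᶜ)
          :+ (:- ((e :* e ᶜ :+ 𝟙) :* (h :* g′ :- g :* h′))) :* (e :* e ᶜ :- 𝟙)) refl hᵢ gᵢ hⱼ gⱼ η))
      where
      hᵢ gᵢ hⱼ gⱼ : 𝔽
      hᵢ = h (data-at i)
      gᵢ = g (data-at i)
      hⱼ = h (data-at j)
      gⱼ = g (data-at j)
      e′ : η * conj hᵢ * (η * conj gⱼ) ≡ η * conj gᵢ * (η * conj hⱼ)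
      e′ = subst₂ _≡_ (cong₂ _*_ (αu≡ i) (αv≡ j)) (cong₂ _*_ (αv≡ i) (αu≡ j)) e

    -- Here `η` meets its conjugate and cancels: the two products are the conjugates of `h ḡ′` and
    -- `ḡ h′`.
    uv̄-distinct : ∀ i j → i ≢ j → (α i * u i) * conj (α j * v j) ≢ conj (α i * v i) * (α j * u j)
    uv̄-distinct i j i≢j e = hḡ-distinct (data-at i) (data-at j) (direction-wedge i j i≢j)
      (combine₂ (cong conj e′) 1# N-η (- (hᵢ * conj gⱼ - conj gᵢ * hⱼ))
        (solve 5 (λ h g h′ g′ e → h :* g′ ᶜ :- g ᶜ :* h′ := 𝟙 :* ((e :* h ᶜ :* (e :* g′ ᶜ) ᶜ) ᶜ :- ((e :* g ᶜ) ᶜ :* (e :* h′ ᶜ)) ᶜ)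
          :+ (:- (h :* g′ ᶜ :- g ᶜ :* h′)) :* (e :* e ᶜ :- 𝟙)) refl hᵢ gᵢ hⱼ gⱼ η))
      where
      hᵢ gᵢ hⱼ gⱼ : 𝔽
      hᵢ = h (data-at i)
      gᵢ = g (data-at i)
      hⱼ = h (data-at j)
      gⱼ = g (data-at j)
      e′ : η * conj hᵢ * conj (η * conj gⱼ) ≡ conj (η * conj gᵢ) * (η * conj hⱼ)
      e′ = subst₂ _≡_ (cong₂ (λ a b → a * conj b) (αu≡ i) (αv≡ j)) (cong₂ (λ a b → conj a * b) (αv≡ i) (αu≡ j)) e

    same-plane : ∀ {c c′} → π⟨ c ⟩ ≐ π⟨ c′ ⟩ → c ≡ c′
    same-plane {c} {c′} (⊆ , _) = trans (⊆ {point (0# ∷ 1# ∷ 0# ∷ c ∷ []) (1≢0 ∘ cong (Vec.head ∘ Vec.tail))} (sym (*-identityʳ c))) (*-identityʳ c′)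

    same-point : ∀ {c c′} → P⟨ c ⟩ ∼ vec P⟨ c′ ⟩ → c ≡ c′
    same-point {c} {c′} (k , e) with vec4-injective e
    ... | 1≡k , _ , c≡kc′ , _ = combine₂ c≡kc′ 1# 1≡k (- c′) (solve 3 (λ c c′ k → c :- c′ := 𝟙 :* (c :- k :* c′) :+ (:- c′) :* (𝟙 :- k :* 𝟙)) refl c c′ k)

    good-set : GoodSet
    good-set = record
      { α = α ; u = u ; v = v
      ; α∈ℐ = λ i → (proj₁ (α-index i) , refl) , [ (λ a∈A → inj₁ (subst A (sym (norm-α i)) a∈A)) ,
          (λ (odd , e) → inj₂ (odd , trans (norm-α i) e)) ]′ (admissible (data-at i))
      ; u∈𝒰 = λ i → trans (norm≡ (u i)) (Nu≡1 i)
      ; v∈𝒰 = λ i → trans (norm≡ (v i)) (Nv≡1 i)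
      ; distinct-pairs = λ i j i≢j (P∼ , π≐) → uv-distinct i j i≢j
          (trans (cong₂ _*_ (same-point P∼) (sym (same-plane π≐))) (*-comm _ _))
      ; good = λ i j ≢ → let i≢j = λ i≡j → ≢ (cong (λ k → α k , u k , v k) i≡j) in
          (λ e → uv-distinct i j i≢j (combine₁ e (α i * α j) (solve 6 (λ a b u v u′ v′ → a :* u :* (b :* v′) :- a :* v :* (b :* u′)
            := a :* b :* ((u :* v′ :- v :* u′) :- 𝟘)) refl (α i) (α j) (u i) (v i) (u j) (v j)))) ,
          (λ e → uv̄-distinct i j i≢j (trans (cong (α i * u i *_) (conj≡^q (α j * v j)))
            (trans (x-y≡0⇒x≡y e) (cong (_* (α j * u j)) (sym (conj≡^q (α i * v i)))))))
      }
      where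
      norm-α : ∀ i → norm (α i) ≡ N (g (data-at i))
      norm-α i = trans (norm≡ (α i)) (proj₂ (α-index i))

    module Pencil-at (i : Fin (suc q)) = Pencil {α i} {u i} {v i} (Λ-nonzero _) (Nu≡1 i) (Nv≡1 i)

    Switched-at : Fin (suc q) → 𝔽 → Lineη → Set
    Switched-at i c = Switched (g (data-at i)) (h (data-at i)) (direction i) c

    -- By the choice of `u` and `v`, the spanning vectors of the pencil line are `apex` and `foot`.
    switch-form : ∀ i c ℓ → on ℓ ≐ ⟨ Pencil-at.e₁ i , Pencil-at.e₂ i c ⟩ → switch (𝒮 ℓ) (ℛ ℓ) ⇔ₛ Switched-at i c
    switch-form i c ℓ on-ℓ = switch⇔Switched {𝒮 ℓ} {ℛ ℓ} 𝒮⇔ ℛ⇔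
      where
      D : HallData (direction i)
      D = data-at i
      on-ℓ′ : on ℓ ≐ ⟨ apex c (Ng≢1 D) (Nh≢1 D) , foot c (Ng≢1 D) (Nh≢1 D) ⟩
      on-ℓ′ = subst₂ (λ a b → on ℓ ≐ ⟨ a , b ⟩) (vec4 refl refl (αu≡ i) refl)
        (vec4 refl refl (cong (_* conj c) (αv≡ i)) (αv≡ i)) on-ℓ
      𝒮⇔ : 𝒮 ℓ ⇔ₛ TwistedSpread (g D) (h D) c
      𝒮⇔ = equivₛ (λ m → joins⇒TwistedSpread c (Ng≢1 D) (Nh≢1 D) {on ℓ} on-ℓ′ {m})
           (λ m → TwistedSpread⇒joins c (Ng≢1 D) (Nh≢1 D) {on ℓ} on-ℓ′ {m})
      ℛ⇔ : ℛ ℓ ⇔ₛ Reg c (direction i)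
      ℛ⇔ = equivₛ (λ m (m∈𝒟 , m∈𝒮) → Dη∩TwistedSpread⇒Reg (d≢0 D) (hd̄≡dg D) (Ng≢1 D) (g≢0 D) {c} {m} (𝒟η⇒Dη {m} m∈𝒟) (into 𝒮⇔ m m∈𝒮))
           (λ m r → Dη⇒𝒟η {m} (Reg⇒Dη (d≢0 D) (hd̄≡dg D) (Ng≢1 D) {c} {m} r) ,
             outof 𝒮⇔ m (Reg⇒TwistedSpread (d≢0 D) (hd̄≡dg D) (Ng≢1 D) {c} {m} r))

    -- The switched spread of the pencil line with parameter `c` is the image under the elation `c`
    -- of the member chosen for that direction.
    Π⟨good-set⟩⊆Π : Π⟨ good-set ⟩ ⊆ Π
    Π⟨good-set⟩⊆Π {T′} (inj₂ (⊆ , ⊇)) = respects {𝒟η} {T′} ((λ {m} → ⊇ {m}) , (λ {m} → ⊆ {m})) 𝒟η∈Π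
    Π⟨good-set⟩⊆Π {T′} (inj₁ (ℓ , (ℓ≢r , i , ℓ∈) , T′≐)) = from-form (Pencil-at.pencil-form i ℓ ℓ∈ ℓ≢r)
      where
      from-form : (∃ λ c → on ℓ ≐ ⟨ Pencil-at.e₁ i , Pencil-at.e₂ i c ⟩) → Π T′
      from-form (c , on-ℓ) = respects {image c (T (data-at i))} {T′}
        (⇔ₛ⇒≐ (⇔ₛ-trans (image-form (data-at i) c) (⇔ₛ-sym (⇔ₛ-trans (≐⇒⇔ₛ T′≐) (switch-form i c ℓ on-ℓ)))))
        (E-inv c (T (data-at i)) (T∈Π (data-at i)))

    -- A member of Π over the regulus of direction d′ through c, translated by -c,
    -- contains the chord of direction d′ through the origin, hence is T.
    module _ {T′ S R : LineSet} (T′∈Π : Π T′) (R-reg : IsRegulusThroughR R) (T′≐ : T′ ≐ switch S R) where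

      translated-member : ∀ {c d′ r} i → d′ ≢ 0# → (∀ m → R m → Reg c d′ m) → r ∈ Fix → r ≢ 0# → d′ ≡ r * direction i →
        T′ ⇔ₛ Switched-at i c
      translated-member {c} {d′} {r} i d′≢0 R⇒ hr r≢0 d′≡ = equivₛ forth back
        where
        D : HallData (direction i)
        D = data-at i
        k : Lineη
        k = proj₁ (chord-line {d′} {1#} c d′≢0 1≢0)
        hk : W k ≃ Chord d′ c 1#
        hk = proj₂ (chord-line {d′} {1#} c d′≢0 1≢0)
        k∈T′ : T′ k
        k∈T′ = proj₂ T′≐ {k} (inj₂ (Opposite⇒opposite {R} {k} λ l l∈R → chord-Opposite {c} {d′} {k} d′≢0 hk l (R⇒ l l∈R)))
        i⁻¹ : 𝔽
        i⁻¹ = proj₁ (inverse r r≢0)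
        ri⁻¹≡1 : r * i⁻¹ ≡ 1#
        ri⁻¹≡1 = proj₂ (inverse r r≢0)
        shifted-chord : W (m D) ≃ Shifted (- c) (W k)
        shifted-chord = equiv
          (λ {x} {y} w → let ρ , σ , hρ , hσ , ex , ey = to (hm D) w in from hk (ρ * i⁻¹ , σ , Fix-* hρ (Fix-inverse ri⁻¹≡1 hr) , hσ ,
            combine₄ ex 1# ey c d′≡ (- (ρ * i⁻¹)) ri⁻¹≡1 (- (ρ * direction i))
              (solve 9 (λ x y c ρ σ j d′ r d → (x :- (:- c) :* y) :- (ρ :* j :* d′ :+ σ :* c)
                := 𝟙 :* (x :- (ρ :* d :+ σ :* 𝟘)) :+ c :* (y :- σ :* 𝟙) :+ (:- (ρ :* j)) :* (d′ :- r :* d)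
                  :+ (:- (ρ :* d)) :* (r :* j :- 𝟙)) refl x y c ρ σ i⁻¹ d′ r (direction i)) , ey))
          (λ {x} {y} w → let ρ , σ , hρ , hσ , ex , ey = to hk w in from (hm D) (ρ * r , σ , Fix-* hρ hr , hσ ,
            combine₃ ex 1# ey (- c) d′≡ ρ (solve 8 (λ x y c ρ σ d′ r d → x :- (ρ :* r :* d :+ σ :* 𝟘)
              := 𝟙 :* ((x :- (:- c) :* y) :- (ρ :* d′ :+ σ :* c)) :+ (:- c) :* (y :- σ :* 𝟙) :+ ρ :* (d′ :- r :* d)) refl x y c ρ σ d′ r (direction i)) , ey))
        T″≐T : image (- c) T′ ≐ T D
        T″≐T = unique (m D) (image (- c) T′) (T D) (E-inv (- c) T′ T′∈Π) (T∈Π D) (⇒image (- c) T′ (m D) k k∈T′ shifted-chord) (m∈T D)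
        unshift : ∀ {n l} → W n ≃ Shifted (- c) (W l) → W l ≃ Shifted c (W n)
        unshift {n} {l} hn = subst (λ z → W l ≃ Shifted z (W n)) (solve 1 (λ c → :- (:- c) := c) refl c) (Shifted-inverse { - c} {n} {l} hn)
        forth : ∀ l → T′ l → Switched-at i c l
        forth l l∈T′ = let n , hn = translate (- c) l in
          Switched-shift {m = l} {n} (sym (+-identityˡ c)) (unshift {n} {l} hn)
            (into (T⇔ D) n (proj₁ T″≐T {n} (⇒image (- c) T′ n l l∈T′ hn)))
        back : ∀ l → Switched-at i c l → T′ l
        back l l∈ = let n , hn = translate (- c) l
                        l′ , l′∈T′ , hn′ = image⇒ (- c) T′ n (proj₂ T″≐T {n} (outof (T⇔ D) n
                          (Switched-shift {m = n} {l} (sym (-‿inverseʳ c)) hn l∈)))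
          in IsSpread.respects (spread T′ T′∈Π) {l′} {l} (≃⇒≈ {l′} {l} (≃-trans (unshift {n} {l′} hn′) (≃-sym (unshift {n} {l} hn)))) l′∈T′

      hall∈Π⟨good-set⟩ : Π⟨ good-set ⟩ T′
      hall∈Π⟨good-set⟩ = let c , d′ , d′≢0 , R⇒ , _ = regulus-form R-reg
                             i , r , hr , r≢0 , d′≡ = direction-onto d′≢0
        in inj₁ (Pencil-at.line i c , (Pencil-at.line≢r i c , i , Pencil-at.line∈pencil i c) ,
             ⇔ₛ⇒≐ (⇔ₛ-trans (translated-member i d′≢0 R⇒ hr r≢0 d′≡)
               (⇔ₛ-sym (switch-form i c (Pencil-at.line i c) ((λ {P} → id) , (λ {P} → id))))))

    Π⊆Π⟨good-set⟩ : Π ⊆ Π⟨ good-set ⟩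
    Π⊆Π⟨good-set⟩ {T′} T′∈Π with proj₁ members {T′} T′∈Π
    ... | inj₁ T′≐𝒟η = inj₂ T′≐𝒟η
    ... | inj₂ (k , T′≐hall) = let S , R , R-reg , _ , _ , T′≐ = ≐-hall {T′} {k} T′≐hall in
      hall∈Π⟨good-set⟩ {T′} {S} {R} T′∈Π R-reg T′≐

open import Data.Nat using (_^_)

theorem3p6 : (q : ℕ) → 3 ≤ q → IsPrimePower q →
    (F : FiniteField (q ^ 2)) →
    (setting : Geometry.Setting q F) →
    let open Geometry.Construction q F setting in
    (Π : Pred LineSet 0ℓ) → IsHallParallelism Π → E-invariant Π →
    Σ GoodSet λ 𝒫 → Π ≐ Π⟨ 𝒫 ⟩
theorem3p6 q 3≤q pp F setting Π hall-parallelism E-inv = good-set , (λ {T} → Π⊆Π⟨good-set⟩ {T}) , (λ {T} → Π⟨good-set⟩⊆Π {T})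
  where open HallParallelisms.Representation q 3≤q pp F setting Π hall-parallelism E-inv
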